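{- Let $q\ge9$ be a power of $3$. The EA-lines form three $G_q$-orbits, of sizes $q^3-q$, $\frac12(q^2-1)$, $\frac12(q^2-1)$; let $\mathcal O_1$ be the orbit of size $q^3-q$, and label the two orbits of size $\frac12(q^2-1)$ as $\mathcal O_2,\mathcal O_3$ suitably. Writing $\Pi_{\pi,j}$ for the number of $\pi$-planes through any line of $\mathcal O_j$ and $\Lambda_{j,\pi}$ for the number of lines of $\mathcal O_j$ in a $\pi$-plane, we have: $\Pi_{2_{\mathcal C},1}=\Lambda_{2,3_{\mathcal C}}=\Lambda_{2,0_{\mathcal C}}=\Lambda_{3,\overline{1_{\mathcal C}}}=1$; $\Lambda_{1,2_{\mathcal C}}=\Lambda_{1,\overline{1_{\mathcal C}}}=q-1$; $\Pi_{\pi,2}=\Lambda_{2,\pi}=0$ for $\pi\in\{2_{\mathcal C},\overline{1_{\mathcal C}}\}$, and $\Pi_{\pi,3}=\Lambda_{3,\pi}=0$ for $\pi\in\{2_{\mathcal C},3_{\mathcal C},0_{\mathcal C}\}$; $\Pi_{\overline{1_{\mathcal C}},3}=\Lambda_{1,0_{\mathcal C}}=q$; $\Pi_{3_{\mathcal C},2}=\Pi_{0_{\mathcal C},1}=\frac13q$; $\Pi_{0_{\mathcal C},2}=\frac23q$; $\Pi_{3_{\mathcal C},1}=\frac16(q-3)$, $\Lambda_{1,3_{\mathcal C}}=q-3$; $\Pi_{\overline{1_{\mathcal C}},1}=\frac12(q-1)$.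
   Context: Let $\mathrm{PG}(3,q)$ have points $\mathbf{P}(x_0,x_1,x_2,x_3)$; put $P(t)=\mathbf{P}(t^3,t^2,t,1)$ ($t\in\mathbb{F}_q$), $P(\infty)=\mathbf{P}(1,0,0,0)$, $\mathcal{C}=\{P(t):t\in\mathbb{F}_q\cup\{\infty\}\}$ the twisted cubic, $G_q$ the group of projectivities fixing $\mathcal C$. Write $\boldsymbol{\pi}(c_0,c_1,c_2,c_3)$ for the plane $c_0x_0+c_1x_1+c_2x_2+c_3x_3=0$. $\Gamma$-planes: osculating planes $\boldsymbol{\pi}(1,-3t,3t^2,-t^3)$ ($t\in\mathbb{F}_q$) and $\boldsymbol{\pi}(0,0,0,1)$; for $q\equiv0\pmod3$ they all contain a common line, the axis $\mathrm{A}$. A $d_{\mathcal C}$-plane ($d\in\{0,2,3\}$) contains exactly $d$ points of $\mathcal C$; a $\overline{1_{\mathcal C}}$-plane is a non-$\Gamma$-plane with exactly one point of $\mathcal C$ (each plane type is a $G_q$-orbit for $q\ge5$). An EA-line is a line containing no point of $\mathcal C$, different from $\mathrm{A}$, meeting $\mathrm{A}$. Known fact: for $q\equiv0\pmod 3$, $q\ge9$, the EA-lines form exactly three $G_q$-orbits, of sizes $q^3-q$, $\frac12(q^2-1)$, $\frac12(q^2-1)$, namely the orbits of the lines through $\mathbf{P}(0,1,0,0)$ and respectively $\mathbf{P}(0,0,1,1)$, $\mathbf{P}(1,0,1,0)$, $\mathbf{P}(1,0,\rho,0)$, with $\rho$ a non-square in $\mathbb{F}_q$. -}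

module Defs where

open import Data.Nat using (ℕ; _≤_; _^_)
open import Data.Fin using (Fin; _<_) renaming (zero to f0; suc to fs)
open import Data.Maybe using (Maybe; just; nothing)
open import Data.Vec using (Vec; []; _∷_; lookup; zipWith; map)
open import Data.List using (List; length)
open import Data.List.Relation.Unary.Unique.Propositional using (Unique)
open import Data.List.Membership.Propositional using (_∈_)
open import Data.Product using (Σ; _×_; _,_; ∃-syntax)
open import Data.Sum using (_⊎_)
open import Relation.Binary.PropositionalEquality using (_≡_)
open import Relation.Binary.Definitions using (DecidableEquality)
open import Relation.Nullary using (¬_)
open import Function.Bundles using (_↔_; _⇔_)
open import Algebra.Structures using (IsCommutativeRing)

record FiniteField : Set₁ where
  infixl 6 _+_
  infixl 7 _*_
  field
    F          : Set
    _≟_        : DecidableEquality F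
    _+_ _*_    : F → F → F
    -_         : F → F
    0# 1#      : F
    isCommRing : IsCommutativeRing _≡_ _+_ _*_ -_ 0# 1#
    0≢1        : ¬ (0# ≡ 1#)
    inverse    : (x : F) → ¬ (x ≡ 0#) → Σ F (λ y → x * y ≡ 1#)
    size       : ℕ
    enum       : F ↔ Fin size

Count : {A : Set} → (A → Set) → ℕ → Set
Count {A} P n = Σ (List A) λ xs → Unique xs × length xs ≡ n × ((x : A) → P x ⇔ x ∈ xs)

module Geometry (K : FiniteField) where
  open FiniteField K

  V4 : Set
  V4 = Vec F 4

  M4 : Set
  M4 = Vec V4 4

  vec : F → F → F → F → V4
  vec a b c d = a ∷ b ∷ c ∷ d ∷ []

  zeroV : V4
  zeroV = vec 0# 0# 0# 0#

  _·_ : F → V4 → V4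
  a · u = map (a *_) u

  _⊕_ : V4 → V4 → V4
  u ⊕ v = zipWith _+_ u v

  dot : V4 → V4 → F
  dot (a ∷ b ∷ c ∷ d ∷ []) (a' ∷ b' ∷ c' ∷ d' ∷ []) = a * a' + b * b' + c * c' + d * d'

  apply : M4 → V4 → V4
  apply M x = map (λ row → dot row x) M

  mmul : M4 → M4 → M4
  mmul A B = map (λ row → map (λ col → dot row col) BT) A
    where
    BT : M4
    BT = map (λ r → lookup r f0) B ∷ map (λ r → lookup r (fs f0)) B
         ∷ map (λ r → lookup r (fs (fs f0))) B ∷ map (λ r → lookup r (fs (fs (fs f0)))) B ∷ []

  idM : M4
  idM = vec 1# 0# 0# 0# ∷ vec 0# 1# 0# 0# ∷ vec 0# 0# 1# 0# ∷ vec 0# 0# 0# 1# ∷ []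

  -- proportionality (same projective point / same plane)
  _∼_ : V4 → V4 → Set
  x ∼ y = Σ F λ c → ¬ (c ≡ 0#) × x ≡ c · y

  Lead : V4 → Fin 4 → Set
  Lead u i = ((k : Fin 4) → k < i → lookup u k ≡ 0#) × lookup u i ≡ 1#

  -- canonical representatives of points / planes of PG(3,q)
  Normalized : V4 → Set
  Normalized u = Σ (Fin 4) (Lead u)

  -- canonical representatives of lines: 2×4 matrices (rows u, v) in
  -- reduced row echelon form of rank 2; the line is the span of u, v
  RREF : V4 × V4 → Set
  RREF (u , v) = Σ (Fin 4) λ i → Σ (Fin 4) λ j → i < j × Lead u i × Lead v j × lookup u j ≡ 0#

  InSpan : V4 → V4 × V4 → Set
  InSpan x (u , v) = Σ F λ a → Σ F λ b → x ≡ (a · u) ⊕ (b · v)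

  OnPlane : V4 → V4 → Set
  OnPlane x c = dot c x ≡ 0#

  ContainsLine : V4 → V4 × V4 → Set
  ContainsLine c (u , v) = OnPlane u c × OnPlane v c

  -- the twisted cubic: P(t) = (t³,t²,t,1), P(∞) = (1,0,0,0)
  P : Maybe F → V4
  P (just t) = vec (t * t * t) (t * t) t 1#
  P nothing  = vec 1# 0# 0# 0#

  OnC : V4 → Set
  OnC x = Σ (Maybe F) λ t → x ∼ P t

  CPointsOn : V4 → ℕ → Set
  CPointsOn c n = Count (λ x → Normalized x × OnC x × OnPlane x c) n

  three : F
  three = 1# + 1# + 1#

  -- Γ-planes: osculating planes π(1,-3t,3t²,-t³) and π(0,0,0,1)
  GammaPlane : V4 → Set
  GammaPlane c = (Σ F λ t → c ∼ vec 1# (- (three * t)) (three * (t * t)) (- (t * t * t)))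
               ⊎ c ∼ vec 0# 0# 0# 1#

  data PlaneType : Set where
    2C 3C 0C 1̄C : PlaneType

  HasType : PlaneType → V4 → Set
  HasType 2C  c = CPointsOn c 2
  HasType 3C  c = CPointsOn c 3
  HasType 0C  c = CPointsOn c 0
  HasType 1̄C c = ¬ GammaPlane c × CPointsOn c 1

  InG : M4 → Set
  InG M = (Σ M4 λ N → mmul M N ≡ idM × mmul N M ≡ idM)
        × ((t : Maybe F) → Σ (Maybe F) λ s → apply M (P t) ∼ P s)

  Orbit : V4 × V4 → V4 × V4 → Set
  Orbit (u , v) ℓ' = Σ M4 λ M → InG M × InSpan (apply M u) ℓ' × InSpan (apply M v) ℓ'

  PiIs : PlaneType → (V4 × V4 → Set) → ℕ → Set
  PiIs π O n = (ℓ : V4 × V4) → RREF ℓ → O ℓ →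
               Count (λ c → Normalized c × HasType π c × ContainsLine c ℓ) n

  LamIs : (V4 × V4 → Set) → PlaneType → ℕ → Set
  LamIs O π n = (c : V4) → Normalized c → HasType π c →
                Count (λ ℓ → RREF ℓ × O ℓ × ContainsLine c ℓ) n

  ℓ₁ : V4 × V4
  ℓ₁ = vec 0# 1# 0# 0# , vec 0# 0# 1# 1#

  ℓ₂ : V4 × V4
  ℓ₂ = vec 0# 1# 0# 0# , vec 1# 0# 1# 0#

  ℓ₃ : F → V4 × V4
  ℓ₃ ρ = vec 0# 1# 0# 0# , vec 1# 0# ρ 0#

  NonSquare : F → Set
  NonSquare ρ = (x : F) → ¬ (x * x ≡ ρ)

  record Claims (O₁ O₂ O₃ : V4 × V4 → Set) : Set where
    field
      Π-2C-1  : PiIs 2C O₁ 1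
      Λ-2-3C  : LamIs O₂ 3C 1
      Λ-2-0C  : LamIs O₂ 0C 1
      Λ-3-1̄C  : LamIs O₃ 1̄C 1
      Λ-1-2C  : LamIs O₁ 2C (size Data.Nat.∸ 1)
      Λ-1-1̄C  : LamIs O₁ 1̄C (size Data.Nat.∸ 1)
      Π-2C-2  : PiIs 2C O₂ 0
      Λ-2-2C  : LamIs O₂ 2C 0
      Π-1̄C-2  : PiIs 1̄C O₂ 0
      Λ-2-1̄C  : LamIs O₂ 1̄C 0
      Π-2C-3  : PiIs 2C O₃ 0
      Λ-3-2C  : LamIs O₃ 2C 0
      Π-3C-3  : PiIs 3C O₃ 0
      Λ-3-3C  : LamIs O₃ 3C 0
      Π-0C-3  : PiIs 0C O₃ 0
      Λ-3-0C  : LamIs O₃ 0C 0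
      Π-1̄C-3  : PiIs 1̄C O₃ size
      Λ-1-0C  : LamIs O₁ 0C size
      Π-3C-2  : PiIs 3C O₂ (size Data.Nat./ 3)
      Π-0C-1  : PiIs 0C O₁ (size Data.Nat./ 3)
      Π-0C-2  : PiIs 0C O₂ ((2 Data.Nat.* size) Data.Nat./ 3)
      Π-3C-1  : PiIs 3C O₁ ((size Data.Nat.∸ 3) Data.Nat./ 6)
      Λ-1-3C  : LamIs O₁ 3C (size Data.Nat.∸ 3)
      Π-1̄C-1  : PiIs 1̄C O₁ ((size Data.Nat.∸ 1) Data.Nat./ 2)

PowerOf3≥9 : ℕ → Set
PowerOf3≥9 q = Σ ℕ λ h → 2 ≤ h × q ≡ 3 ^ h

{-# OPTIONS --safe #-}
module Submission where

-- In characteristic 3 the Γ-planes are the planes through the axis, and every other plane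
-- meets the axis in one point; by the action of G that point may be taken to be e₁ = (0,1,0,0).
-- The plane is then (c₀,0,c₂,c₃) with c₂ ≠ 0, and its points on the cubic are the roots of
-- c₀ t³ + c₂ t + c₃, an additive polynomial up to a constant: its type is decided by whether
-- c₀ d² + c₂ has a zero d (the difference of two roots) and whether there is a root at all.
-- Planes through a fixed line are counted by means of the three-to-one map z ↦ z³ - z and the
-- two-to-one map e ↦ - e².  For lines in a fixed plane one needs the group itself: an element
-- of G carries the cubic into its quadrics y² = xz, z² = yw, xw = yz, and comparing coefficients
-- shows that the elements fixing P(∞) are exactly the maps t ↦ k t + s.

open import Defs
open import Algebra.Bundles using (RawRing; CommutativeRing)
import Algebra.Solver.Ring
open import Algebra.Solver.Ring.AlmostCommutativeRing
  using (AlmostCommutativeRing; fromCommutativeRing; _-Raw-AlmostCommutative⟶_)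
open import Data.Empty using (⊥-elim)
open import Data.Fin using (Fin; _<_) renaming (zero to f0; suc to fs)
import Data.Fin.Properties as Fin
open import Data.List using (List; []; _∷_; length; _++_; filter; tabulate)
open import Data.List.Membership.Propositional using (_∈_; _∉_; find; lose)
open import Data.List.Membership.Propositional.Properties
  using (∈-∃++; ∈-++⁺ˡ; ∈-++⁺ʳ; ∈-++⁻; ∈-filter⁺; ∈-filter⁻; ∈-tabulate⁺)
open import Data.List.Properties using (length-++; length-tabulate)
open import Data.List.Relation.Unary.All as All using (All; []; _∷_)
open import Data.List.Relation.Unary.All.Properties using (¬Any⇒All¬; All¬⇒¬Any)
open import Data.List.Relation.Unary.AllPairs using ([]; _∷_)
open import Data.List.Relation.Unary.Any using (here; there; any?)
open import Data.List.Relation.Unary.Unique.Propositional using (Unique)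
import Data.List.Relation.Unary.Unique.Propositional.Properties as Unique
open import Data.Maybe using (Maybe; just; nothing)
open import Data.Maybe.Properties using (≡-dec)
open import Data.Nat as ℕ using (ℕ; suc; _≤_; _∸_; z≤n; s≤s)
open import Data.Nat.DivMod using (m*n/n≡m)
import Data.Nat.Properties as ℕ
open import Data.Product using (Σ; _×_; _,_; proj₁; proj₂; ∃-syntax)
open import Data.Sum as Sum using (_⊎_; inj₁; inj₂; [_,_]′)
open import Data.Unit using (⊤; tt)
open import Data.Vec as Vec using (Vec; []; _∷_; lookup)
open import Data.Vec.Properties using (lookup-zipWith; lookup-map; lookup-replicate)
open import Function using (_∘_)
open import Function.Bundles using (mk⇔; Equivalence; Inverse)
open import Relation.Binary.Definitions using (DecidableEquality; tri<; tri≈; tri>)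
open import Relation.Binary.PropositionalEquality
open import Relation.Nullary using (¬_; Dec; yes; no)
open import Relation.Nullary.Decidable using (map′; _×-dec_; ¬?)
open import Relation.Unary using (Decidable)

-- An orbit consists of the images of one line under all matrices of `InG`, which are given only by
-- their effect on the cubic. For planes through an orbit line one representative line is enough,
-- since matrices preserve incidence and plane types. For orbit lines inside a plane one must also
-- exclude every other image, hence know all matrices. The link is the axis. In characteristic 3 the
-- tangent at P(t) meets it in (0, - t, 1, 0) and the tangent at P(∞) in `e₁`, so points of the axis
-- move like points of the cubic. Each of `ℓ₁`, `ℓ₂`, `ℓ₃ ρ` meets the axis in `e₁`; if an image
-- lies in a plane whose only axis point is `e₁`, the matrix fixes P(∞), and up to scalars two
-- parameters k ≠ 0 and s remain. For a line joining `e₁` to (1, 0, b, 0) incidence becomes c₀ k² +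
-- c₂ b = 0, a question of square classes that separates `ℓ₂` from `ℓ₃ ρ`. For `ℓ₁` incidence
-- determines k from s, and k = 0 happens exactly when s is a root of the cubic polynomial.
-- Comparing coefficients concerns products of degree 6, so at least seven field elements are
-- required; q ≥ 9 supplies them.

private variable
  A B : Set

-- Finite counting

Unique-⊆-length : {xs ys : List A} → Unique xs → (∀ {x} → x ∈ xs → x ∈ ys) → length xs ≤ length ys
Unique-⊆-length [] _ = z≤n
Unique-⊆-length {xs = x ∷ xs} (x∉ ∷ u) sub with ∈-∃++ (sub (here refl))
... | ps , qs , refl = subst (suc (length xs) ≤_) eq (s≤s (Unique-⊆-length u sub′))
  where
  eq : suc (length (ps ++ qs)) ≡ length (ps ++ x ∷ qs)
  eq = trans (cong suc (length-++ ps)) (trans (sym (ℕ.+-suc (length ps) (length qs))) (sym (length-++ ps)))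
  sub′ : ∀ {y} → y ∈ xs → y ∈ ps ++ qs
  sub′ y∈ with ∈-++⁻ ps (sub (there y∈))
  ... | inj₁ p = ∈-++⁺ˡ p
  ... | inj₂ (here refl) = ⊥-elim (All¬⇒¬Any x∉ y∈)
  ... | inj₂ (there q) = ∈-++⁺ʳ ps q

count-≤ : {P Q : A → Set} {m n : ℕ} → Count P m → Count Q n → (∀ x → P x → Q x) → m ≤ n
count-≤ (xs , uxs , refl , p) (ys , _ , refl , q) P⇒Q =
  Unique-⊆-length uxs (λ {x} x∈ → Equivalence.to (q x) (P⇒Q x (Equivalence.from (p x) x∈)))

count-unique : {P : A → Set} {m n : ℕ} → Count P m → Count P n → m ≡ n
count-unique c d = ℕ.≤-antisym (count-≤ c d λ _ p → p) (count-≤ d c λ _ p → p)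

count-cong : {P Q : A → Set} {n : ℕ} → (∀ x → P x → Q x) → (∀ x → Q x → P x) → Count P n → Count Q n
count-cong f g (xs , u , l , p) =
  xs , u , l , λ x → mk⇔ (Equivalence.to (p x) ∘ g x) (f x ∘ Equivalence.from (p x))

count-none : {P : A → Set} → (∀ x → ¬ P x) → Count P 0
count-none f = [] , [] , refl , λ x → mk⇔ (⊥-elim ∘ f x) (λ ())

count-one : {P : A → Set} (a : A) → P a → (∀ x → P x → x ≡ a) → Count P 1
count-one a pa f = a ∷ [] , [] ∷ [] , refl , λ x → mk⇔ (here ∘ f x) (λ { (here refl) → pa })

count-⊎ : {P Q : A → Set} {m n : ℕ} → Count P m → Count Q n → (∀ x → P x → ¬ Q x) →
          Count (λ x → P x ⊎ Q x) (m ℕ.+ n)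
count-⊎ (xs , uxs , refl , p) (ys , uys , refl , q) disj =
  xs ++ ys ,
  Unique.++⁺ uxs uys (λ (x∈ , y∈) → disj _ (Equivalence.from (p _) x∈) (Equivalence.from (q _) y∈)) ,
  length-++ xs ,
  λ x → mk⇔ [ ∈-++⁺ˡ ∘ Equivalence.to (p x) , ∈-++⁺ʳ xs ∘ Equivalence.to (q x) ]′
            (λ z → [ inj₁ ∘ Equivalence.from (p x) , inj₂ ∘ Equivalence.from (q x) ]′ (∈-++⁻ xs z))

count-∃? : {P Q : A → Set} {n : ℕ} → Count P n → Decidable Q → Dec (∃[ x ] P x × Q x)
count-∃? (xs , _ , _ , p) Q? =
  map′ (λ h → let x , x∈ , qx = find h in x , Equivalence.from (p x) x∈ , qx)
       (λ (x , px , qx) → lose (Equivalence.to (p x) px) qx)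
       (any? Q? xs)

count-filter : {P Q : A → Set} {n : ℕ} → Count P n → Decidable Q → ∃[ m ] Count (λ x → P x × Q x) m
count-filter (xs , u , _ , p) Q? =
  _ , filter Q? xs , Unique.filter⁺ Q? u , refl ,
  λ x → mk⇔ (λ (px , qx) → ∈-filter⁺ Q? (Equivalence.to (p x) px) qx)
            (λ x∈ → let x∈xs , qx = ∈-filter⁻ Q? {xs = xs} x∈ in Equivalence.from (p x) x∈xs , qx)

count-complement : {P Q : A → Set} {m n : ℕ} → Count P n → Count (λ x → P x × Q x) m → Decidable Q →
                   Count (λ x → P x × ¬ Q x) (n ∸ m)
count-complement {P = P} {Q} {m} {n} cP cQ Q? with count-filter cP (¬? ∘ Q?)
... | k , c¬ = subst (Count _) (trans (sym (ℕ.m+n∸m≡n m k)) (cong (_∸ m) m+k≡n)) c¬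
  where
  m+k≡n : m ℕ.+ k ≡ n
  m+k≡n = count-unique
    (count-cong (λ _ → [ proj₁ , proj₁ ]′)
                (λ x px → [ (λ q → inj₁ (px , q)) , (λ ¬q → inj₂ (px , ¬q)) ]′ (split x))
                (count-⊎ cQ c¬ (λ _ (_ , q) (_ , ¬q) → ¬q q)))
    cP
    where
    split : ∀ x → Q x ⊎ ¬ Q x
    split x with Q? x
    ... | yes q = inj₁ q
    ... | no ¬q = inj₂ ¬q

-- A relation instead of a function lets objects be matched with normalised representatives.
count-↔ : {P : A → Set} {Q : B → Set} {n : ℕ} (R : A → B → Set) →
          (∀ x → P x → ∃[ y ] Q y × R x y) →
          (∀ y → Q y → ∃[ x ] P x × R x y) →
          (∀ {x y y′} → P x → Q y → Q y′ → R x y → R x y′ → y ≡ y′) →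
          (∀ {x x′ y} → P x → P x′ → Q y → R x y → R x′ y → x ≡ x′) →
          Count P n → Count Q n
count-↔ {A = A} {B} {P} {Q} R fwd bwd fun inj (xs , u , refl , p) =
  let ys , l , uys , sound , complete = image xs u (All.tabulate (λ {x} → Equivalence.from (p x)))
  in ys , uys , l , λ y → mk⇔
    (λ qy → let x , px , r = bwd y qy in complete x (Equivalence.to (p x) px) y qy r)
    (λ y∈ → proj₁ (proj₂ (proj₂ (sound y y∈))))
  where
  image : (zs : List A) → Unique zs → All P zs →
          Σ (List B) λ ys → length ys ≡ length zs × Unique ys ×
          (∀ y → y ∈ ys → ∃[ x ] x ∈ zs × Q y × R x y) × (∀ x → x ∈ zs → ∀ y → Q y → R x y → y ∈ ys)
  image [] [] [] = [] , refl , [] , (λ _ ()) , (λ _ ())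
  image (z ∷ zs) (z∉ ∷ u) (pz ∷ ps) with image zs u ps | fwd z pz
  ... | ys , l , uys , sound , complete | y , qy , r =
    y ∷ ys , cong suc l , ¬Any⇒All¬ ys y∉ ∷ uys ,
    (λ { _ (here refl) → z , here refl , qy , r
       ; y′ (there y∈) → let x , x∈ , h = sound y′ y∈ in x , there x∈ , h }) ,
    (λ { _ (here refl) y′ qy′ r′ → here (fun pz qy′ qy r′ r)
       ; x (there x∈) y′ qy′ r′ → there (complete x x∈ y′ qy′ r′) })
    where
    y∉ : y ∉ ys
    y∉ y∈ with sound y y∈
    ... | x , x∈ , _ , r′ with inj pz (All.lookup ps x∈) qy r r′
    ... | refl = All¬⇒¬Any z∉ x∈

-- Mostly read backwards: when `P` is already counted, comparison by `count-unique` turns the fibre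
-- size k into the number of values of `f`, and shows divisibility by k.
count-fibres : {P : A → Set} {Q : B → Set} {m k : ℕ} (f : A → B) →
               (∀ x → P x → Q (f x)) → (∀ y → Q y → Count (λ x → P x × f x ≡ y) k) →
               Count Q m → Count P (m ℕ.* k)
count-fibres {A = A} {P = P} {k = k} f P⇒Q fibre (ys , u , refl , q) =
  count-cong (λ _ → proj₁) (λ x px → px , Equivalence.to (q (f x)) (P⇒Q x px))
    (go ys u (λ {y} → Equivalence.from (q y)))
  where
  go : ∀ zs → Unique zs → (∀ {y} → y ∈ zs → _) → Count (λ x → P x × f x ∈ zs) (length zs ℕ.* k)
  go [] _ _ = count-none (λ _ ())
  go (z ∷ zs) (z∉ ∷ u) sub =
    count-cong (λ { _ (inj₁ (px , e)) → px , here e ; _ (inj₂ (px , e)) → px , there e })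
               (λ { _ (px , here e) → inj₁ (px , e) ; _ (px , there e) → inj₂ (px , e) })
      (count-⊎ (fibre z (sub (here refl))) (go zs u (sub ∘ there))
        (λ { _ (_ , refl) (_ , e) → All¬⇒¬Any z∉ e }))

-- If `y` were missed, the image, which has n elements by injectivity, together with `y` would put n
-- + 1 elements into a set of n.
count-surjective : {P : A → Set} {Q : B → Set} {n : ℕ} → DecidableEquality B → Count P n → Count Q n →
                   (f : A → B) → (∀ x → P x → Q (f x)) →
                   (∀ {x y} → P x → P y → f x ≡ f y → x ≡ y) → ∀ y → Q y → ∃[ x ] P x × f x ≡ y
count-surjective {P = P} {Q} {n} _≟_ cP cQ f P⇒Q inj y qy with count-∃? cP (λ x → f x ≟ y)
... | yes h = h
... | no ¬h = ⊥-elim (ℕ.1+n≰n (count-≤ (count-⊎ (count-one y refl (λ _ e → e)) image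
                (λ { _ refl (x , px , e) → ¬h (x , px , e) })) cQ
                (λ { _ (inj₁ refl) → qy ; _ (inj₂ (x , px , refl)) → P⇒Q x px })))
  where
  image : Count (λ z → ∃[ x ] P x × f x ≡ z) n
  image = count-↔ (λ x z → f x ≡ z) (λ x px → f x , (x , px , refl) , refl)
            (λ _ h → h) (λ _ _ _ e e′ → trans (sym e) e′)
            (λ px px′ _ e e′ → inj px px′ (trans e (sym e′))) cP

-- Arithmetic in a finite field of characteristic 3

module TwistedCubic (K : FiniteField) (3≡0 : Geometry.three K ≡ FiniteField.0# K)
  (7≤size : 7 ≤ FiniteField.size K) where

  open FiniteField K

  commutativeRing : CommutativeRing _ _
  commutativeRing = record { isCommutativeRing = isCommRing }

  open import Algebra.Properties.Ring (CommutativeRing.ring commutativeRing)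
    using (-‿involutive; -‿distribˡ-*; -0#≈0#; -‿+-comm)
  open CommutativeRing commutativeRing
    using (+-identityˡ; +-identityʳ; +-assoc; -‿inverseˡ; -‿inverseʳ; *-identityˡ; *-identityʳ; *-comm; *-assoc; zeroˡ; zeroʳ)

  -- Coefficients for the ring solver, which then decides identities of characteristic 3.
  data F₃ : Set where
    o i j : F₃

  _+₃_ _*₃_ : F₃ → F₃ → F₃
  o +₃ y = y
  i +₃ o = i
  i +₃ i = j
  i +₃ j = o
  j +₃ o = j
  j +₃ i = o
  j +₃ j = i
  o *₃ y = o
  i *₃ y = y
  j *₃ o = o
  j *₃ i = j
  j *₃ j = i

  -₃_ : F₃ → F₃
  -₃ o = o
  -₃ i = j
  -₃ j = i

  ring₃ : RawRing _ _
  ring₃ = record { _≈_ = _≡_ ; _+_ = _+₃_ ; _*_ = _*₃_ ; -_ = -₃_ ; 0# = o ; 1# = i }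

  embed : F₃ → F
  embed o = 0#
  embed i = 1#
  embed j = - 1#

  1+1≡-1 : 1# + 1# ≡ - 1#
  1+1≡-1 = begin
    1# + 1#                    ≡⟨ +-identityʳ _ ⟨
    (1# + 1#) + 0#             ≡⟨ cong ((1# + 1#) +_) (-‿inverseʳ 1#) ⟨
    (1# + 1#) + (1# + - 1#)    ≡⟨ +-assoc _ _ _ ⟨
    (1# + 1# + 1#) + - 1#      ≡⟨ cong (_+ - 1#) 3≡0 ⟩
    0# + - 1#                  ≡⟨ +-identityˡ _ ⟩
    - 1#                       ∎
    where open ≡-Reasoning

  embed-+ : ∀ x y → embed (x +₃ y) ≡ embed x + embed y
  embed-+ o y = sym (+-identityˡ _)
  embed-+ i o = sym (+-identityʳ _)
  embed-+ i i = sym 1+1≡-1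
  embed-+ i j = sym (-‿inverseʳ 1#)
  embed-+ j o = sym (+-identityʳ _)
  embed-+ j i = sym (-‿inverseˡ 1#)
  embed-+ j j = sym (trans (-‿+-comm 1# 1#) (trans (cong -_ 1+1≡-1) (-‿involutive 1#)))

  embed-* : ∀ x y → embed (x *₃ y) ≡ embed x * embed y
  embed-* o y = sym (zeroˡ _)
  embed-* i y = sym (*-identityˡ _)
  embed-* j o = sym (zeroʳ _)
  embed-* j i = sym (*-identityʳ _)
  embed-* j j = sym (trans (sym (-‿distribˡ-* 1# (- 1#))) (trans (cong -_ (*-identityˡ _)) (-‿involutive 1#)))

  embed-- : ∀ x → embed (-₃ x) ≡ - embed x
  embed-- o = sym -0#≈0#
  embed-- i = refl
  embed-- j = sym (-‿involutive 1#)

  acRing : AlmostCommutativeRing _ _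
  acRing = fromCommutativeRing commutativeRing

  embedding : ring₃ -Raw-AlmostCommutative⟶ acRing
  embedding = record
    { ⟦_⟧ = embed ; +-homo = embed-+ ; *-homo = embed-* ; -‿homo = embed-- ; 0-homo = refl ; 1-homo = refl }

  embed-≟ : (x y : F₃) → Maybe (embed x ≡ embed y)
  embed-≟ o o = just refl
  embed-≟ i i = just refl
  embed-≟ j j = just refl
  embed-≟ _ _ = nothing

  module Ring = Algebra.Solver.Ring ring₃ acRing embedding embed-≟
  open Ring using (solve; _:=_; _:+_; _:*_; :-_; con)

  finite : Count (λ (_ : F) → ⊤) size
  finite = tabulate (Inverse.from enum) ,
           Unique.tabulate⁺ (λ e → trans (sym (Inverse.strictlyInverseˡ enum _))
               (trans (cong (Inverse.to enum) e) (Inverse.strictlyInverseˡ enum _))) ,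
           length-tabulate _ ,
           λ x → mk⇔ (λ _ → subst (_∈ _) (Inverse.strictlyInverseʳ enum x) (∈-tabulate⁺ (Inverse.to enum x))) (λ _ → tt)

  dec∃ : {P : F → Set} → Decidable P → Dec (∃[ x ] P x)
  dec∃ P? = map′ (λ (x , _ , p) → x , p) (λ (x , p) → x , tt , p) (count-∃? finite P?)

  injective⇒surjective : (f : F → F) → (∀ {x y} → f x ≡ f y → x ≡ y) → ∀ y → ∃[ x ] f x ≡ y
  injective⇒surjective f inj y =
    let x , _ , e = count-surjective _≟_ finite finite f _ (λ _ _ → inj) y tt in x , e

  -- Ideal membership: the last argument is an identity for the ring solver.
  modulo : ∀ {p q x y} (a : F) → p ≡ q → x ≡ y + a * (p + - q) → x ≡ y
  modulo {p} {_} {_} {y} a refl e = trans e (solve 3 (λ a p y → y :+ a :* (p :+ :- p) := y) refl a p y)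

  modulo₂ : ∀ {p q p′ q′ x y} (a a′ : F) → p ≡ q → p′ ≡ q′ →
            x ≡ y + a * (p + - q) + a′ * (p′ + - q′) → x ≡ y
  modulo₂ a a′ h h′ e = modulo a h (modulo a′ h′ e)

  *-cancel-0 : ∀ {x y} → ¬ x ≡ 0# → x * y ≡ 0# → y ≡ 0#
  *-cancel-0 {x} {y} x≢0 e with inverse x x≢0
  ... | x′ , xx′ = modulo₂ (- y) x′ xx′ e
    (solve 3 (λ x y x′ → y := con o :+ :- y :* (x :* x′ :+ :- con i) :+ x′ :* (x :* y :+ :- con o)) refl x y x′)

  *-nonzero : ∀ {x y} → ¬ x ≡ 0# → ¬ y ≡ 0# → ¬ x * y ≡ 0#
  *-nonzero x≢0 y≢0 e = y≢0 (*-cancel-0 x≢0 e)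

  *-zero-split : ∀ {x y} → x * y ≡ 0# → x ≡ 0# ⊎ y ≡ 0#
  *-zero-split {x} e with x ≟ 0#
  ... | yes x≡0 = inj₁ x≡0
  ... | no x≢0 = inj₂ (*-cancel-0 x≢0 e)

  square-zero : ∀ {x} → x * x ≡ 0# → x ≡ 0#
  square-zero e = [ (λ h → h) , (λ h → h) ]′ (*-zero-split e)

  nonzeroʳ : ∀ {x y z} → x * y ≡ z → ¬ z ≡ 0# → ¬ y ≡ 0#
  nonzeroʳ {x} e z≢0 refl = z≢0 (trans (sym e) (zeroʳ x))

  1≢0 : ¬ 1# ≡ 0#
  1≢0 e = 0≢1 (sym e)

  -1≢0 : ¬ - 1# ≡ 0#
  -1≢0 e = 1≢0 (modulo (- 1#) e (solve 0 (con i := con o :+ :- con i :* (:- con i :+ :- con o)) refl))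

  difference-zero : ∀ {x y} → x + - y ≡ 0# → x ≡ y
  difference-zero {x} {y} e = modulo 1# e (solve 2 (λ x y → x := y :+ con i :* (x :+ :- y :+ :- con o)) refl x y)

  cube : F → F
  cube x = x * x * x

  cube-zero : ∀ {x} → cube x ≡ 0# → x ≡ 0#
  cube-zero e = [ square-zero , (λ h → h) ]′ (*-zero-split e)

  -- In characteristic 3, (x - y)³ = x³ - y³, so equal cubes have a difference with cube zero. By
  -- finiteness cubing is then a bijection.
  cube-injective : ∀ {x y} → cube x ≡ cube y → x ≡ y
  cube-injective {x} {y} e = difference-zero (cube-zero (modulo 1# e
    (solve 2 (λ x y → (x :+ :- y) :* (x :+ :- y) :* (x :+ :- y)
       := con o :+ con i :* (x :* x :* x :+ :- (y :* y :* y))) refl x y)))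

  cube-root : ∀ x → ∃[ y ] cube y ≡ x
  cube-root = injective⇒surjective cube cube-injective

  -- Negatives of squares

  NonZeros : Count (λ x → ¬ x ≡ 0#) (size ∸ 1)
  NonZeros = count-cong (λ _ → proj₂) (λ _ h → tt , h)
    (count-complement finite (count-one 0# (tt , refl) (λ _ → proj₂)) (_≟ 0#))

  -- Equivalently, - x is a non-zero square.
  NegSquare : F → Set
  NegSquare x = ∃[ d ] x * (d * d) + 1# ≡ 0#

  NegSquare? : Decidable NegSquare
  NegSquare? x = dec∃ (λ d → (x * (d * d) + 1#) ≟ 0#)

  NegSquare⇒≢0 : ∀ {x} → NegSquare x → ¬ x ≡ 0#
  NegSquare⇒≢0 (d , e) refl = 1≢0 (trans (solve 1 (λ d → con i := con o :* (d :* d) :+ con i) refl d) e)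

  negsq : F → F
  negsq e = - (e * e)

  negsq-NegSquare : ∀ {e} → ¬ e ≡ 0# → NegSquare (negsq e)
  negsq-NegSquare {e} e≢0 = let d , ed = inverse e e≢0 in d ,
    modulo (- (e * d + 1#)) ed
      (solve 2 (λ e d → :- (e :* e) :* (d :* d) :+ con i
         := con o :+ :- (e :* d :+ con i) :* (e :* d :+ :- con i)) refl e d)

  NegSquare⇒negsq : ∀ {x} → NegSquare x → ∃[ e ] (¬ e ≡ 0#) × negsq e ≡ x
  NegSquare⇒negsq {x} (d , h) = x * d ,
    (λ xd → 1≢0 (modulo₂ 1# (- d) h xd
      (solve 2 (λ x d → con i := con o :+ con i :* (x :* (d :* d) :+ con i :+ :- con o)
         :+ :- d :* (x :* d :+ :- con o)) refl x d))) ,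
    modulo (- x) h
      (solve 2 (λ x d → :- (x :* d :* (x :* d)) := x :+ :- x :* (x :* (d :* d) :+ con i :+ :- con o)) refl x d)

  negsq-fibre : ∀ {e x} → negsq x ≡ negsq e → x ≡ e ⊎ x ≡ - e
  negsq-fibre {e} {x} h with *-zero-split (modulo (- 1#) h
    (solve 2 (λ e x → (x :+ :- e) :* (x :+ e) := con o :+ :- con i :* (:- (x :* x) :+ :- :- (e :* e))) refl e x))
  ... | inj₁ z = inj₁ (difference-zero z)
  ... | inj₂ z = inj₂ (modulo 1# z (solve 2 (λ e x → x := :- e :+ con i :* (x :+ e :+ :- con o)) refl e x))

  negsq-neg : ∀ e → negsq (- e) ≡ negsq e
  negsq-neg = solve 1 (λ e → :- (:- e :* :- e) := :- (e :* e)) refl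

  e≢-e : ∀ {e} → ¬ e ≡ 0# → ¬ e ≡ - e
  e≢-e {e} e≢0 h = e≢0 (modulo (- 1#) h (solve 1 (λ e → e := con o :+ :- con i :* (e :+ :- :- e)) refl e))

  -- As `E` is closed under negation and misses 0, each value of `negsq` on it comes from exactly
  -- two distinct elements e and - e. The size m of `X` is produced rather than given, so that the
  -- evenness of n becomes part of the result.
  count-halve : {E X : F → Set} {n : ℕ} → Decidable X →
    (∀ e → E e → ¬ e ≡ 0#) → (∀ e → E e → E (- e)) →
    (∀ e → E e → X (negsq e)) → (∀ x → X x → ∃[ e ] E e × negsq e ≡ x) →
    Count E n → ∃[ m ] Count X m × n ≡ m ℕ.* 2
  count-halve {E} {X} X? E≢0 E-neg E⇒X X⇒E cE =
    let m , cX = count-filter finite X?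
        cX′ = count-cong (λ _ → proj₂) (λ _ h → tt , h) cX
    in m , cX′ , count-unique cE (count-fibres negsq E⇒X fibre cX′)
    where
    fibre : ∀ x → X x → Count (λ e → E e × negsq e ≡ x) 2
    fibre x Xx with X⇒E x Xx
    ... | e , Ee , refl =
      count-cong (λ { _ (inj₁ refl) → Ee , refl ; _ (inj₂ refl) → E-neg e Ee , negsq-neg e })
                 (λ _ (_ , h) → negsq-fibre h)
        (count-⊎ (count-one e refl (λ _ h → h)) (count-one (- e) refl (λ _ h → h))
                 (λ _ h h′ → e≢-e (E≢0 e Ee) (trans (sym h) h′)))

  halves : ∃[ m ] Count NegSquare m × size ∸ 1 ≡ m ℕ.* 2
  halves = count-halve NegSquare? (λ _ h → h)
    (λ e e≢0 z → e≢0 (trans (sym (-‿involutive e)) (trans (cong -_ z) -0#≈0#)))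
    (λ _ → negsq-NegSquare) (λ _ → NegSquare⇒negsq) NonZeros

  half : ℕ
  half = proj₁ halves

  NegSquares : Count NegSquare half
  NegSquares = proj₁ (proj₂ halves)

  NonNegSquares : Count (λ x → (¬ x ≡ 0#) × ¬ NegSquare x) half
  NonNegSquares = subst (Count _) eq
    (count-complement NonZeros (count-cong (λ x h → NegSquare⇒≢0 h , h) (λ _ → proj₂) NegSquares) NegSquare?)
    where
    eq : size ∸ 1 ∸ half ≡ half
    eq = trans (cong (_∸ half) (trans (proj₂ (proj₂ halves))
        (trans (ℕ.*-comm half 2) (cong (half ℕ.+_) (ℕ.+-identityʳ half)))))
               (ℕ.m+n∸m≡n half half)

  -- Multiplication by a non-square maps the negatives of non-zero squares injectively into the
  -- remaining non-zero elements. Both classes have `half` elements, so every element of the second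
  -- class is reached.
  nonsquare-coset : ∀ {ρ} → Geometry.NonSquare K ρ → ∀ {y} → ¬ y ≡ 0# → ¬ NegSquare y →
                    ∃[ x ] NegSquare x × ρ * x ≡ y
  nonsquare-coset {ρ} nsq {y} y≢0 ny =
    count-surjective _≟_ NegSquares NonNegSquares (ρ *_)
      (λ x nx → *-nonzero ρ≢0 (NegSquare⇒≢0 nx) , λ (d′ , h′) → clash nx d′ h′)
      (λ _ _ e → ρ-cancel e) y (y≢0 , ny)
    where
    ρ≢0 : ¬ ρ ≡ 0#
    ρ≢0 h = nsq 0# (trans (zeroˡ 0#) (sym h))
    ρ-cancel : ∀ {x x′} → ρ * x ≡ ρ * x′ → x ≡ x′
    ρ-cancel {x} {x′} e = difference-zero (*-cancel-0 ρ≢0 (modulo 1# e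
      (solve 3 (λ r x x′ → r :* (x :+ :- x′) := con o :+ con i :* (r :* x :+ :- (r :* x′))) refl ρ x x′)))
    clash : ∀ {x} → NegSquare x → ∀ d′ → ¬ ρ * x * (d′ * d′) + 1# ≡ 0#
    clash {x} (d , h) d′ h′ with inverse d′ d′≢0
      where
      d′≢0 : ¬ d′ ≡ 0#
      d′≢0 refl = 1≢0 (trans (solve 2 (λ r x → con i := r :* x :* (con o :* con o) :+ con i) refl ρ x) h′)
    -- From x = - 1/d² and ρ x = - 1/d′² follows ρ = (d/d′)², and t is 1/d′.
    ... | t , d′t = nsq (d * t) (modulo (ρ * (d′ * t + 1#)) d′t (modulo₂ (d * t * (d * t)) (- (t * d′ * (t * d′)) * ρ) h′ h
      (solve 5 (λ r x d d′ t → d :* t :* (d :* t) := r :+ r :* (d′ :* t :+ con i) :* (d′ :* t :+ :- con i)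
         :+ d :* t :* (d :* t) :* (r :* x :* (d′ :* d′) :+ con i :+ :- con o)
         :+ :- (t :* d′ :* (t :* d′)) :* r :* (x :* (d :* d) :+ con i :+ :- con o)) refl ρ x d d′ t)))

  -- The Artin–Schreier map.
  wp : F → F
  wp z = cube z + - z

  InImage : F → Set
  InImage y = ∃[ z ] wp z ≡ y

  InImage? : Decidable InImage
  InImage? y = dec∃ (λ z → wp z ≟ y)

  -- The map is additive in characteristic 3, and its kernel consists of the roots 0, 1, - 1 of X³ -
  -- X.
  wp-fibre : ∀ {z w} → wp w ≡ wp z → w ≡ z ⊎ w ≡ z + 1# ⊎ w ≡ z + - 1#
  wp-fibre {z} {w} h with *-zero-split (modulo 1# h
      (solve 2 (λ z w → (w :+ :- z) :* ((w :+ :- (z :+ con i)) :* (w :+ :- (z :+ :- con i)))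
        := con o :+ con i :* (w :* w :* w :+ :- w :+ :- (z :* z :* z :+ :- z))) refl z w))
  ... | inj₁ e = inj₁ (difference-zero e)
  ... | inj₂ e with *-zero-split e
  ... | inj₁ e′ = inj₂ (inj₁ (difference-zero e′))
  ... | inj₂ e′ = inj₂ (inj₂ (difference-zero e′))

  -- Each fibre is a coset of the prime field, so the image contains one third of all elements.
  image : ∃[ m ] Count InImage m × size ≡ m ℕ.* 3
  image =
    let m , c = count-filter finite InImage?
        c′ = count-cong (λ _ → proj₂) (λ _ h → tt , h) c
    in m , c′ , count-unique finite (count-fibres wp (λ z _ → z , refl) fibre c′)
    where
    cancel : ∀ {z a b} → z + a ≡ z + b → a ≡ b
    cancel {z} {a} {b} h = modulo 1# h (solve 3 (λ z a b → a := b :+ con i :* (z :+ a :+ :- (z :+ b))) refl z a b)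
    1≢-1 : ¬ 1# ≡ - 1#
    1≢-1 = e≢-e 1≢0
    fibre : ∀ y → InImage y → Count (λ z → ⊤ × wp z ≡ y) 3
    fibre _ (z , refl) =
      count-cong
        (λ { _ (inj₁ refl) → tt , refl
           ; _ (inj₂ (inj₁ refl)) → tt , solve 1 (λ z → (z :+ con i) :* (z :+ con i) :* (z :+ con i) :+ :- (z :+ con i)
               := z :* z :* z :+ :- z) refl z
           ; _ (inj₂ (inj₂ refl)) → tt , solve 1 (λ z → (z :+ :- con i) :* (z :+ :- con i) :* (z :+ :- con i) :+ :- (z :+ :- con i)
               := z :* z :* z :+ :- z) refl z })
        (λ _ (_ , h) → wp-fibre h)
        (count-⊎ (only z)
          (count-⊎ (only (z + 1#)) (only (z + - 1#)) (λ _ h h′ → 1≢-1 (cancel (trans (sym h) h′))))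
          (λ { _ h (inj₁ h′) → 1≢0 (cancel (trans (sym (trans (sym h) h′)) (sym (+-identityʳ z))))
             ; _ h (inj₂ h′) → -1≢0 (cancel (trans (sym (trans (sym h) h′)) (sym (+-identityʳ z)))) }))
      where
      only : ∀ a → Count (_≡ a) 1
      only a = count-one a refl (λ _ h → h)

  -- Polynomials as coefficient vectors

  -- The constant term comes first.
  evalPoly : ∀ {n} → Vec F n → F → F
  evalPoly [] t = 0#
  evalPoly (a ∷ p) t = a + t * evalPoly p t

  -- Synthetic division by t - r.
  quotient : ∀ {n} → Vec F (suc n) → F → Vec F n
  quotient (a ∷ []) r = []
  quotient (a ∷ p@(_ ∷ _)) r = evalPoly p r ∷ quotient p r

  quotient-spec : ∀ {n} (p : Vec F (suc n)) r t →
                  evalPoly p t ≡ evalPoly p r + (t + - r) * evalPoly (quotient p r) t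
  quotient-spec (a ∷ []) r t = solve 3 (λ a r t → a :+ t :* con o := a :+ r :* con o :+ (t :+ :- r) :* con o) refl a r t
  quotient-spec (a ∷ p@(_ ∷ _)) r t = trans (cong (λ z → a + t * z) (quotient-spec p r t))
    (solve 5 (λ a r t x y → a :+ t :* (x :+ (t :+ :- r) :* y) := a :+ r :* x :+ (t :+ :- r) :* (x :+ t :* y)) refl
       a r t (evalPoly p r) (evalPoly (quotient p r) t))

  zeros : ∀ n → Vec F n
  zeros n = Vec.replicate n 0#

  quotient-zero : ∀ {n} (p : Vec F (suc n)) r → evalPoly p r ≡ 0# → quotient p r ≡ zeros n → p ≡ zeros (suc n)
  quotient-zero (a ∷ []) r e _ = cong (_∷ []) (trans (solve 2 (λ a r → a := a :+ r :* con o) refl a r) e)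
  quotient-zero (a ∷ p@(_ ∷ _)) r e h with cong Vec.head h | cong Vec.tail h
  ... | pr | q = cong₂ _∷_
    (modulo₂ 1# (- r) e pr
        (solve 3 (λ a r x → a
            := con o :+ con i :* (a :+ r :* x :+ :- con o) :+ :- r :* (x :+ :- con o)) refl a r (evalPoly p r)))
    (quotient-zero p r pr q)

  -- Division by t - r for a root r removes one coefficient, and the other roots survive because
  -- their difference from r is invertible.
  vanishes : ∀ {n} (p : Vec F n) (rs : List F) → Unique rs → n ≤ length rs → All (λ r → evalPoly p r ≡ 0#) rs → p ≡ zeros n
  vanishes [] _ _ _ _ = refl
  vanishes p@(_ ∷ _) (r ∷ rs) (r∉ ∷ u) (s≤s n≤) (e ∷ es) =
    quotient-zero p r e (vanishes (quotient p r) rs u n≤ (All.tabulate root))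
    where
    root : ∀ {t} → t ∈ rs → evalPoly (quotient p r) t ≡ 0#
    root {t} t∈ = *-cancel-0 (λ h → All.lookup r∉ t∈ (sym (difference-zero h)))
      (modulo₂ (- 1#) 1# e (trans (sym (quotient-spec p r t)) (All.lookup es t∈))
        (solve 3 (λ d x y → d :* y := con o :+ :- con i :* (x :+ :- con o) :+ con i :* (x :+ d :* y :+ :- con o)) refl
          (t + - r) (evalPoly p r) (evalPoly (quotient p r) t)))

  identically-zero : ∀ {n} → n ≤ size → (p : Vec F n) → (∀ t → evalPoly p t ≡ 0#) → p ≡ zeros n
  identically-zero n≤ p h = let xs , u , l , _ = finite in
    vanishes p xs u (subst (_ ≤_) (sym l) n≤) (All.tabulate (λ _ → h _))

  evalPoly-injective : ∀ {n} → n ≤ size → (p q : Vec F n) → (∀ t → evalPoly p t ≡ evalPoly q t) → p ≡ q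
  evalPoly-injective {n} n≤ p q h =
    minus-zero p q (identically-zero n≤ (minus p q) λ t → modulo 1# (h t)
      (trans (eval-minus p q t)
          (solve 2 (λ x y → x :+ :- y := con o :+ con i :* (x :+ :- y)) refl (evalPoly p t) (evalPoly q t))))
    where
    minus : ∀ {n} → Vec F n → Vec F n → Vec F n
    minus = Vec.zipWith (λ a b → a + - b)
    eval-minus : ∀ {n} (p q : Vec F n) t → evalPoly (minus p q) t ≡ evalPoly p t + - evalPoly q t
    eval-minus [] [] t = solve 0 (con o := con o :+ :- con o) refl
    eval-minus (a ∷ p) (b ∷ q) t = trans (cong (λ z → a + - b + t * z) (eval-minus p q t))
      (solve 5 (λ a b t x y → a :+ :- b :+ t :* (x :+ :- y)
          := a :+ t :* x :+ :- (b :+ t :* y)) refl a b t (evalPoly p t) (evalPoly q t))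
    minus-zero : ∀ {n} (p q : Vec F n) → minus p q ≡ zeros n → p ≡ q
    minus-zero [] [] _ = refl
    minus-zero (a ∷ p) (b ∷ q) e = cong₂ _∷_ (difference-zero (cong Vec.head e)) (minus-zero p q (cong Vec.tail e))

  -- Linear algebra

  open Geometry K

  vec-cong : ∀ {a b c d a′ b′ c′ d′} → a ≡ a′ → b ≡ b′ → c ≡ c′ → d ≡ d′ → vec a b c d ≡ vec a′ b′ c′ d′
  vec-cong refl refl refl refl = refl

  vec-injective : ∀ {a b c d a′ b′ c′ d′} → vec a b c d ≡ vec a′ b′ c′ d′ → a ≡ a′ × b ≡ b′ × c ≡ c′ × d ≡ d′
  vec-injective refl = refl , refl , refl , refl

  lin : F → F → V4 → V4 → V4
  lin a b u v = (a · u) ⊕ (b · v)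

  lookup-lin : ∀ a b u v k → lookup (lin a b u v) k ≡ a * lookup u k + b * lookup v k
  lookup-lin a b u v k = trans (lookup-zipWith _+_ k (a · u) (b · v))
    (cong₂ _+_ (lookup-map k (a *_) u) (lookup-map k (b *_) v))

  ·-as-lin : ∀ a u v → a · u ≡ lin a 0# u v
  ·-as-lin a (x ∷ y ∷ z ∷ w ∷ []) (x′ ∷ y′ ∷ z′ ∷ w′ ∷ []) = vec-cong (s x x′) (s y y′) (s z z′) (s w w′)
    where
    s : ∀ p q → a * p ≡ a * p + 0# * q
    s = solve 3 (λ a p q → a :* p := a :* p :+ con o :* q) refl a

  lin-1-0 : ∀ u v → u ≡ lin 1# 0# u v
  lin-1-0 (x ∷ y ∷ z ∷ w ∷ []) (x′ ∷ y′ ∷ z′ ∷ w′ ∷ []) = vec-cong (s x x′) (s y y′) (s z z′) (s w w′)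
    where
    s : ∀ p q → p ≡ 1# * p + 0# * q
    s = solve 2 (λ p q → p := con i :* p :+ con o :* q) refl

  lin-0-1 : ∀ u v → v ≡ lin 0# 1# u v
  lin-0-1 (x ∷ y ∷ z ∷ w ∷ []) (x′ ∷ y′ ∷ z′ ∷ w′ ∷ []) = vec-cong (s x x′) (s y y′) (s z z′) (s w w′)
    where
    s : ∀ p q → q ≡ 0# * p + 1# * q
    s = solve 2 (λ p q → q := con o :* p :+ con i :* q) refl

  lin-0-0 : ∀ u v → lin 0# 0# u v ≡ zeroV
  lin-0-0 (x ∷ y ∷ z ∷ w ∷ []) (x′ ∷ y′ ∷ z′ ∷ w′ ∷ []) = vec-cong (s x x′) (s y y′) (s z z′) (s w w′)
    where
    s : ∀ p q → 0# * p + 0# * q ≡ 0#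
    s = solve 2 (λ p q → con o :* p :+ con o :* q := con o) refl

  lin-lin : ∀ a b c d e f u v → lin a b (lin c d u v) (lin e f u v) ≡ lin (a * c + b * e) (a * d + b * f) u v
  lin-lin a b c d e f (x ∷ y ∷ z ∷ w ∷ []) (x′ ∷ y′ ∷ z′ ∷ w′ ∷ []) = vec-cong (s x x′) (s y y′) (s z z′) (s w w′)
    where
    s : ∀ p q → a * (c * p + d * q) + b * (e * p + f * q) ≡ (a * c + b * e) * p + (a * d + b * f) * q
    s = solve 8 (λ a b c d e f p q → a :* (c :* p :+ d :* q) :+ b :* (e :* p :+ f :* q)
                   := (a :* c :+ b :* e) :* p :+ (a :* d :+ b :* f) :* q) refl a b c d e f

  InSpan-lin : ∀ {x y ℓ} a b → InSpan x ℓ → InSpan y ℓ → InSpan (lin a b x y) ℓ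
  InSpan-lin {ℓ = u , v} a b (c , d , refl) (e , f , refl) = _ , _ , lin-lin a b c d e f u v

  InSpan-trans : ∀ {x u v ℓ} → InSpan x (u , v) → InSpan u ℓ → InSpan v ℓ → InSpan x ℓ
  InSpan-trans (a , b , refl) u∈ v∈ = InSpan-lin a b u∈ v∈

  InSpan-· : ∀ {x ℓ} a → InSpan x ℓ → InSpan (a · x) ℓ
  InSpan-· {x} {ℓ} a x∈ = subst (λ z → InSpan z ℓ) (sym (·-as-lin a x x)) (InSpan-lin a 0# x∈ x∈)

  InSpan-fst : ∀ {u v} → InSpan u (u , v)
  InSpan-fst {u} {v} = 1# , 0# , lin-1-0 u v

  Independent : V4 × V4 → Set
  Independent (u , v) = ∀ a b → lin a b u v ≡ zeroV → a ≡ 0# × b ≡ 0#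

  -- Cramer's rule for the coefficients (a, b), (c, d) of x and y in terms of u and v. If the
  -- determinant vanished, so would d x - b y and - c x + a y; independence would then give a = b =
  -- 0, hence x = 0.
  exchange : ∀ {x y u v} → Independent (x , y) → InSpan x (u , v) → InSpan y (u , v) →
             InSpan u (x , y) × InSpan v (x , y)
  exchange {u = u} {v} ind (a , b , refl) (c , d , refl) with (a * d + - (b * c)) ≟ 0#
  ... | yes D≡0 = ⊥-elim (1≢0 (proj₁ (ind 1# 0# (trans (sym (lin-1-0 _ _)) x≡0))))
    where
    open ≡-Reasoning
    db : d ≡ 0# × - b ≡ 0#
    db = ind d (- b) (begin
      lin d (- b) (lin a b u v) (lin c d u v)  ≡⟨ lin-lin d (- b) a b c d u v ⟩
      lin (d * a + - b * c) (d * b + - b * d) u v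
        ≡⟨ cong₂ (λ p q → lin p q u v)
             (trans (solve 4 (λ a b c d → d :* a :+ :- b :* c := a :* d :+ :- (b :* c)) refl a b c d) D≡0)
             (solve 2 (λ b d → d :* b :+ :- b :* d := con o) refl b d) ⟩
      lin 0# 0# u v  ≡⟨ lin-0-0 u v ⟩
      zeroV ∎)
    ca : - c ≡ 0# × a ≡ 0#
    ca = ind (- c) a (begin
      lin (- c) a (lin a b u v) (lin c d u v)  ≡⟨ lin-lin (- c) a a b c d u v ⟩
      lin (- c * a + a * c) (- c * b + a * d) u v
        ≡⟨ cong₂ (λ p q → lin p q u v)
             (solve 2 (λ a c → :- c :* a :+ a :* c := con o) refl a c)
             (trans (solve 4 (λ a b c d → :- c :* b :+ a :* d := a :* d :+ :- (b :* c)) refl a b c d) D≡0) ⟩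
      lin 0# 0# u v  ≡⟨ lin-0-0 u v ⟩
      zeroV ∎)
    x≡0 : lin a b u v ≡ zeroV
    x≡0 = trans (cong₂ (λ p q → lin p q u v) (proj₂ ca)
      (modulo (- 1#) (proj₂ db) (solve 1 (λ b → b := con o :+ :- con i :* (:- b :+ :- con o)) refl b))) (lin-0-0 u v)
  ... | no D≢0 with inverse _ D≢0
  ... | D′ , DD′ =
    (D′ * d , - (D′ * b) , (begin
      u ≡⟨ lin-1-0 u v ⟩
      lin 1# 0# u v ≡⟨ cong₂ (λ p q → lin p q u v)
        (modulo (- 1#) DD′
            (solve 5 (λ a b c d e → con i
                := e :* d :* a :+ :- (e :* b) :* c :+ :- con i :* ((a :* d :+ :- (b :* c)) :* e :+ :- con i))
                    refl a b c d D′))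
        (solve 3 (λ b d e → con o := e :* d :* b :+ :- (e :* b) :* d) refl b d D′) ⟩
      lin (D′ * d * a + - (D′ * b) * c) (D′ * d * b + - (D′ * b) * d) u v ≡⟨ lin-lin _ _ a b c d u v ⟨
      lin (D′ * d) (- (D′ * b)) (lin a b u v) (lin c d u v) ∎)) ,
    (- (D′ * c) , D′ * a , (begin
      v ≡⟨ lin-0-1 u v ⟩
      lin 0# 1# u v ≡⟨ cong₂ (λ p q → lin p q u v)
        (solve 3 (λ a c e → con o := :- (e :* c) :* a :+ e :* a :* c) refl a c D′)
        (modulo (- 1#) DD′
            (solve 5 (λ a b c d e → con i
                := :- (e :* c) :* b :+ e :* a :* d :+ :- con i :* ((a :* d :+ :- (b :* c)) :* e :+ :- con i))
                    refl a b c d D′)) ⟩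
      lin (- (D′ * c) * a + D′ * a * c) (- (D′ * c) * b + D′ * a * d) u v ≡⟨ lin-lin _ _ a b c d u v ⟨
      lin (- (D′ * c)) (D′ * a) (lin a b u v) (lin c d u v) ∎))
    where open ≡-Reasoning

  lookup-zeroV : ∀ k → lookup zeroV k ≡ 0#
  lookup-zeroV k = lookup-replicate k 0#

  leading : ∀ {n} (x : Vec F n) →
            x ≡ Vec.replicate n 0# ⊎ ∃[ m ] (∀ k → k < m → lookup x k ≡ 0#) × (¬ lookup x m ≡ 0#)
  leading [] = inj₁ refl
  leading (a ∷ x) with a ≟ 0# | leading x
  ... | no a≢0 | _ = inj₂ (f0 , (λ _ ()) , a≢0)
  ... | yes refl | inj₁ refl = inj₁ refl
  ... | yes refl | inj₂ (m , z , nz) = inj₂ (fs m , (λ { f0 _ → refl ; (fs k) (s≤s k<m) → z k k<m }) , nz)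

  rref-independent : ∀ {ℓ} → RREF ℓ → Independent ℓ
  rref-independent {u , v} (m , n , m<n , (_ , um) , (vz , vn) , un) a b h = a≡0 , b≡0
    where
    at : ∀ k → a * lookup u k + b * lookup v k ≡ 0#
    at k = trans (sym (lookup-lin a b u v k)) (trans (cong (λ z → lookup z k) h) (lookup-zeroV k))
    a≡0 : a ≡ 0#
    a≡0 = trans (solve 2 (λ a b → a := a :* con i :+ b :* con o) refl a b)
      (trans (cong₂ (λ p q → a * p + b * q) (sym um) (sym (vz m m<n))) (at m))
    b≡0 : b ≡ 0#
    b≡0 = trans (solve 2 (λ a b → b := a :* con o :+ b :* con i) refl a b)
      (trans (cong₂ (λ p q → a * p + b * q) (sym un) (sym vn)) (at n))

  -- Gaussian elimination: `u` is x scaled to its pivot m, `w` is y cleared in column m, `v` is `w`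
  -- scaled to its pivot n, and `u₁` is `u` cleared in column n. The order of the rows depends on
  -- which pivot comes first.
  rref-exists : ∀ {x y} → Independent (x , y) → ∃[ ℓ ] RREF ℓ × InSpan x ℓ × InSpan y ℓ
  rref-exists {x} {y} ind with leading x
  ... | inj₁ refl = ⊥-elim (1≢0 (proj₁ (ind 1# 0# (sym (lin-1-0 x y)))))
  ... | inj₂ (m , xz , xm) with inverse _ xm
  ... | a , xma with leading (lin (- (lookup y m * a)) 1# x y)
  ... | inj₁ w≡0 = ⊥-elim (1≢0 (proj₂ (ind _ _ w≡0)))
  ... | inj₂ (n , wz , wn) with inverse _ wn
  ... | b , wnb = choose (Fin.<-cmp m n)
    where
    u w v u₁ : V4
    u = a · x
    w = lin (- (lookup y m * a)) 1# x y
    v = b · w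
    u₁ = lin 1# (- lookup u n) u v
    u-at : ∀ k → lookup u k ≡ a * lookup x k
    u-at k = lookup-map k (a *_) x
    v-at : ∀ k → lookup v k ≡ b * lookup w k
    v-at k = lookup-map k (b *_) w
    u₁-at : ∀ k → lookup u₁ k ≡ 1# * lookup u k + - lookup u n * lookup v k
    u₁-at = lookup-lin 1# (- lookup u n) u v
    w-m : lookup w m ≡ 0#
    w-m = trans (lookup-lin _ 1# x y m) (modulo (- lookup y m) xma
      (solve 3 (λ y x a → :- (y :* a) :* x :+ con i :* y
          := con o :+ :- y :* (x :* a :+ :- con i)) refl (lookup y m) (lookup x m) a))
    u-m : lookup u m ≡ 1#
    u-m = trans (u-at m) (trans (*-comm a _) xma)
    u-z : ∀ k → k < m → lookup u k ≡ 0#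
    u-z k k<m = trans (u-at k) (trans (cong (a *_) (xz k k<m)) (zeroʳ a))
    v-n : lookup v n ≡ 1#
    v-n = trans (v-at n) (trans (*-comm b _) wnb)
    v-m : lookup v m ≡ 0#
    v-m = trans (v-at m) (trans (cong (b *_) w-m) (zeroʳ b))
    v-z : ∀ k → k < n → lookup v k ≡ 0#
    v-z k k<n = trans (v-at k) (trans (cong (b *_) (wz k k<n)) (zeroʳ b))
    u₁-m : lookup u₁ m ≡ 1#
    u₁-m = trans (u₁-at m) (trans (cong₂ (λ p q → 1# * p + - lookup u n * q) u-m v-m)
      (solve 1 (λ c → con i :* con i :+ :- c :* con o := con i) refl (lookup u n)))
    v∈ : InSpan v (x , y)
    v∈ = InSpan-· b (_ , _ , refl)
    u₁∈ : InSpan u₁ (x , y)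
    u₁∈ = InSpan-lin _ _ (InSpan-· a InSpan-fst) v∈
    choose : _ → ∃[ ℓ ] RREF ℓ × InSpan x ℓ × InSpan y ℓ
    choose (tri< m<n _ _) = (u₁ , v) , r , exchange (rref-independent r) u₁∈ v∈
      where
      r : RREF (u₁ , v)
      r = m , n , m<n ,
        ((λ k k<m → trans (u₁-at k) (trans
           (cong₂ (λ p q → 1# * p + - lookup u n * q) (u-z k k<m) (v-z k (Fin.<-trans k<m m<n)))
           (solve 1 (λ c → con i :* con o :+ :- c :* con o := con o) refl (lookup u n)))) , u₁-m) ,
        (v-z , v-n) ,
        trans (u₁-at n) (trans (cong (λ q → 1# * lookup u n + - lookup u n * q) v-n)
          (solve 1 (λ c → con i :* c :+ :- c :* con i := con o) refl (lookup u n)))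
    choose (tri≈ _ refl _) = ⊥-elim (wn w-m)
    -- Here `u` is zero in column n already, being left of its pivot, so `u₁` equals `u` and the
    -- rows merely change places.
    choose (tri> _ _ n<m) = (v , u₁) , r , exchange (rref-independent r) v∈ u₁∈
      where
      r : RREF (v , u₁)
      r = n , m , n<m , (v-z , v-n) ,
        ((λ k k<m → trans (u₁-at k) (trans
           (cong₂ (λ p q → 1# * p + - q * lookup v k) (u-z k k<m) (u-z n n<m))
           (solve 1 (λ c → con i :* con o :+ :- con o :* c := con o) refl (lookup v k)))) , u₁-m) ,
        v-m

  -- Both pairs span the subspace of x and y, so `u` and `v` are combinations of `u′` and `v′` with
  -- coefficients a, b and c, d. Comparing pivots gives m = m′, then c = 0, then n = n′; the pivot
  -- columns then show that the coefficient matrix is the identity.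
  rref-unique : ∀ {x y ℓ ℓ′} → Independent (x , y) → RREF ℓ → RREF ℓ′ →
                InSpan x ℓ → InSpan y ℓ → InSpan x ℓ′ → InSpan y ℓ′ → ℓ ≡ ℓ′
  rref-unique {ℓ = u , v} {u′ , v′} ind
    (m , n , m<n , (uz , um) , (vz , vn) , un) (m′ , n′ , m′<n′ , (u′z , u′m) , (v′z , v′n) , u′n) x∈ y∈ x∈′ y∈′
    with exchange ind x∈ y∈ | exchange ind x∈′ y∈′
  ... | u∈ , v∈ | u′∈ , v′∈ with InSpan-trans u∈ x∈′ y∈′ | InSpan-trans v∈ x∈′ y∈′ | InSpan-trans u′∈ x∈ y∈
  ... | a , b , refl | c , d , refl | a′ , b′ , e = goal (Fin.<-cmp m m′)
    where
    at : ∀ a b k {r s t} → lookup (lin a b u′ v′) k ≡ t → lookup u′ k ≡ r → lookup v′ k ≡ s → a * r + b * s ≡ t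
    at a b k h refl refl = trans (sym (lookup-lin a b u′ v′ k)) h
    goal : _ → _
    goal (tri< m<m′ _ _) = ⊥-elim (1≢0 (trans (sym (at a b m um (u′z m m<m′) (v′z m (Fin.<-trans m<m′ m′<n′))))
      (solve 2 (λ a b → a :* con o :+ b :* con o := con o) refl a b)))
    goal (tri> _ _ m′<m) = ⊥-elim (1≢0
        (trans (sym u′m) (trans (cong (λ z → lookup z m′) e) (trans (lookup-lin a′ b′ (lin a b u′ v′) (lin c d u′ v′) m′)
      (trans (cong₂ (λ p q → a′ * p + b′ * q) (uz m′ m′<m) (vz m′ (Fin.<-trans m′<m m<n)))
        (solve 2 (λ a b → a :* con o :+ b :* con o := con o) refl a′ b′))))))
    goal (tri≈ _ refl _) = finish c≡0 (Fin.<-cmp n n′)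
      where
      c≡0 : c ≡ 0#
      c≡0 = trans (solve 2 (λ c d → c := c :* con i :+ d :* con o) refl c d) (at c d m (vz m m<n) u′m (v′z m m′<n′))
      finish : c ≡ 0# → _ → _
      finish refl (tri< n<n′ _ _) = ⊥-elim (1≢0 (trans (sym (at 0# d n vn refl (v′z n n<n′)))
        (solve 2 (λ p d → con o :* p :+ d :* con o := con o) refl (lookup u′ n) d)))
      finish refl (tri> _ _ n′<n) = ⊥-elim (1≢0 (trans (sym vn) (trans (lookup-lin 0# d u′ v′ n)
        (trans (cong (λ q → 0# * lookup u′ n + q * lookup v′ n) d≡0)
          (solve 2 (λ p q → con o :* p :+ con o :* q := con o) refl (lookup u′ n) (lookup v′ n))))))
        where
        d≡0 : d ≡ 0#
        d≡0 = trans (solve 2 (λ p d → d := con o :* p :+ d :* con i) refl (lookup u′ n′) d)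
                (at 0# d n′ (vz n′ n′<n) refl v′n)
      finish refl (tri≈ _ refl _) = cong₂ _,_
        (trans (cong₂ (λ p q → lin p q u′ v′) a≡1 b≡0) (sym (lin-1-0 u′ v′)))
        (trans (cong (λ q → lin 0# q u′ v′) d≡1) (sym (lin-0-1 u′ v′)))
        where
        a≡1 : a ≡ 1#
        a≡1 = trans (solve 2 (λ a b → a := a :* con i :+ b :* con o) refl a b) (at a b m um u′m (v′z m m′<n′))
        b≡0 : b ≡ 0#
        b≡0 = trans (solve 2 (λ a b → b := a :* con o :+ b :* con i) refl a b) (at a b n un u′n v′n)
        d≡1 : d ≡ 1#
        d≡1 = trans (solve 2 (λ p d → d := con o :* p :+ d :* con i) refl (lookup u′ n) d) (at 0# d n vn refl v′n)

  ·-assoc : ∀ a b u → a · (b · u) ≡ (a * b) · u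
  ·-assoc a b (x ∷ y ∷ z ∷ w ∷ []) = vec-cong (s x) (s y) (s z) (s w)
    where
    s : ∀ p → a * (b * p) ≡ a * b * p
    s p = sym (*-assoc a b p)

  ·-identity : ∀ u → 1# · u ≡ u
  ·-identity (x ∷ y ∷ z ∷ w ∷ []) = vec-cong (*-identityˡ x) (*-identityˡ y) (*-identityˡ z) (*-identityˡ w)

  ∼-refl : ∀ {x} → x ∼ x
  ∼-refl {x} = 1# , 1≢0 , sym (·-identity x)

  ∼-sym : ∀ {x y} → x ∼ y → y ∼ x
  ∼-sym {y = y} (c , c≢0 , refl) with inverse c c≢0
  ... | d , cd = d , nonzeroʳ cd 1≢0 ,
    trans (sym (·-identity y)) (trans (cong (_· y) (trans (sym cd) (*-comm c d))) (sym (·-assoc d c y)))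

  ∼-trans : ∀ {x y z} → x ∼ y → y ∼ z → x ∼ z
  ∼-trans {z = z} (c , c≢0 , refl) (d , d≢0 , refl) = c * d , *-nonzero c≢0 d≢0 , ·-assoc c d z

  normalized-nonzero : ∀ {x} → Normalized x → ¬ x ≡ zeroV
  normalized-nonzero (m , _ , xm) refl = 1≢0 (trans (sym xm) (lookup-zeroV m))

  normalize : ∀ {x} → ¬ x ≡ zeroV → ∃[ y ] Normalized y × y ∼ x
  normalize {x} x≢0 with leading x
  ... | inj₁ x≡0 = ⊥-elim (x≢0 x≡0)
  ... | inj₂ (m , z , nz) with inverse _ nz
  ... | a , xa = a · x ,
    (m , (λ k k<m → trans (lookup-map k (a *_) x) (trans (cong (a *_) (z k k<m)) (zeroʳ a))) ,
         trans (lookup-map m (a *_) x) (trans (*-comm a _) xa)) ,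
    a , nonzeroʳ xa 1≢0 , refl

  -- Proportional vectors have their first non-zero entry in the same place, and there the factor is
  -- read off as 1.
  normalized-unique : ∀ {x y} → Normalized x → Normalized y → x ∼ y → x ≡ y
  normalized-unique {y = y} (m , xz , xm) (n , yz , yn) (c , c≢0 , refl) with Fin.<-cmp m n
  ... | tri< m<n _ _ = ⊥-elim (1≢0
      (trans (sym xm) (trans (lookup-map m (c *_) y) (trans (cong (c *_) (yz m m<n)) (zeroʳ c)))))
  ... | tri> _ _ n<m = ⊥-elim (c≢0
      (trans (sym (*-identityʳ c)) (trans (cong (c *_) (sym yn)) (trans (sym (lookup-map n (c *_) y)) (xz n n<m)))))
  ... | tri≈ _ refl _ = trans (cong (_· y)
      (trans (sym (*-identityʳ c)) (trans (cong (c *_) (sym yn)) (trans (sym (lookup-map m (c *_) y)) xm)))) (·-identity y)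

  dot-lin : ∀ r a b u v → dot r (lin a b u v) ≡ a * dot r u + b * dot r v
  dot-lin (p ∷ q ∷ r ∷ s ∷ []) a b (x ∷ y ∷ z ∷ w ∷ []) (x′ ∷ y′ ∷ z′ ∷ w′ ∷ []) =
    solve 14 (λ p q r s a b x y z w x′ y′ z′ w′ →
      p :* (a :* x :+ b :* x′) :+ q :* (a :* y :+ b :* y′) :+ r :* (a :* z :+ b :* z′) :+ s :* (a :* w :+ b :* w′)
      := a :* (p :* x :+ q :* y :+ r :* z :+ s :* w) :+ b :* (p :* x′ :+ q :* y′ :+ r :* z′ :+ s :* w′))
      refl p q r s a b x y z w x′ y′ z′ w′

  dot-· : ∀ r a u → dot r (a · u) ≡ a * dot r u
  dot-· r a u = trans (cong (dot r) (·-as-lin a u u)) (trans (dot-lin r a 0# u u)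
    (solve 2 (λ a x → a :* x :+ con o :* x := a :* x) refl a (dot r u)))

  dot-zeroˡ : ∀ x → dot zeroV x ≡ 0#
  dot-zeroˡ (x ∷ y ∷ z ∷ w ∷ []) =
    solve 4 (λ x y z w → con o :* x :+ con o :* y :+ con o :* z :+ con o :* w := con o) refl x y z w

  dot-comm : ∀ u v → dot u v ≡ dot v u
  dot-comm (p ∷ q ∷ r ∷ s ∷ []) (x ∷ y ∷ z ∷ w ∷ []) =
    cong₂ _+_ (cong₂ _+_ (cong₂ _+_ (*-comm p x) (*-comm q y)) (*-comm r z)) (*-comm s w)

  apply-lin : ∀ M a b u v → apply M (lin a b u v) ≡ lin a b (apply M u) (apply M v)
  apply-lin (r₀ ∷ r₁ ∷ r₂ ∷ r₃ ∷ []) a b u v =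
    vec-cong (dot-lin r₀ a b u v) (dot-lin r₁ a b u v) (dot-lin r₂ a b u v) (dot-lin r₃ a b u v)

  apply-· : ∀ M a u → apply M (a · u) ≡ a · apply M u
  apply-· (r₀ ∷ r₁ ∷ r₂ ∷ r₃ ∷ []) a u = vec-cong (dot-· r₀ a u) (dot-· r₁ a u) (dot-· r₂ a u) (dot-· r₃ a u)

  transposed : M4 → M4
  transposed ((a ∷ b ∷ c ∷ d ∷ []) ∷ (a′ ∷ b′ ∷ c′ ∷ d′ ∷ []) ∷ (a″ ∷ b″ ∷ c″ ∷ d″ ∷ []) ∷ (a‴ ∷ b‴ ∷ c‴ ∷ d‴ ∷ []) ∷ []) =
    vec a a′ a″ a‴ ∷ vec b b′ b″ b‴ ∷ vec c c′ c″ c‴ ∷ vec d d′ d″ d‴ ∷ []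

  -- The dual action: plane coordinates form a row vector that is multiplied by M from the right.
  -- The result is the preimage of the plane under M, so composition is reversed.
  pull : M4 → V4 → V4
  pull M c = Vec.map (dot c) (transposed M)

  dot-pull : ∀ M c x → dot (pull M c) x ≡ dot c (apply M x)
  dot-pull ((a ∷ b ∷ c ∷ d ∷ []) ∷ (a′ ∷ b′ ∷ c′ ∷ d′ ∷ []) ∷ (a″ ∷ b″ ∷ c″ ∷ d″ ∷ []) ∷ (a‴ ∷ b‴ ∷ c‴ ∷ d‴ ∷ []) ∷ [])
           (p ∷ q ∷ r ∷ s ∷ []) (x ∷ y ∷ z ∷ w ∷ []) =
    trans (cong₂ _+_ (cong₂ _+_ (cong₂ _+_ (t a a′ a″ a‴ x) (t b b′ b″ b‴ y)) (t c c′ c″ c‴ z)) (t d d′ d″ d‴ w))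
    (trans (solve 16 (λ a b c d a′ b′ c′ d′ a″ b″ c″ d″ a‴ b‴ c‴ d‴ →
         (a :+ a′ :+ a″ :+ a‴) :+ (b :+ b′ :+ b″ :+ b‴) :+ (c :+ c′ :+ c″ :+ c‴) :+ (d :+ d′ :+ d″ :+ d‴)
      := (a :+ b :+ c :+ d) :+ (a′ :+ b′ :+ c′ :+ d′) :+ (a″ :+ b″ :+ c″ :+ d″) :+ (a‴ :+ b‴ :+ c‴ :+ d‴))
      refl _ _ _ _ _ _ _ _ _ _ _ _ _ _ _ _)
    (sym (cong₂ _+_ (cong₂ _+_ (cong₂ _+_ (t′ p a b c d) (t′ q a′ b′ c′ d′)) (t′ r a″ b″ c″ d″)) (t′ s a‴ b‴ c‴ d‴))))
    where
    t : ∀ a b c d x → (p * a + q * b + r * c + s * d) * x ≡ p * (a * x) + q * (b * x) + r * (c * x) + s * (d * x)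
    t = solve 9 (λ p q r s a b c d x → (p :* a :+ q :* b :+ r :* c :+ s :* d) :* x
          := p :* (a :* x) :+ q :* (b :* x) :+ r :* (c :* x) :+ s :* (d :* x)) refl p q r s
    t′ : ∀ p a b c d → p * (a * x + b * y + c * z + d * w) ≡ p * (a * x) + p * (b * y) + p * (c * z) + p * (d * w)
    t′ = solve 9 (λ x y z w p a b c d → p :* (a :* x :+ b :* y :+ c :* z :+ d :* w)
          := p :* (a :* x) :+ p :* (b :* y) :+ p :* (c :* z) :+ p :* (d :* w)) refl x y z w

  apply-mmul : ∀ M N x → apply (mmul M N) x ≡ apply M (apply N x)
  apply-mmul ((a ∷ b ∷ c ∷ d ∷ []) ∷ (a′ ∷ b′ ∷ c′ ∷ d′ ∷ []) ∷ (a″ ∷ b″ ∷ c″ ∷ d″ ∷ []) ∷ (a‴ ∷ b‴ ∷ c‴ ∷ d‴ ∷ []) ∷ [])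
    N@((_ ∷ _ ∷ _ ∷ _ ∷ []) ∷ (_ ∷ _ ∷ _ ∷ _ ∷ []) ∷ (_ ∷ _ ∷ _ ∷ _ ∷ []) ∷ (_ ∷ _ ∷ _ ∷ _ ∷ []) ∷ []) x =
    vec-cong (dot-pull N _ x) (dot-pull N _ x) (dot-pull N _ x) (dot-pull N _ x)

  e₀ e₁ e₂ e₃ : V4
  e₀ = vec 1# 0# 0# 0#
  e₁ = vec 0# 1# 0# 0#
  e₂ = vec 0# 0# 1# 0#
  e₃ = vec 0# 0# 0# 1#

  coordinates : ∀ r → vec (dot r e₀) (dot r e₁) (dot r e₂) (dot r e₃) ≡ r
  coordinates (a ∷ b ∷ c ∷ d ∷ []) = vec-cong
    (solve 4 (λ a b c d → a :* con i :+ b :* con o :+ c :* con o :+ d :* con o := a) refl a b c d)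
    (solve 4 (λ a b c d → a :* con o :+ b :* con i :+ c :* con o :+ d :* con o := b) refl a b c d)
    (solve 4 (λ a b c d → a :* con o :+ b :* con o :+ c :* con i :+ d :* con o := c) refl a b c d)
    (solve 4 (λ a b c d → a :* con o :+ b :* con o :+ c :* con o :+ d :* con i := d) refl a b c d)

  dot-ext : ∀ {r s} → (∀ x → dot r x ≡ dot s x) → r ≡ s
  dot-ext {r} {s} h = trans (sym (coordinates r)) (trans (vec-cong (h e₀) (h e₁) (h e₂) (h e₃)) (coordinates s))

  matrix-ext : ∀ {M N} → (∀ x → apply M x ≡ apply N x) → M ≡ N
  matrix-ext {_ ∷ _ ∷ _ ∷ _ ∷ []} {_ ∷ _ ∷ _ ∷ _ ∷ []} h =
    cong₂ _∷_ (dot-ext λ x → cong Vec.head (h x))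
      (cong₂ _∷_ (dot-ext λ x → cong (λ v → lookup v (fs f0)) (h x))
      (cong₂ _∷_ (dot-ext λ x → cong (λ v → lookup v (fs (fs f0))) (h x))
      (cong₂ _∷_ (dot-ext λ x → cong (λ v → lookup v (fs (fs (fs f0)))) (h x)) refl)))

  apply-idM : ∀ x → apply idM x ≡ x
  apply-idM x = trans (vec-cong (dot-comm e₀ x) (dot-comm e₁ x) (dot-comm e₂ x) (dot-comm e₃ x)) (coordinates x)

  OnPlane-span : ∀ {c ℓ x} → ContainsLine c ℓ → InSpan x ℓ → OnPlane x c
  OnPlane-span {c} {u , v} (cu , cv) (a , b , refl) = trans (dot-lin c a b u v)
    (trans (cong₂ (λ p q → a * p + b * q) cu cv) (solve 2 (λ a b → a :* con o :+ b :* con o := con o) refl a b))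

  OnPlane-∼ : ∀ {c c′ x} → c ∼ c′ → OnPlane x c′ → OnPlane x c
  OnPlane-∼ {c′ = c′} {x} (a , _ , refl) h = trans (dot-comm (a · c′) x) (trans (dot-· x a c′)
    (trans (cong (a *_) (trans (dot-comm x c′) h)) (zeroʳ a)))

  OnPlane-∼ₚ : ∀ {c x y} → x ∼ y → OnPlane y c → OnPlane x c
  OnPlane-∼ₚ {c} {x} {y} x∼y h = trans (dot-comm c x) (OnPlane-∼ x∼y (trans (dot-comm y c) h))

  ContainsLine-∼ : ∀ {c c′ ℓ} → c ∼ c′ → ContainsLine c′ ℓ → ContainsLine c ℓ
  ContainsLine-∼ {c} {c′} {u , v} h (p , q) = OnPlane-∼ {c} {c′} {u} h p , OnPlane-∼ {c} {c′} {v} h q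

  -- The group of the cubic

  ∼-reflexive : ∀ {x y} → x ≡ y → x ∼ y
  ∼-reflexive refl = ∼-refl

  ∼-apply : ∀ M {x y} → x ∼ y → apply M x ∼ apply M y
  ∼-apply M (c , c≢0 , refl) = c , c≢0 , apply-· M c _

  P-injective : ∀ {t s} → P t ∼ P s → t ≡ s
  P-injective {just t} {just s} (c , _ , e) with vec-injective e
  ... | _ , _ , tcs , 1c = cong just (trans tcs (trans (cong (_* s) (trans (sym (*-identityʳ c)) (sym 1c))) (*-identityˡ s)))
  P-injective {just t} {nothing} (c , _ , e) = ⊥-elim (1≢0 (trans (proj₂ (proj₂ (proj₂ (vec-injective e)))) (zeroʳ c)))
  P-injective {nothing} {just s} (c , c≢0 , e) = ⊥-elim (c≢0
      (trans (sym (*-identityʳ c)) (sym (proj₂ (proj₂ (proj₂ (vec-injective e)))))))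
  P-injective {nothing} {nothing} _ = refl

  P-nonzero : ∀ {t} → ¬ P t ≡ zeroV
  P-nonzero {just t} e = 1≢0 (proj₂ (proj₂ (proj₂ (vec-injective e))))
  P-nonzero {nothing} e = 1≢0 (proj₁ (vec-injective e))

  finiteMaybe : Count (λ (_ : Maybe F) → ⊤) (suc size)
  finiteMaybe = count-cong (λ _ _ → tt) (λ { (just t) _ → inj₂ (t , refl) ; nothing _ → inj₁ refl })
    (count-⊎ {P = _≡ nothing} {Q = λ x → ∃[ t ] x ≡ just t} (count-one nothing refl (λ _ h → h))
      (count-↔ (λ t x → x ≡ just t) (λ t _ → just t , (t , refl) , refl) (λ { _ (t , e) → t , tt , e })
        (λ _ _ _ e e′ → trans e (sym e′)) (λ { _ _ _ refl refl → refl }) finite)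
      (λ { _ refl () }))

  PreservesCubic : M4 → Set
  PreservesCubic M = ∀ t → Σ (Maybe F) λ s → apply M (P t) ∼ P s

  InG-intro : ∀ {M} N → (∀ x → apply M (apply N x) ≡ x) → (∀ x → apply N (apply M x) ≡ x) → PreservesCubic M → InG M
  InG-intro {M} N MN NM p = (N , matrix-ext (λ x → trans (apply-mmul M N x) (trans (MN x) (sym (apply-idM x))))
                               , matrix-ext (λ x → trans (apply-mmul N M x) (trans (NM x) (sym (apply-idM x))))) , p

  inv : ∀ {M} → InG M → M4
  inv ((N , _) , _) = N

  apply-inv : ∀ {M} (g : InG M) x → apply M (apply (inv g) x) ≡ x
  apply-inv {M} ((N , e , _) , _) x = trans (sym (apply-mmul M N x)) (trans (cong (λ L → apply L x) e) (apply-idM x))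

  inv-apply : ∀ {M} (g : InG M) x → apply (inv g) (apply M x) ≡ x
  inv-apply {M} ((N , _ , e) , _) x = trans (sym (apply-mmul N M x)) (trans (cong (λ L → apply L x) e) (apply-idM x))

  -- M permutes the finite set of points of the cubic, so every point is an image.
  cubic-preimage : ∀ {M} → InG M → ∀ s → ∃[ t ] apply M (P t) ∼ P s
  cubic-preimage {M} g s =
    let t , _ , e = count-surjective (≡-dec _≟_) finiteMaybe finiteMaybe σ _ (λ _ _ → σ-injective) s tt
    in t , subst (λ z → apply M (P t) ∼ P z) e (proj₂ (proj₂ g t))
    where
    σ : Maybe F → Maybe F
    σ t = proj₁ (proj₂ g t)
    σ-injective : ∀ {t t′} → σ t ≡ σ t′ → t ≡ t′
    σ-injective {t} {t′} e = P-injective (subst₂ _∼_ (inv-apply g _) (inv-apply g _) (∼-apply (inv g)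
      (∼-trans (proj₂ (proj₂ g t)) (∼-trans (∼-reflexive (cong P e)) (∼-sym (proj₂ (proj₂ g t′)))))))

  inv-InG : ∀ {M} (g : InG M) → InG (inv g)
  inv-InG {M} g = InG-intro M (inv-apply g) (apply-inv g) λ s →
    let t , h = cubic-preimage g s in t , subst (apply (inv g) (P s) ∼_) (inv-apply g (P t)) (∼-apply (inv g) (∼-sym h))

  mmul-InG : ∀ {M N} → InG M → InG N → InG (mmul M N)
  mmul-InG {M} {N} g h = InG-intro (mmul (inv h) (inv g))
    (λ x → trans (apply-mmul M N _) (trans (cong (apply M ∘ apply N) (apply-mmul (inv h) (inv g) x))
       (trans (cong (apply M) (apply-inv h _)) (apply-inv g x))))
    (λ x → trans (apply-mmul (inv h) (inv g) _) (trans (cong (apply (inv h) ∘ apply (inv g)) (apply-mmul M N x))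
       (trans (cong (apply (inv h)) (inv-apply g _)) (inv-apply h x))))
    (λ t → let s , e = proj₂ h t ; r , e′ = proj₂ g s in
       r , ∼-trans (∼-reflexive (apply-mmul M N (P t))) (∼-trans (∼-apply M e) e′))

  -- d times the matrix of t ↦ k t + s, written for characteristic 3.
  affine : F → F → F → M4
  affine d k s =
    vec (d * cube k) 0# 0# (d * cube s) ∷
    vec 0# (d * (k * k)) (- (d * (k * s))) (d * (s * s)) ∷
    vec 0# 0# (d * k) (d * s) ∷
    vec 0# 0# 0# d ∷ []

  affine-action : F → F → F → V4 → V4
  affine-action d k s (x ∷ y ∷ z ∷ w ∷ []) =
    vec (d * (cube k * x + cube s * w)) (d * (k * k * y + - (k * s) * z + s * s * w)) (d * (k * z + s * w)) (d * w)

  apply-affine : ∀ d k s x → apply (affine d k s) x ≡ affine-action d k s x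
  apply-affine d k s (x ∷ y ∷ z ∷ w ∷ []) = vec-cong
    (solve 7 (λ d k s x y z w → d :* (k :* k :* k) :* x :+ con o :* y :+ con o :* z :+ d :* (s :* s :* s) :* w
       := d :* (k :* k :* k :* x :+ s :* s :* s :* w)) refl d k s x y z w)
    (solve 7 (λ d k s x y z w → con o :* x :+ d :* (k :* k) :* y :+ :- (d :* (k :* s)) :* z :+ d :* (s :* s) :* w
       := d :* (k :* k :* y :+ :- (k :* s) :* z :+ s :* s :* w)) refl d k s x y z w)
    (solve 7 (λ d k s x y z w → con o :* x :+ con o :* y :+ d :* k :* z :+ d :* s :* w
       := d :* (k :* z :+ s :* w)) refl d k s x y z w)
    (solve 7 (λ d k s x y z w → con o :* x :+ con o :* y :+ con o :* z :+ d :* w := d :* w) refl d k s x y z w)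

  -- The inverse of t ↦ k t + s is t ↦ k′ t - k′ s. The multipliers arise from splitting k k′ - 1
  -- off differences such as (k k′)³ - 1.
  affine-inverse : ∀ {k k′} s x → k * k′ ≡ 1# →
                   affine-action 1# k s (affine-action 1# k′ (- (k′ * s)) x) ≡ x
  affine-inverse {k} {k′} s (x ∷ y ∷ z ∷ w ∷ []) h = vec-cong
    (modulo ((x + - cube s * w) * (k * k′ * (k * k′) + k * k′ + 1#)) h (solve 5 (λ k k′ s x w →
        con i :* (k :* k :* k :* (con i :* (k′ :* k′ :* k′ :* x :+ :- (k′ :* s) :* :- (k′ :* s) :* :- (k′ :* s) :* w)) :+ s :* s :* s :* (con i :* w))
        := x :+ (x :+ :- (s :* s :* s) :* w) :* (k :* k′ :* (k :* k′) :+ k :* k′ :+ con i) :* (k :* k′ :+ :- con i))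
            refl k k′ s x w))
    (modulo (y * (k * k′ + 1#) + s * z * (k * k′) + s * s * w * (k * k′ + - 1#)) h (solve 6 (λ k k′ s y z w →
        con i :* (k :* k :* (con i :* (k′ :* k′ :* y :+ :- (k′ :* :- (k′ :* s)) :* z :+ :- (k′ :* s) :* :- (k′ :* s) :* w))
          :+ :- (k :* s) :* (con i :* (k′ :* z :+ :- (k′ :* s) :* w)) :+ s :* s :* (con i :* w))
        := y :+ (y :* (k :* k′ :+ con i) :+ s :* z :* (k :* k′) :+ s :* s :* w :* (k :* k′ :+ :- con i)) :* (k :* k′ :+ :- con i))
            refl k k′ s y z w))
    (modulo (z + - (s * w)) h (solve 5 (λ k k′ s z w →
        con i :* (k :* (con i :* (k′ :* z :+ :- (k′ :* s) :* w)) :+ s :* (con i :* w))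
        := z :+ (z :+ :- (s :* w)) :* (k :* k′ :+ :- con i)) refl k k′ s z w))
    (solve 1 (λ w → con i :* (con i :* w) := w) refl w)

  affine-InG : ∀ {k} s → ¬ k ≡ 0# → InG (affine 1# k s)
  affine-InG {k} s k≢0 with inverse k k≢0
  ... | k′ , kk′ = InG-intro (affine 1# k′ (- (k′ * s)))
    (λ x → trans (apply-affine 1# k s _)
        (trans (cong (affine-action 1# k s) (apply-affine 1# k′ _ x)) (affine-inverse s x kk′)))
    (λ x → trans (apply-affine 1# k′ (- (k′ * s)) _) (trans (cong (affine-action 1# k′ (- (k′ * s))) (apply-affine 1# k s x))
      (trans (cong (λ z → affine-action 1# k′ (- (k′ * s)) (affine-action 1# k z x)) s≡)
        (affine-inverse (- (k′ * s)) x (trans (*-comm k′ k) kk′)))))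
    λ { (just t) → just (k * t + s) , ∼-reflexive (trans (apply-affine 1# k s _) (vec-cong
          (solve 3 (λ k s t → con i :* (k :* k :* k :* (t :* t :* t) :+ s :* s :* s :* con i)
              := (k :* t :+ s) :* (k :* t :+ s) :* (k :* t :+ s)) refl k s t)
          (solve 3 (λ k s t → con i :* (k :* k :* (t :* t) :+ :- (k :* s) :* t :+ s :* s :* con i)
              := (k :* t :+ s) :* (k :* t :+ s)) refl k s t)
          (solve 3 (λ k s t → con i :* (k :* t :+ s :* con i) := k :* t :+ s) refl k s t)
          (*-identityˡ 1#)))
      ; nothing → nothing , cube k , (λ h → k≢0 (cube-zero h)) , trans (apply-affine 1# k s _) (vec-cong
          (solve 2 (λ k s → con i :* (k :* k :* k :* con i :+ s :* s :* s :* con o) := k :* k :* k :* con i) refl k s)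
          (solve 2 (λ k s → con i :* (k :* k :* con o :+ :- (k :* s) :* con o :+ s :* s :* con o)
              := k :* k :* k :* con o) refl k s)
          (solve 2 (λ k s → con i :* (k :* con o :+ s :* con o) := k :* k :* k :* con o) refl k s)
          (solve 1 (λ k → con i :* con o := k :* k :* k :* con o) refl k)) }
    where
    -- The other composite is the same identity with k and k′ exchanged, once s is written as the
    -- translation part belonging to - k′ s.
    s≡ : s ≡ - (k * - (k′ * s))
    s≡ = modulo (- s) kk′ (solve 3 (λ k k′ s → s := :- (k :* :- (k′ :* s)) :+ :- s :* (k :* k′ :+ :- con i)) refl k k′ s)

  reversal : M4
  reversal = e₃ ∷ e₂ ∷ e₁ ∷ e₀ ∷ []

  reverse : V4 → V4
  reverse (x ∷ y ∷ z ∷ w ∷ []) = vec w z y x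

  apply-reversal : ∀ x → apply reversal x ≡ reverse x
  apply-reversal x@(_ ∷ _ ∷ _ ∷ _ ∷ []) = trans (vec-cong (dot-comm e₃ x) (dot-comm e₂ x) (dot-comm e₁ x) (dot-comm e₀ x)) (cong reverse (coordinates x))

  -- This is t ↦ 1/t: for t ≠ 0 the reversed vector (1, t, t², t³) is t³ times P(1/t), while 0 and ∞
  -- change places.
  reversal-InG : InG reversal
  reversal-InG = InG-intro reversal involutive involutive preserves
    where
    involutive : ∀ x → apply reversal (apply reversal x) ≡ x
    involutive x@(_ ∷ _ ∷ _ ∷ _ ∷ []) = trans (apply-reversal _) (cong reverse (apply-reversal x))
    preserves : PreservesCubic reversal
    preserves nothing = just 0# , ∼-reflexive (trans (apply-reversal (P nothing)) (vec-cong
      (solve 0 (con o := con o :* con o :* con o) refl) (solve 0 (con o := con o :* con o) refl) refl refl))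
    preserves (just t) with t ≟ 0#
    ... | yes refl = nothing , ∼-reflexive (trans (apply-reversal (P (just 0#))) (vec-cong
      refl refl (solve 0 (con o :* con o := con o) refl) (solve 0 (con o :* con o :* con o := con o) refl)))
    ... | no t≢0 with inverse t t≢0
    ... | u , tu = just u , cube t , (λ h → t≢0 (cube-zero h)) , trans (apply-reversal (P (just t))) (vec-cong
      (modulo (- (t * u * (t * u) + t * u + 1#)) tu
          (solve 2 (λ t u → con i
              := t :* t :* t :* (u :* u :* u) :+ :- (t :* u :* (t :* u) :+ t :* u :+ con i) :* (t :* u :+ :- con i))
                  refl t u))
      (modulo (- (t * (t * u + 1#))) tu
          (solve 2 (λ t u → t := t :* t :* t :* (u :* u) :+ :- (t :* (t :* u :+ con i)) :* (t :* u :+ :- con i)) refl t u))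
      (modulo (- (t * t)) tu (solve 2 (λ t u → t :* t := t :* t :* t :* u :+ :- (t :* t) :* (t :* u :+ :- con i)) refl t u))
      (sym (*-identityʳ _)))

  -- t ↦ s + 1/t, which moves ∞ to s.
  turn : F → M4
  turn s = mmul (affine 1# 1# s) reversal

  turn-InG : ∀ s → InG (turn s)
  turn-InG s = mmul-InG {affine 1# 1# s} {reversal} (affine-InG s 1≢0) reversal-InG

  apply-turn : ∀ s x → apply (turn s) x ≡ affine-action 1# 1# s (reverse x)
  apply-turn s x = trans (apply-mmul (affine 1# 1# s) reversal x)
    (trans (cong (apply (affine 1# 1# s)) (apply-reversal x)) (apply-affine 1# 1# s (reverse x)))

  turn-∞ : ∀ s → apply (turn s) (P nothing) ≡ P (just s)
  turn-∞ s = trans (apply-turn s (P nothing)) (vec-cong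
    (solve 1 (λ s → con i :* (con i :* con i :* con i :* con o :+ s :* s :* s :* con i) := s :* s :* s) refl s)
    (solve 1 (λ s → con i :* (con i :* con i :* con o :+ :- (con i :* s) :* con o :+ s :* s :* con i) := s :* s) refl s)
    (solve 1 (λ s → con i :* (con i :* con o :+ s :* con i) := s) refl s)
    (*-identityˡ 1#))

  turn-axis : ∀ s b c → apply (turn s) (vec 0# b c 0#) ≡ vec 0# (c + - (s * b)) b 0#
  turn-axis s b c = trans (apply-turn s (vec 0# b c 0#)) (vec-cong
    (solve 1 (λ s → con i :* (con i :* con i :* con i :* con o :+ s :* s :* s :* con o) := con o) refl s)
    (solve 3 (λ s b c → con i :* (con i :* con i :* c :+ :- (con i :* s) :* b :+ s :* s :* con o)
        := c :+ :- (s :* b)) refl s b c)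
    (solve 3 (λ s b c → con i :* (con i :* b :+ s :* con o) := b) refl s b c)
    (*-identityˡ 0#))

  -- The product of two polynomials, whose top coefficients come first; in the product the constant term does.
  convolve : V4 → V4 → Vec F 7
  convolve (a₃ ∷ a₂ ∷ a₁ ∷ a₀ ∷ []) (b₃ ∷ b₂ ∷ b₁ ∷ b₀ ∷ []) =
    a₀ * b₀ ∷
    a₀ * b₁ + a₁ * b₀ ∷
    a₀ * b₂ + a₁ * b₁ + a₂ * b₀ ∷
    a₀ * b₃ + a₁ * b₂ + a₂ * b₁ + a₃ * b₀ ∷
    a₁ * b₃ + a₂ * b₂ + a₃ * b₁ ∷
    a₂ * b₃ + a₃ * b₂ ∷
    a₃ * b₃ ∷ []

  evalPoly-convolve : ∀ p q t → evalPoly (convolve p q) t ≡ dot p (P (just t)) * dot q (P (just t))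
  evalPoly-convolve (a₃ ∷ a₂ ∷ a₁ ∷ a₀ ∷ []) (b₃ ∷ b₂ ∷ b₁ ∷ b₀ ∷ []) t =
    solve 9 (λ a₃ a₂ a₁ a₀ b₃ b₂ b₁ b₀ t →
      a₀ :* b₀ :+ t :* (a₀ :* b₁ :+ a₁ :* b₀ :+ t :* (a₀ :* b₂ :+ a₁ :* b₁ :+ a₂ :* b₀
        :+ t :* (a₀ :* b₃ :+ a₁ :* b₂ :+ a₂ :* b₁ :+ a₃ :* b₀ :+ t :* (a₁ :* b₃ :+ a₂ :* b₂ :+ a₃ :* b₁
        :+ t :* (a₂ :* b₃ :+ a₃ :* b₂ :+ t :* (a₃ :* b₃ :+ t :* con o))))))
      := (a₃ :* (t :* t :* t) :+ a₂ :* (t :* t) :+ a₁ :* t :+ a₀ :* con i)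
         :* (b₃ :* (t :* t :* t) :+ b₂ :* (t :* t) :+ b₁ :* t :+ b₀ :* con i))
      refl a₃ a₂ a₁ a₀ b₃ b₂ b₁ b₀ t

  -- Two polynomials of degree at most 6 that agree as functions have the same seven coefficients if
  -- the field has at least seven elements; this is the purpose of `7≤size`.
  convolve-unique : ∀ p q r s → (∀ t → dot p (P (just t)) * dot q (P (just t)) ≡ dot r (P (just t)) * dot s (P (just t))) →
                    convolve p q ≡ convolve r s
  convolve-unique p q r s h = evalPoly-injective 7≤size _ _ λ t →
    trans (evalPoly-convolve p q t) (trans (h t) (sym (evalPoly-convolve r s t)))

  Quadrics : V4 → Set
  Quadrics (x ∷ y ∷ z ∷ w ∷ []) = y * y ≡ x * z × z * z ≡ y * w × x * w ≡ y * z

  P-quadrics : ∀ t → Quadrics (P t)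
  P-quadrics (just t) =
    solve 1 (λ t → t :* t :* (t :* t) := t :* t :* t :* t) refl t ,
    solve 1 (λ t → t :* t := t :* t :* con i) refl t ,
    solve 1 (λ t → t :* t :* t :* con i := t :* t :* t) refl t
  P-quadrics nothing = solve 0 (con o :* con o := con i :* con o) refl ,
      refl , solve 0 (con i :* con o := con o :* con o) refl

  quadrics-∼ : ∀ {x y} → x ∼ y → Quadrics y → Quadrics x
  quadrics-∼ {y = x ∷ y ∷ z ∷ w ∷ []} (c , _ , refl) (h , h′ , h″) = s y y x z h , s z z y w h′ , s x w y z h″
    where
    s : ∀ p q r t → p * q ≡ r * t → c * p * (c * q) ≡ c * r * (c * t)
    s p q r t e = modulo (c * c) e
        (solve 5 (λ c p q r t → c :* p :* (c :* q)
            := c :* r :* (c :* t) :+ c :* c :* (p :* q :+ :- (r :* t))) refl c p q r t)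

  -- Divided by d, the third row is k t + s with k = c₁/d and s = c₀/d; then z² = yw makes the
  -- second row its square, and xw = yz makes the first row its cube. The sign of - (c₀ c₁) comes
  -- from 2 = - 1, and the middle entries of the first row vanish like the binomial coefficients 3.
  triangular≡affine : ∀ {a₃ a₂ a₁ a₀ b₂ b₁ b₀ c₁ c₀ d d′} → d * d′ ≡ 1# →
    c₁ * c₁ ≡ b₂ * d → - (c₀ * c₁) ≡ b₁ * d → c₀ * c₀ ≡ b₀ * d →
    a₃ * d ≡ b₂ * c₁ → a₂ * d ≡ b₂ * c₀ + b₁ * c₁ → a₁ * d ≡ b₁ * c₀ + b₀ * c₁ → a₀ * d ≡ b₀ * c₀ →
    vec a₃ a₂ a₁ a₀ ∷ vec 0# b₂ b₁ b₀ ∷ vec 0# 0# c₁ c₀ ∷ vec 0# 0# 0# d ∷ [] ≡ affine d (d′ * c₁) (d′ * c₀)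
  triangular≡affine {a₃} {a₂} {a₁} {a₀} {b₂} {b₁} {b₀} {c₁} {c₀} {d} {d′} dd′ hb₂ hb₁ hb₀ ha₃ ha₂ ha₁ ha₀ =
    cong₂ _∷_ (vec-cong (top (trans ha₃ (cong (_* c₁) b₂≡)) cube₁)
        (trans (divide (trans ha₂ (trans (cong₂ (λ p q → p * c₀ + q * c₁) b₂≡ b₁≡) vanish₂))) (zeroˡ d′))
        (trans (divide (trans ha₁ (trans (cong₂ (λ p q → p * c₀ + q * c₁) b₁≡ b₀≡) vanish₁))) (zeroˡ d′))
        (top (trans ha₀ (cong (_* c₀) b₀≡)) cube₀))
    (cong₂ _∷_ (vec-cong refl (trans b₂≡ square₁) (trans b₁≡ product) (trans b₀≡ square₀))
    (cong₂ _∷_ (vec-cong refl refl (undo c₁) (undo c₀)) refl))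
    where
    divide : ∀ {x y} → x * d ≡ y → x ≡ y * d′
    divide {x} {y} h = modulo₂ d′ (- x) h dd′
      (solve 4 (λ x y d e → x := y :* e :+ e :* (x :* d :+ :- y) :+ :- x :* (d :* e :+ :- con i)) refl x y d d′)
    top : ∀ {x y z} → x * d ≡ y → y * d′ ≡ z → x ≡ z
    top h e = trans (divide h) e
    b₂≡ : b₂ ≡ c₁ * c₁ * d′
    b₂≡ = divide (sym hb₂)
    b₁≡ : b₁ ≡ - (c₀ * c₁) * d′
    b₁≡ = divide (sym hb₁)
    b₀≡ : b₀ ≡ c₀ * c₀ * d′
    b₀≡ = divide (sym hb₀)
    undo : ∀ c → c ≡ d * (d′ * c)
    undo c = modulo (- c) dd′ (solve 3 (λ c d e → c := d :* (e :* c) :+ :- c :* (d :* e :+ :- con i)) refl c d d′)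
    square : ∀ c → c * c * d′ ≡ d * (d′ * c * (d′ * c))
    square c = modulo (- (c * c * d′)) dd′
        (solve 3 (λ c d e → c :* c :* e
            := d :* (e :* c :* (e :* c)) :+ :- (c :* c :* e) :* (d :* e :+ :- con i)) refl c d d′)
    square₁ = square c₁
    square₀ = square c₀
    product : - (c₀ * c₁) * d′ ≡ - (d * (d′ * c₁ * (d′ * c₀)))
    product = modulo (c₀ * c₁ * d′) dd′
        (solve 4 (λ b c d e → :- (b :* c) :* e
            := :- (d :* (e :* c :* (e :* b))) :+ b :* c :* e :* (d :* e :+ :- con i)) refl c₀ c₁ d d′)
    cubed : ∀ c → c * c * d′ * c * d′ ≡ d * cube (d′ * c)
    cubed c = modulo (- (c * c * c * d′ * d′)) dd′
        (solve 3 (λ c d e → c :* c :* e :* c :* e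
            := d :* (e :* c :* (e :* c) :* (e :* c)) :+ :- (c :* c :* c :* e :* e) :* (d :* e :+ :- con i)) refl c d d′)
    cube₁ = cubed c₁
    cube₀ = cubed c₀
    vanish₂ : c₁ * c₁ * d′ * c₀ + - (c₀ * c₁) * d′ * c₁ ≡ 0#
    vanish₂ = solve 3 (λ b c e → c :* c :* e :* b :+ :- (b :* c) :* e :* c := con o) refl c₀ c₁ d′
    vanish₁ : - (c₀ * c₁) * d′ * c₀ + c₀ * c₀ * d′ * c₁ ≡ 0#
    vanish₁ = solve 3 (λ b c e → :- (b :* c) :* e :* b :+ b :* b :* e :* c := con o) refl c₀ c₁ d′

  -- A degree argument: x has degree 3 and y at most 2, so y² = xz leaves z degree at most 1. Then
  -- yz has degree at most 3, and xw = yz forces w to be constant.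
  leading-coefficients-zero : ∀ a₃ a₂ a₁ a₀ b₂ b₁ b₀ c₂ c₁ c₀ d₂ d₁ d₀ → ¬ a₃ ≡ 0# →
    convolve (vec 0# b₂ b₁ b₀) (vec 0# b₂ b₁ b₀) ≡ convolve (vec a₃ a₂ a₁ a₀) (vec 0# c₂ c₁ c₀) →
    convolve (vec a₃ a₂ a₁ a₀) (vec 0# d₂ d₁ d₀) ≡ convolve (vec 0# b₂ b₁ b₀) (vec 0# c₂ c₁ c₀) →
    c₂ ≡ 0# × d₂ ≡ 0# × d₁ ≡ 0#
  leading-coefficients-zero a₃ a₂ a₁ a₀ b₂ b₁ b₀ c₂ c₁ c₀ d₂ d₁ d₀ a₃≢0 E₁ E₃ = c₂≡0 , d₂≡0 , d₁≡0
    where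
    t⁵₁ : b₂ * 0# + 0# * b₂ ≡ a₂ * 0# + a₃ * c₂
    t⁵₁ = cong (λ v → lookup v (fs (fs (fs (fs (fs f0)))))) E₁
    t⁵₃ : a₂ * 0# + a₃ * d₂ ≡ b₂ * 0# + 0# * c₂
    t⁵₃ = cong (λ v → lookup v (fs (fs (fs (fs (fs f0)))))) E₃
    t⁴₃ : a₁ * 0# + a₂ * d₂ + a₃ * d₁ ≡ b₁ * 0# + b₂ * c₂ + 0# * c₁
    t⁴₃ = cong (λ v → lookup v (fs (fs (fs (fs f0))))) E₃
    c₂≡0 : c₂ ≡ 0#
    c₂≡0 = *-cancel-0 a₃≢0 (modulo (- 1#) t⁵₁
      (solve 4 (λ a₃ a₂ b₂ c₂ → a₃ :* c₂
          := con o :+ :- con i :* (b₂ :* con o :+ con o :* b₂ :+ :- (a₂ :* con o :+ a₃ :* c₂))) refl a₃ a₂ b₂ c₂))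
    d₂≡0 : d₂ ≡ 0#
    d₂≡0 = *-cancel-0 a₃≢0 (modulo 1# t⁵₃
      (solve 5 (λ a₃ a₂ b₂ c₂ d₂ → a₃ :* d₂
          := con o :+ con i :* (a₂ :* con o :+ a₃ :* d₂ :+ :- (b₂ :* con o :+ con o :* c₂))) refl a₃ a₂ b₂ c₂ d₂))
    d₁≡0 : d₁ ≡ 0#
    d₁≡0 = *-cancel-0 a₃≢0 (modulo 1# t⁴₃ (modulo₂ b₂ (- a₂) c₂≡0 d₂≡0
      (solve 9 (λ a₃ a₂ a₁ b₂ b₁ c₂ c₁ d₂ d₁ → a₃ :* d₁
          := con o :+ con i :* (a₁ :* con o :+ a₂ :* d₂ :+ a₃ :* d₁ :+ :- (b₁ :* con o :+ b₂ :* c₂ :+ con o :* c₁))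
         :+ b₂ :* (c₂ :+ :- con o) :+ :- a₂ :* (d₂ :+ :- con o)) refl a₃ a₂ a₁ b₂ b₁ c₂ c₁ d₂ d₁)))

  quadrics⇒affine : ∀ a₃ a₂ a₁ a₀ b₂ b₁ b₀ c₁ c₀ d → ¬ a₃ ≡ 0# → ¬ d ≡ 0# →
    convolve (vec 0# 0# c₁ c₀) (vec 0# 0# c₁ c₀) ≡ convolve (vec 0# b₂ b₁ b₀) (vec 0# 0# 0# d) →
    convolve (vec a₃ a₂ a₁ a₀) (vec 0# 0# 0# d) ≡ convolve (vec 0# b₂ b₁ b₀) (vec 0# 0# c₁ c₀) →
    ∃[ k ] ∃[ s ] (¬ k ≡ 0#) ×
    vec a₃ a₂ a₁ a₀ ∷ vec 0# b₂ b₁ b₀ ∷ vec 0# 0# c₁ c₀ ∷ vec 0# 0# 0# d ∷ [] ≡ affine d k s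
  quadrics⇒affine a₃ a₂ a₁ a₀ b₂ b₁ b₀ c₁ c₀ d a₃≢0 d≢0 E₂ E₃ =
    let d′ , dd′ = inverse d d≢0 in
    d′ * c₁ , d′ * c₀ ,
    -- The factor c₁ is non-zero because b₂ c₁ = a₃ d is.
    *-nonzero (nonzeroʳ dd′ 1≢0) (nonzeroʳ (sym ha₃) (*-nonzero a₃≢0 d≢0)) ,
    triangular≡affine dd′ hb₂ hb₁ hb₀ ha₃ ha₂ ha₁ ha₀
    where
    hb₀ : c₀ * c₀ ≡ b₀ * d
    hb₀ = cong (λ v → lookup v f0) E₂
    ha₀ : a₀ * d ≡ b₀ * c₀
    ha₀ = cong (λ v → lookup v f0) E₃
    l₁ : a₀ * 0# + a₁ * d ≡ b₀ * c₁ + b₁ * c₀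
    l₁ = cong (λ v → lookup v (fs f0)) E₃
    l₂ : a₀ * 0# + a₁ * 0# + a₂ * d ≡ b₀ * 0# + b₁ * c₁ + b₂ * c₀
    l₂ = cong (λ v → lookup v (fs (fs f0))) E₃
    l₃ : a₀ * 0# + a₁ * 0# + a₂ * 0# + a₃ * d ≡ b₀ * 0# + b₁ * 0# + b₂ * c₁ + 0# * c₀
    l₃ = cong (λ v → lookup v (fs (fs (fs f0)))) E₃
    h₁ : c₀ * c₁ + c₁ * c₀ ≡ b₀ * 0# + b₁ * d
    h₁ = cong (λ v → lookup v (fs f0)) E₂
    h₂ : c₀ * 0# + c₁ * c₁ + 0# * c₀ ≡ b₀ * 0# + b₁ * 0# + b₂ * d
    h₂ = cong (λ v → lookup v (fs (fs f0))) E₂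
    hb₂ : c₁ * c₁ ≡ b₂ * d
    hb₂ = modulo 1# h₂
        (solve 6 (λ b₂ b₁ b₀ c₁ c₀ d → c₁ :* c₁
            := b₂ :* d :+ con i :* (c₀ :* con o :+ c₁ :* c₁ :+ con o :* c₀ :+ :- (b₀ :* con o :+ b₁ :* con o :+ b₂ :* d)))
                refl b₂ b₁ b₀ c₁ c₀ d)
    hb₁ : - (c₀ * c₁) ≡ b₁ * d
    hb₁ = modulo 1# h₁
        (solve 5 (λ b₁ b₀ c₁ c₀ d → :- (c₀ :* c₁)
            := b₁ :* d :+ con i :* (c₀ :* c₁ :+ c₁ :* c₀ :+ :- (b₀ :* con o :+ b₁ :* d))) refl b₁ b₀ c₁ c₀ d)
    ha₃ : a₃ * d ≡ b₂ * c₁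
    ha₃ = modulo 1# l₃
        (solve 10 (λ a₃ a₂ a₁ a₀ b₂ b₁ b₀ c₁ c₀ d → a₃ :* d
            := b₂ :* c₁ :+ con i :* (a₀ :* con o :+ a₁ :* con o :+ a₂ :* con o :+ a₃ :* d :+ :- (b₀ :* con o :+ b₁ :* con o :+ b₂ :* c₁ :+ con o :* c₀)))
                refl a₃ a₂ a₁ a₀ b₂ b₁ b₀ c₁ c₀ d)
    ha₂ : a₂ * d ≡ b₂ * c₀ + b₁ * c₁
    ha₂ = modulo 1# l₂
        (solve 9 (λ a₂ a₁ a₀ b₂ b₁ b₀ c₁ c₀ d → a₂ :* d
            := b₂ :* c₀ :+ b₁ :* c₁ :+ con i :* (a₀ :* con o :+ a₁ :* con o :+ a₂ :* d :+ :- (b₀ :* con o :+ b₁ :* c₁ :+ b₂ :* c₀)))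
                refl a₂ a₁ a₀ b₂ b₁ b₀ c₁ c₀ d)
    ha₁ : a₁ * d ≡ b₁ * c₀ + b₀ * c₁
    ha₁ = modulo 1# l₁
        (solve 7 (λ a₁ a₀ b₁ b₀ c₁ c₀ d → a₁ :* d
            := b₁ :* c₀ :+ b₀ :* c₁ :+ con i :* (a₀ :* con o :+ a₁ :* d :+ :- (b₀ :* c₁ :+ b₁ :* c₀)))
                refl a₁ a₀ b₁ b₀ c₁ c₀ d)

  -- The image of the cubic lies on the quadrics through the cubic; comparing
  -- coefficients in these equations leaves only the maps t ↦ k t + s.
  fixes-∞⇒affine : ∀ {M} → InG M → apply M (P nothing) ∼ P nothing →
                   ∃[ d ] ∃[ k ] ∃[ s ] (¬ d ≡ 0#) × (¬ k ≡ 0#) × M ≡ affine d k s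
  fixes-∞⇒affine {r₀@(a₃ ∷ a₂ ∷ a₁ ∷ a₀ ∷ []) ∷ r₁@(b₃ ∷ b₂ ∷ b₁ ∷ b₀ ∷ []) ∷ r₂@(c₃ ∷ c₂ ∷ c₁ ∷ c₀ ∷ []) ∷ r₃@(d₃ ∷ d₂ ∷ d₁ ∷ d₀ ∷ []) ∷ []}
    g (u , u≢0 , fix) =
    let ea , eb , ec , ed = vec-injective fix in
    triangulate (entry b₃ b₂ b₁ b₀ eb) (entry c₃ c₂ c₁ c₀ ec) (entry d₃ d₂ d₁ d₀ ed) (corner ea) E₁ E₂ E₃
    where
    M : M4
    M = r₀ ∷ r₁ ∷ r₂ ∷ r₃ ∷ []
    on-quadrics : ∀ t → Quadrics (apply M (P (just t)))
    on-quadrics t = quadrics-∼ {apply M (P (just t))} {P (proj₁ (proj₂ g (just t)))} (proj₂ (proj₂ g (just t))) (P-quadrics (proj₁ (proj₂ g (just t))))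
    E₁ : convolve r₁ r₁ ≡ convolve r₀ r₂
    E₁ = convolve-unique r₁ r₁ r₀ r₂ (λ t → proj₁ (on-quadrics t))
    E₂ : convolve r₂ r₂ ≡ convolve r₁ r₃
    E₂ = convolve-unique r₂ r₂ r₁ r₃ (λ t → proj₁ (proj₂ (on-quadrics t)))
    E₃ : convolve r₀ r₃ ≡ convolve r₁ r₂
    E₃ = convolve-unique r₀ r₃ r₁ r₂ (λ t → proj₂ (proj₂ (on-quadrics t)))
    entry : ∀ a b c d → a * 1# + b * 0# + c * 0# + d * 0# ≡ u * 0# → a ≡ 0#
    entry a b c d e = modulo 1# e
        (solve 5 (λ a b c d u → a
            := con o :+ con i :* (a :* con i :+ b :* con o :+ c :* con o :+ d :* con o :+ :- (u :* con o))) refl a b c d u)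
    corner : a₃ * 1# + a₂ * 0# + a₁ * 0# + a₀ * 0# ≡ u * 1# → ¬ a₃ ≡ 0#
    corner ea h = u≢0 (modulo₂ (- 1#) 1# ea h
        (solve 5 (λ a b c d u → u
            := con o :+ :- con i :* (a :* con i :+ b :* con o :+ c :* con o :+ d :* con o :+ :- (u :* con i)) :+ con i :* (a :+ :- con o))
                refl a₃ a₂ a₁ a₀ u))
    -- An invertible matrix has no zero row, since some vector is sent to `e₃`.
    last-row : ¬ r₃ ≡ zeroV
    last-row h = 1≢0 (trans (sym (cong (λ v → lookup v (fs (fs (fs f0)))) (apply-inv {M} g e₃)))
      (trans (cong (λ r → dot r y) h) (dot-zeroˡ y)))
      where
      y : V4
      y = apply (inv {M} g) e₃
    triangulate : b₃ ≡ 0# → c₃ ≡ 0# → d₃ ≡ 0# → ¬ a₃ ≡ 0# →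
      convolve r₁ r₁ ≡ convolve r₀ r₂ → convolve r₂ r₂ ≡ convolve r₁ r₃ → convolve r₀ r₃ ≡ convolve r₁ r₂ →
      ∃[ d ] ∃[ k ] ∃[ s ] (¬ d ≡ 0#) × (¬ k ≡ 0#) × M ≡ affine d k s
    triangulate refl refl refl a₃≢0 E₁ E₂ E₃ = finish (leading-coefficients-zero a₃ a₂ a₁ a₀ b₂ b₁ b₀ c₂ c₁ c₀ d₂ d₁ d₀ a₃≢0 E₁ E₃) E₂ E₃
      where
      finish : c₂ ≡ 0# × d₂ ≡ 0# × d₁ ≡ 0# → convolve r₂ r₂ ≡ convolve r₁ r₃ → convolve r₀ r₃ ≡ convolve r₁ r₂ →
        ∃[ d ] ∃[ k ] ∃[ s ] (¬ d ≡ 0#) × (¬ k ≡ 0#) × M ≡ affine d k s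
      finish (refl , refl , refl) E₂ E₃ =
        d₀ , proj₁ q , proj₁ (proj₂ q) , d₀≢0 , proj₂ (proj₂ q)
        where
        d₀≢0 : ¬ d₀ ≡ 0#
        d₀≢0 h = last-row (vec-cong refl refl refl h)
        q = quadrics⇒affine a₃ a₂ a₁ a₀ b₂ b₁ b₀ c₁ c₀ d₀ a₃≢0 d₀≢0 E₂ E₃

  onAxis : F → F → V4
  onAxis b c = vec 0# b c 0#

  affine-axis : ∀ d k s b c → apply (affine d k s) (onAxis b c) ≡ onAxis (d * (k * k * b + - (k * s) * c)) (d * (k * c))
  affine-axis d k s b c = trans (apply-affine d k s (onAxis b c)) (vec-cong
    (solve 3 (λ d k s → d :* (k :* k :* k :* con o :+ s :* s :* s :* con o) := con o) refl d k s)
    (solve 5 (λ d k s b c → d :* (k :* k :* b :+ :- (k :* s) :* c :+ s :* s :* con o)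
        := d :* (k :* k :* b :+ :- (k :* s) :* c)) refl d k s b c)
    (solve 4 (λ d k s c → d :* (k :* c :+ s :* con o) := d :* (k :* c)) refl d k s c)
    (zeroʳ d))

  -- Composition with the inverse of `turn s` brings ∞ back to itself, so the description of the
  -- stabiliser of P(∞) applies to the composite.
  moves-∞⇒turn : ∀ {M} → InG M → ∀ s → apply M (P nothing) ∼ P (just s) →
    ∃[ d ] ∃[ k ] ∃[ r ] (¬ d ≡ 0#) × (¬ k ≡ 0#) × (∀ x → apply M x ≡ apply (turn s) (apply (affine d k r) x))
  moves-∞⇒turn {M} g s h =
    let d , k , r , d≢0 , k≢0 , e = fixes-∞⇒affine {mmul T⁻¹ M} (mmul-InG {T⁻¹} {M} (inv-InG {turn s} (turn-InG s)) g) fixed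
    in d , k , r , d≢0 , k≢0 , λ x → trans (sym (apply-inv {turn s} (turn-InG s) (apply M x)))
         (cong (apply (turn s)) (trans (sym (apply-mmul T⁻¹ M x)) (cong (λ L → apply L x) e)))
    where
    T⁻¹ : M4
    T⁻¹ = inv {turn s} (turn-InG s)
    fixed : apply (mmul T⁻¹ M) (P nothing) ∼ P nothing
    fixed = ∼-trans (∼-reflexive (apply-mmul T⁻¹ M (P nothing))) (∼-trans (∼-apply T⁻¹ h)
      (∼-reflexive (trans (cong (apply T⁻¹) (sym (turn-∞ s))) (inv-apply {turn s} (turn-InG s) (P nothing)))))

  axis-preserved : ∀ {M} → InG M → ∀ b c → ∃[ b′ ] ∃[ c′ ] apply M (onAxis b c) ≡ onAxis b′ c′
  axis-preserved {M} g b c = case-of (proj₂ g nothing)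
    where
    case-of : (∃[ s ] apply M (P nothing) ∼ P s) → _
    case-of (nothing , h) = let d , k , s , _ , _ , e = fixes-∞⇒affine {M} g h in
      _ , _ , trans (cong (λ L → apply L (onAxis b c)) e) (affine-axis d k s b c)
    case-of (just s , h) = let d , k , r , _ , _ , e = moves-∞⇒turn {M} g s h in
      _ , _ , trans (e (onAxis b c)) (trans (cong (apply (turn s)) (affine-axis d k r b c)) (turn-axis s _ _))

  -- Geometrically, tangents go to tangents: `e₁` is where the tangent at P(∞) meets the axis, and
  -- (0, - s, 1, 0) is where the tangent at P(s) does.
  moves-∞⇒e₁ : ∀ {M} → InG M → ∀ s → apply M (P nothing) ∼ P (just s) →
               ∃[ d ] (¬ d ≡ 0#) × apply M e₁ ≡ onAxis (- (s * d)) d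
  moves-∞⇒e₁ {M} g s h =
    let d , k , r , d≢0 , k≢0 , e = moves-∞⇒turn {M} g s h
    in d * (k * k) , *-nonzero d≢0 (*-nonzero k≢0 k≢0) ,
       trans (e e₁) (trans (cong (apply (turn s)) (affine-axis d k r 1# 0#)) (trans (turn-axis s _ _) (vec-cong refl
         (solve 4 (λ d k r s → d :* (k :* con o) :+ :- (s :* (d :* (k :* k :* con i :+ :- (k :* r) :* con o)))
             := :- (s :* (d :* (k :* k)))) refl d k r s)
         (solve 3 (λ d k r → d :* (k :* k :* con i :+ :- (k :* r) :* con o) := d :* (k :* k)) refl d k r) refl)))

  -- Γ-planes, and transport of plane types along the group

  dot-axis : ∀ c₀ c₁ c₂ c₃ b c → dot (vec c₀ c₁ c₂ c₃) (onAxis b c) ≡ c₁ * b + c₂ * c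
  dot-axis = solve 6 (λ c₀ c₁ c₂ c₃ b c → c₀ :* con o :+ c₁ :* b :+ c₂ :* c :+ c₃ :* con o := c₁ :* b :+ c₂ :* c) refl

  -- The two middle coordinates of an osculating plane carry the factor 3.
  gamma⇒axis : ∀ {c} → GammaPlane c → ∀ b d → OnPlane (onAxis b d) c
  gamma⇒axis (inj₁ (t , a , _ , refl)) b d = modulo (a * (- t * b + t * t * d)) 3≡0
    (solve 5 (λ a t b d th → a :* con i :* con o :+ a :* :- (th :* t) :* b :+ a :* (th :* (t :* t)) :* d :+ a :* :- (t :* t :* t) :* con o
       := con o :+ a :* (:- t :* b :+ t :* t :* d) :* (th :+ :- con o)) refl a t b d three)
  gamma⇒axis (inj₂ (a , _ , refl)) b d =
    solve 3 (λ a b d → a :* con o :* con o :+ a :* con o :* b :+ a :* con o :* d :+ a :* con i :* con o := con o) refl a b d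

  -- Testing on (0, 1, 0, 0) and (0, 0, 1, 0) leaves (c₀, 0, 0, c₃). For c₀ ≠ 0 this is the
  -- osculating plane at the t with t³ = - c₃/c₀, which exists because every element is a cube.
  axis⇒gamma : ∀ {c} → ¬ c ≡ zeroV → (∀ b d → OnPlane (onAxis b d) c) → GammaPlane c
  axis⇒gamma {c₀ ∷ c₁ ∷ c₂ ∷ c₃ ∷ []} c≢0 h = gamma c₁≡0 c₂≡0 (c₀ ≟ 0#)
    where
    c₁≡0 : c₁ ≡ 0#
    c₁≡0 = trans (solve 4 (λ a b c d → b := a :* con o :+ b :* con i :+ c :* con o :+ d :* con o) refl c₀ c₁ c₂ c₃) (h 1# 0#)
    c₂≡0 : c₂ ≡ 0#
    c₂≡0 = trans (solve 4 (λ a b c d → c := a :* con o :+ b :* con o :+ c :* con i :+ d :* con o) refl c₀ c₁ c₂ c₃) (h 0# 1#)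
    gamma : c₁ ≡ 0# → c₂ ≡ 0# → Dec (c₀ ≡ 0#) → GammaPlane (vec c₀ c₁ c₂ c₃)
    gamma refl refl (yes refl) = inj₂ (c₃ , (λ { refl → c≢0 refl }) , vec-cong (sym (zeroʳ c₃)) (sym (zeroʳ c₃)) (sym (zeroʳ c₃)) (sym (*-identityʳ c₃)))
    gamma refl refl (no c₀≢0) =
      let a , ca = inverse c₀ c₀≢0
          t , t³ = cube-root (- (a * c₃))
      in inj₁ (t , c₀ , c₀≢0 , vec-cong (sym (*-identityʳ c₀))
           (modulo (c₀ * t) 3≡0
               (solve 3 (λ c t th → con o := c :* :- (th :* t) :+ c :* t :* (th :+ :- con o)) refl c₀ t three))
           (modulo (- (c₀ * (t * t))) 3≡0
               (solve 3 (λ c t th → con o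
                   := c :* (th :* (t :* t)) :+ :- (c :* (t :* t)) :* (th :+ :- con o)) refl c₀ t three))
           (modulo₂ (- c₃) c₀ ca t³
               (solve 4 (λ c d t a → d
                   := c :* :- (t :* t :* t) :+ :- d :* (c :* a :+ :- con i) :+ c :* (t :* t :* t :+ :- :- (a :* d)))
                       refl c₀ c₃ t a)))

  gamma-∼ : ∀ {c c′} → c ∼ c′ → GammaPlane c′ → GammaPlane c
  gamma-∼ h (inj₁ (t , e)) = inj₁ (t , ∼-trans h e)
  gamma-∼ h (inj₂ e) = inj₂ (∼-trans h e)

  pull-· : ∀ M a c → pull M (a · c) ≡ a · pull M c
  pull-· M a c = dot-ext λ x → begin
    dot (pull M (a · c)) x   ≡⟨ dot-pull M (a · c) x ⟩
    dot (a · c) (apply M x)  ≡⟨ dot-comm (a · c) (apply M x) ⟩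
    dot (apply M x) (a · c)  ≡⟨ dot-· (apply M x) a c ⟩
    a * dot (apply M x) c    ≡⟨ cong (a *_) (trans (dot-comm (apply M x) c) (sym (dot-pull M c x))) ⟩
    a * dot (pull M c) x     ≡⟨ cong (a *_) (dot-comm (pull M c) x) ⟩
    a * dot x (pull M c)     ≡⟨ dot-· x a (pull M c) ⟨
    dot x (a · pull M c)     ≡⟨ dot-comm x (a · pull M c) ⟩
    dot (a · pull M c) x     ∎
    where open ≡-Reasoning

  pull-∼ : ∀ M {c c′} → c ∼ c′ → pull M c ∼ pull M c′
  pull-∼ M {c′ = c′} (a , a≢0 , refl) = a , a≢0 , pull-· M a c′

  pull-inverse : ∀ {M N} → (∀ x → apply M (apply N x) ≡ x) → ∀ c → pull N (pull M c) ≡ c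
  pull-inverse {M} {N} h c = dot-ext λ x →
    trans (dot-pull N (pull M c) x) (trans (dot-pull M c (apply N x)) (cong (dot c) (h x)))

  pull-nonzero : ∀ {M} → InG M → ∀ {c} → ¬ c ≡ zeroV → ¬ pull M c ≡ zeroV
  pull-nonzero {M} g {c} c≢0 e = c≢0 (dot-ext λ x → begin
    dot c x                                 ≡⟨ cong (dot c) (apply-inv {M} g x) ⟨
    dot c (apply M (apply (inv {M} g) x))   ≡⟨ dot-pull M c (apply (inv {M} g) x) ⟨
    dot (pull M c) (apply (inv {M} g) x)    ≡⟨ cong (λ r → dot r (apply (inv {M} g) x)) e ⟩
    dot zeroV (apply (inv {M} g) x)         ≡⟨ dot-zeroˡ (apply (inv {M} g) x) ⟩
    0#                                      ≡⟨ dot-zeroˡ x ⟨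
    dot zeroV x                             ∎)
    where open ≡-Reasoning

  -- Characterising Γ-planes by the axis avoids computing images of osculating planes: the group
  -- preserves the axis, hence the planes containing it.
  gamma-pull : ∀ {M} → InG M → ∀ {c} → ¬ c ≡ zeroV → GammaPlane c → GammaPlane (pull M c)
  gamma-pull {M} g {c} c≢0 γ = axis⇒gamma {pull M c} (pull-nonzero {M} g c≢0) λ b d →
    let b′ , d′ , e = axis-preserved {M} g b d in
    trans (dot-pull M c (onAxis b d)) (trans (cong (dot c) e) (gamma⇒axis {c} γ b′ d′))

  -- Counting parameters rather than normalised points avoids representatives; the counts agree
  -- because `P` is injective up to scalars.
  Parameters : V4 → ℕ → Set
  Parameters c n = Count (λ t → OnPlane (P t) c) n

  points⇒parameters : ∀ {c n} → CPointsOn c n → Parameters c n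
  points⇒parameters {c} = count-↔ (λ x t → x ∼ P t)
    (λ { x (_ , (t , x∼) , on) → t , OnPlane-∼ₚ {c} {P t} {x} (∼-sym x∼) on , x∼ })
    (λ { t on → let x , nx , x∼ = normalize (P-nonzero {t}) in x , (nx , (t , x∼) , OnPlane-∼ₚ {c} {x} {P t} x∼ on) , x∼ })
    (λ _ _ _ h h′ → P-injective (∼-trans (∼-sym h) h′))
    (λ (nx , _) (nx′ , _) _ h h′ → normalized-unique nx nx′ (∼-trans h (∼-sym h′)))

  parameters⇒points : ∀ {c n} → Parameters c n → CPointsOn c n
  parameters⇒points {c} = count-↔ (λ t x → x ∼ P t)
    (λ { t on → let x , nx , x∼ = normalize (P-nonzero {t}) in x , (nx , (t , x∼) , OnPlane-∼ₚ {c} {x} {P t} x∼ on) , x∼ })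
    (λ { x (_ , (t , x∼) , on) → t , OnPlane-∼ₚ {c} {P t} {x} (∼-sym x∼) on , x∼ })
    (λ _ (nx , _) (nx′ , _) h h′ → normalized-unique nx nx′ (∼-trans h (∼-sym h′)))
    (λ _ _ _ h h′ → P-injective (∼-trans (∼-sym h) h′))

  parameters-pull : ∀ {M} → InG M → ∀ {c n} → Parameters c n → Parameters (pull M c) n
  parameters-pull {M} g {c} = count-↔ (λ s t → apply M (P t) ∼ P s)
    (λ s on → let t , e = cubic-preimage {M} g s in
      t , trans (dot-pull M c (P t)) (OnPlane-∼ₚ {c} {apply M (P t)} {P s} e on) , e)
    (λ t on → let s , e = proj₂ g t in
      s , OnPlane-∼ₚ {c} {P s} {apply M (P t)} (∼-sym e) (trans (sym (dot-pull M c (P t))) on) , e)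
    (λ {_} {t} {t′} _ _ _ h h′ → P-injective (subst₂ _∼_ (inv-apply {M} g (P t)) (inv-apply {M} g (P t′))
      (∼-apply (inv {M} g) (∼-trans h (∼-sym h′)))))
    (λ _ _ _ h h′ → P-injective (∼-trans (∼-sym h) h′))

  parameters-∼ : ∀ {c c′ n} → c ∼ c′ → Parameters c′ n → Parameters c n
  parameters-∼ {c} {c′} h = count-cong (λ t → OnPlane-∼ {c} {c′} {P t} h) (λ t → OnPlane-∼ {c′} {c} {P t} (∼-sym h))

  hasType-pull : ∀ {M} → InG M → ∀ {c} → ¬ c ≡ zeroV → ∀ π → HasType π c → HasType π (pull M c)
  hasType-pull {M} g {c} c≢0 = λ
    { 2C → move ; 3C → move ; 0C → move
    -- Not being a Γ-plane is transported by contraposition: if the preimage were a Γ-plane, pulling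
    -- it back along the inverse matrix would make c one.
    ; 1̄C (¬γ , p) → (λ γ → ¬γ (subst GammaPlane (pull-inverse {M} {inv {M} g} (apply-inv {M} g) c)
                            (gamma-pull {inv {M} g} (inv-InG {M} g) {pull M c} (pull-nonzero {M} g c≢0) γ))) , move p }
    where
    move : ∀ {n} → CPointsOn c n → CPointsOn (pull M c) n
    move {n} p = parameters⇒points {pull M c} {n} (parameters-pull {M} g {c} (points⇒parameters {c} p))

  hasType-∼ : ∀ {c c′} → c ∼ c′ → ∀ π → HasType π c′ → HasType π c
  hasType-∼ {c} {c′} h = λ
    { 2C → move ; 3C → move ; 0C → move
    ; 1̄C (¬γ , p) → (λ γ → ¬γ (gamma-∼ {c′} {c} (∼-sym h) γ)) , move p }
    where
    move : ∀ {n} → CPointsOn c′ n → CPointsOn c n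
    move p = parameters⇒points {c} (parameters-∼ {c} {c′} h (points⇒parameters {c′} p))

  -- Images of lines and the planes through them

  apply-zeroV : ∀ M → apply M zeroV ≡ zeroV
  apply-zeroV (r₀ ∷ r₁ ∷ r₂ ∷ r₃ ∷ []) = vec-cong (z r₀) (z r₁) (z r₂) (z r₃)
    where
    z : ∀ r → dot r zeroV ≡ 0#
    z r = trans (dot-comm r zeroV) (dot-zeroˡ r)

  InSpan-apply : ∀ M {x u v} → InSpan x (u , v) → InSpan (apply M x) (apply M u , apply M v)
  InSpan-apply M (a , b , refl) = a , b , apply-lin M a b _ _

  independent-image : ∀ {M} → InG M → ∀ {u v} → Independent (u , v) → Independent (apply M u , apply M v)
  independent-image {M} g {u} {v} ind a b h = ind a b (begin
    lin a b u v                                     ≡⟨ inv-apply {M} g (lin a b u v) ⟨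
    apply (inv {M} g) (apply M (lin a b u v))       ≡⟨ cong (apply (inv {M} g)) (trans (apply-lin M a b u v) h) ⟩
    apply (inv {M} g) zeroV                         ≡⟨ apply-zeroV (inv {M} g) ⟩
    zeroV                                           ∎)
    where open ≡-Reasoning

  orbit-trans : ∀ {ℓ ℓ′ ℓ″} → Orbit ℓ ℓ′ → Orbit ℓ′ ℓ″ → Orbit ℓ ℓ″
  orbit-trans {u , v} {u′ , v′} {ℓ″} (M , g , Mu , Mv) (N , h , Nu , Nv) =
    mmul N M , mmul-InG {N} {M} h g , go u Mu , go v Mv
    where
    go : ∀ x → InSpan (apply M x) (u′ , v′) → InSpan (apply (mmul N M) x) ℓ″
    go x Mx = subst (λ z → InSpan z ℓ″) (sym (apply-mmul N M x)) (InSpan-trans (InSpan-apply N Mx) Nu Nv)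

  -- The images of u and v are independent and lie in ℓ′, so they span all of it; the inverse matrix
  -- therefore leads ℓ′ back into the first line.
  orbit-sym : ∀ {u v ℓ′} → Independent (u , v) → (o : Orbit (u , v) ℓ′) →
              InSpan (apply (inv {proj₁ o} (proj₁ (proj₂ o))) (proj₁ ℓ′)) (u , v) ×
              InSpan (apply (inv {proj₁ o} (proj₁ (proj₂ o))) (proj₂ ℓ′)) (u , v)
  orbit-sym {u} {v} {u′ , v′} ind (M , g , Mu , Mv) =
    let u∈ , v∈ = exchange (independent-image {M} g ind) Mu Mv in back u∈ , back v∈
    where
    back : ∀ {x} → InSpan x (apply M u , apply M v) → InSpan (apply (inv {M} g) x) (u , v)
    back {x} h = subst₂ (λ p q → InSpan (apply (inv {M} g) x) (p , q)) (inv-apply {M} g u) (inv-apply {M} g v) (InSpan-apply (inv {M} g) h)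

  pull-ContainsLine : ∀ M {c u v ℓ} → InSpan (apply M u) ℓ → InSpan (apply M v) ℓ → ContainsLine c ℓ →
      ContainsLine (pull M c) (u , v)
  pull-ContainsLine M {c} {u} {v} {ℓ} Mu Mv h =
    trans (dot-pull M c u) (OnPlane-span {c} {ℓ} h Mu) , trans (dot-pull M c v) (OnPlane-span {c} {ℓ} h Mv)

  PlaneThrough : PlaneType → V4 × V4 → V4 → Set
  PlaneThrough π ℓ c = Normalized c × HasType π c × ContainsLine c ℓ

  pull-planeThrough : ∀ {M} → InG M → ∀ π {u v ℓ} → InSpan (apply M u) ℓ → InSpan (apply M v) ℓ →
                      ∀ c → PlaneThrough π ℓ c → ∃[ c′ ] PlaneThrough π (u , v) c′ × c′ ∼ pull M c
  pull-planeThrough {M} g π {u} {v} {ℓ} Mu Mv c (nc , τ , h) =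
    c′ , (proj₁ (proj₂ n) ,
          hasType-∼ {c′} {pull M c} e π (hasType-pull {M} g {c} c≢0 π τ) ,
          ContainsLine-∼ {c′} {pull M c} {u , v} e (pull-ContainsLine M {c} {u} {v} {ℓ} Mu Mv h)) , e
    where
    c≢0 : ¬ c ≡ zeroV
    c≢0 = normalized-nonzero nc
    n : ∃[ y ] Normalized y × y ∼ pull M c
    n = normalize {pull M c} (pull-nonzero {M} g {c} c≢0)
    c′ : V4
    c′ = proj₁ n
    e : c′ ∼ pull M c
    e = proj₂ (proj₂ n)

  -- Since `pull` takes preimages, a plane through the original line becomes one through the image
  -- line by pulling it along the inverse `N`. Normalised representatives change, so the matching is
  -- only up to scalars.
  planes-through-image : ∀ {M N π u v u′ v′ n} → InG M → InG N →
    (∀ x → apply M (apply N x) ≡ x) → (∀ x → apply N (apply M x) ≡ x) →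
    InSpan (apply M u) (u′ , v′) → InSpan (apply M v) (u′ , v′) →
    InSpan (apply N u′) (u , v) → InSpan (apply N v′) (u , v) →
    Count (PlaneThrough π (u , v)) n → Count (PlaneThrough π (u′ , v′)) n
  planes-through-image {M} {N} {π} {u} {v} {u′} {v′} g h MN NM Mu Mv Nu′ Nv′ =
    count-↔ R fwd bwd fun inj
    where
    R : V4 → V4 → Set
    R c c′ = c′ ∼ pull N c
    fwd : ∀ c → PlaneThrough π (u , v) c → ∃[ c′ ] PlaneThrough π (u′ , v′) c′ × R c c′
    fwd = pull-planeThrough {N} h π Nu′ Nv′
    bwd : ∀ c′ → PlaneThrough π (u′ , v′) c′ → ∃[ c ] PlaneThrough π (u , v) c × R c c′
    bwd c′ p = let c , q , e = pull-planeThrough {M} g π Mu Mv c′ p in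
      c , q , ∼-sym (subst (pull N c ∼_) (pull-inverse {M} {N} MN c′) (pull-∼ N {c} {pull M c′} e))
    fun : ∀ {c c′ c″} → PlaneThrough π (u , v) c → PlaneThrough π (u′ , v′) c′ → PlaneThrough π (u′ , v′) c″ →
          R c c′ → R c c″ → c′ ≡ c″
    fun _ (n′ , _) (n″ , _) e e′ = normalized-unique n′ n″ (∼-trans e (∼-sym e′))
    inj : ∀ {c c′ c″} → PlaneThrough π (u , v) c → PlaneThrough π (u , v) c′ → PlaneThrough π (u′ , v′) c″ →
          R c c″ → R c′ c″ → c ≡ c′
    inj {c} {c′} (n , _) (n′ , _) _ e e′ = normalized-unique n n′
      (subst₂ _∼_ (pull-inverse {N} {M} NM c) (pull-inverse {N} {M} NM c′)
        (pull-∼ M {pull N c} {pull N c′} (∼-trans (∼-sym e) e′)))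

  planes-through-orbit : ∀ {π u v n} → Independent (u , v) → Count (PlaneThrough π (u , v)) n → PiIs π (Orbit (u , v)) n
  planes-through-orbit {π} {u} {v} ind count (u′ , v′) _ (M , g , Mu , Mv) =
    let Nu′ , Nv′ = orbit-sym {u} {v} {u′ , v′} ind (M , g , Mu , Mv) in
    planes-through-image {M} {inv {M} g} {π} {u} {v} {u′} {v′} g (inv-InG {M} g) (apply-inv {M} g) (inv-apply {M} g)
      Mu Mv Nu′ Nv′ count

  -- Plane types

  number : PlaneType → ℕ
  number 2C = 2
  number 3C = 3
  number 0C = 0
  number 1̄C = 1

  number-injective : ∀ π π′ → number π ≡ number π′ → π ≡ π′
  number-injective 2C 2C _ = refl
  number-injective 3C 3C _ = refl
  number-injective 0C 0C _ = refl
  number-injective 1̄C 1̄C _ = refl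

  type⇒points : ∀ {c} π → HasType π c → CPointsOn c (number π)
  type⇒points 2C p = p
  type⇒points 3C p = p
  type⇒points 0C p = p
  type⇒points 1̄C (_ , p) = p

  type-unique : ∀ {c} π π′ → HasType π c → HasType π′ c → π ≡ π′
  type-unique {c} π π′ h h′ = number-injective π π′ (count-unique (type⇒points {c} π h) (type⇒points {c} π′ h′))

  -- The affine points of the cubic on the plane (c₀ , 0 , c₂ , c₃) are the roots of this polynomial.
  cubic : F → F → F → F → F
  cubic c₀ c₂ c₃ t = c₀ * cube t + c₂ * t + c₃

  dot-P : ∀ c₀ c₂ c₃ t → dot (vec c₀ 0# c₂ c₃) (P (just t)) ≡ cubic c₀ c₂ c₃ t
  dot-P = solve 4 (λ c₀ c₂ c₃ t → c₀ :* (t :* t :* t) :+ con o :* (t :* t) :+ c₂ :* t :+ c₃ :* con i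
      := c₀ :* (t :* t :* t) :+ c₂ :* t :+ c₃) refl

  dot-∞ : ∀ c₀ c₂ c₃ → dot (vec c₀ 0# c₂ c₃) (P nothing) ≡ c₀
  dot-∞ = solve 3 (λ c₀ c₂ c₃ → c₀ :* con i :+ con o :* con o :+ c₂ :* con o :+ c₃ :* con o := c₀) refl

  roots⇒parameters : ∀ {c₀ c₂ c₃ n} → ¬ c₀ ≡ 0# → Count (λ t → cubic c₀ c₂ c₃ t ≡ 0#) n → Parameters (vec c₀ 0# c₂ c₃) n
  roots⇒parameters {c₀} {c₂} {c₃} c₀≢0 = count-↔ (λ t x → x ≡ just t)
    (λ t e → just t , trans (dot-P c₀ c₂ c₃ t) e , refl)
    (λ { (just t) e → t , trans (sym (dot-P c₀ c₂ c₃ t)) e , refl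
       ; nothing e → ⊥-elim (c₀≢0 (trans (sym (dot-∞ c₀ c₂ c₃)) e)) })
    (λ _ _ _ e e′ → trans e (sym e′)) (λ { _ _ _ refl refl → refl })

  roots-and-∞⇒parameters : ∀ {c₂ c₃ n} → Count (λ t → cubic 0# c₂ c₃ t ≡ 0#) n → Parameters (vec 0# 0# c₂ c₃) (suc n)
  roots-and-∞⇒parameters {c₂} {c₃} cnt =
    count-cong (λ { (just t) (inj₂ (t , e , refl)) → trans (dot-P 0# c₂ c₃ t) e ; nothing _ → dot-∞ 0# c₂ c₃ })
               (λ { (just t) e → inj₂ (t , trans (sym (dot-P 0# c₂ c₃ t)) e , refl) ; nothing _ → inj₁ refl })
      (count-⊎ (count-one nothing refl (λ _ h → h))
        (count-↔ {Q = λ x → ∃[ t ] cubic 0# c₂ c₃ t ≡ 0# × x ≡ just t} (λ t x → x ≡ just t)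
          (λ t e → just t , (t , e , refl) , refl) (λ { _ (t , e , h) → t , e , h })
          (λ _ _ _ e e′ → trans e (sym e′)) (λ { _ _ _ refl refl → refl }) cnt)
        (λ { _ refl (_ , _ , ()) }))

  HasRoot : F → F → F → Set
  HasRoot c₀ c₂ c₃ = ∃[ t ] cubic c₀ c₂ c₃ t ≡ 0#

  -- d is the difference of two roots.
  HasPeriod : F → F → Set
  HasPeriod c₀ c₂ = ∃[ d ] c₀ * (d * d) + c₂ ≡ 0#

  HasRoot? : ∀ c₀ c₂ c₃ → Dec (HasRoot c₀ c₂ c₃)
  HasRoot? c₀ c₂ c₃ = dec∃ (λ t → cubic c₀ c₂ c₃ t ≟ 0#)

  HasPeriod? : ∀ c₀ c₂ → Dec (HasPeriod c₀ c₂)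
  HasPeriod? c₀ c₂ = dec∃ (λ d → (c₀ * (d * d) + c₂) ≟ 0#)

  -- To be read with c₂ ≠ 0. For c₀ = 0 the polynomial is linear and the second point is P(∞). The
  -- last case names no root, because without a period there is exactly one.
  Shape : PlaneType → F → F → F → Set
  Shape 2C c₀ c₂ c₃ = c₀ ≡ 0#
  Shape 3C c₀ c₂ c₃ = HasPeriod c₀ c₂ × HasRoot c₀ c₂ c₃
  Shape 0C c₀ c₂ c₃ = HasPeriod c₀ c₂ × ¬ HasRoot c₀ c₂ c₃
  Shape 1̄C c₀ c₂ c₃ = (¬ c₀ ≡ 0#) × ¬ HasPeriod c₀ c₂

  some-shape : ∀ c₀ c₂ c₃ → ∃[ π ] Shape π c₀ c₂ c₃
  some-shape c₀ c₂ c₃ with c₀ ≟ 0# | HasPeriod? c₀ c₂ | HasRoot? c₀ c₂ c₃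
  ... | yes e | _ | _ = 2C , e
  ... | no c₀≢0 | yes d | yes t = 3C , d , t
  ... | no c₀≢0 | yes d | no ¬t = 0C , d , ¬t
  ... | no c₀≢0 | no ¬d | _ = 1̄C , c₀≢0 , ¬d

  -- Cubing is additive, so with d = t - r the two values differ by c₀ d³ + c₂ d = d (c₀ d² + c₂).
  root-difference : ∀ {c₀ c₂ c₃ t r} → cubic c₀ c₂ c₃ t ≡ cubic c₀ c₂ c₃ r →
                    t ≡ r ⊎ c₀ * ((t + - r) * (t + - r)) + c₂ ≡ 0#
  root-difference {c₀} {c₂} {c₃} {t} {r} e = Sum.map₁ difference-zero (*-zero-split (modulo 1# e
    (solve 5 (λ c₀ c₂ c₃ t r → (t :+ :- r) :* (c₀ :* ((t :+ :- r) :* (t :+ :- r)) :+ c₂)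
       := con o :+ con i :* (c₀ :* (t :* t :* t) :+ c₂ :* t :+ c₃ :+ :- (c₀ :* (r :* r :* r) :+ c₂ :* r :+ c₃)))
           refl c₀ c₂ c₃ t r)))

  root+period : ∀ {c₀ c₂ c₃ r d} → c₀ * (d * d) + c₂ ≡ 0# → cubic c₀ c₂ c₃ r ≡ 0# → cubic c₀ c₂ c₃ (r + d) ≡ 0#
  root+period {c₀} {c₂} {c₃} {r} {d} hd hr = modulo₂ 1# d hr hd (solve 5 (λ c₀ c₂ c₃ r d →
    c₀ :* ((r :+ d) :* (r :+ d) :* (r :+ d)) :+ c₂ :* (r :+ d) :+ c₃
    := con o :+ con i :* (c₀ :* (r :* r :* r) :+ c₂ :* r :+ c₃ :+ :- con o) :+ d :* (c₀ :* (d :* d) :+ c₂ :+ :- con o))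
        refl c₀ c₂ c₃ r d)

  period⇒≢0 : ∀ {c₀ c₂} → ¬ c₂ ≡ 0# → HasPeriod c₀ c₂ → ¬ c₀ ≡ 0#
  period⇒≢0 {_} {c₂} c₂≢0 (d , hd) refl = c₂≢0 (trans (solve 2 (λ c₂ d → c₂ := con o :* (d :* d) :+ c₂) refl c₂ d) hd)

  period-unique : ∀ {c₀ c₂ d e} → ¬ c₀ ≡ 0# → c₀ * (d * d) + c₂ ≡ 0# → c₀ * (e * e) + c₂ ≡ 0# → e ≡ d ⊎ e ≡ - d
  period-unique {c₀} {c₂} {d} {e} c₀≢0 hd he = negsq-fibre {d} {e} (difference-zero (*-cancel-0 c₀≢0 (modulo₂ 1# (- 1#) hd he
    (solve 4 (λ c₀ c₂ d e → c₀ :* (:- (e :* e) :+ :- :- (d :* d)) := con o :+ con i :* (c₀ :* (d :* d) :+ c₂ :+ :- con o)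
       :+ :- con i :* (c₀ :* (e :* e) :+ c₂ :+ :- con o)) refl c₀ c₂ d e))))

  -- The roots are r, r + d and r - d: the only periods are d and - d, and d ≠ 0 because c₂ ≠ 0.
  three-roots : ∀ {c₀ c₂ c₃} → ¬ c₂ ≡ 0# → HasPeriod c₀ c₂ → HasRoot c₀ c₂ c₃ → Count (λ t → cubic c₀ c₂ c₃ t ≡ 0#) 3
  three-roots {c₀} {c₂} {c₃} c₂≢0 (d , hd) (r , hr) =
    count-cong
      (λ { _ (inj₁ refl) → hr
         ; _ (inj₂ (inj₁ refl)) → root+period {c₀} {c₂} {c₃} hd hr
         ; _ (inj₂ (inj₂ refl)) → root+period {c₀} {c₂} {c₃} h-d hr })
      (λ t ht → [ inj₁ , (λ e → inj₂ (Sum.map (shift t) (shift t) (period-unique c₀≢0 hd e))) ]′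
                  (root-difference {c₀} {c₂} {c₃} (trans ht (sym hr))))
      (count-⊎ (only r) (count-⊎ (only (r + d)) (only (r + - d)) r+d≢r-d) r≢r±d)
    where
    only : ∀ a → Count (_≡ a) 1
    only a = count-one a refl (λ _ h → h)
    c₀≢0 : ¬ c₀ ≡ 0#
    c₀≢0 = period⇒≢0 c₂≢0 (d , hd)
    h-d : c₀ * (- d * - d) + c₂ ≡ 0#
    h-d = trans (solve 3 (λ c₀ c₂ d → c₀ :* (:- d :* :- d) :+ c₂ := c₀ :* (d :* d) :+ c₂) refl c₀ c₂ d) hd
    d≢0 : ¬ d ≡ 0#
    d≢0 refl = c₂≢0 (trans (solve 2 (λ c₀ c₂ → c₂ := c₀ :* (con o :* con o) :+ c₂) refl c₀ c₂) hd)
    shift : ∀ t {x} → t + - r ≡ x → t ≡ r + x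
    shift t refl = solve 2 (λ t r → t := r :+ (t :+ :- r)) refl t r
    r+d≢r-d : ∀ x → x ≡ r + d → ¬ x ≡ r + - d
    r+d≢r-d _ refl h = d≢0 (modulo (- 1#) h
        (solve 2 (λ r d → d := con o :+ :- con i :* (r :+ d :+ :- (r :+ :- d))) refl r d))
    r≢r±d : ∀ x → x ≡ r → ¬ (x ≡ r + d ⊎ x ≡ r + - d)
    r≢r±d _ refl (inj₁ h) = d≢0 (modulo (- 1#) h (solve 2 (λ r d → d := con o :+ :- con i :* (r :+ :- (r :+ d))) refl r d))
    r≢r±d _ refl (inj₂ h) = d≢0 (modulo 1# h (solve 2 (λ r d → d := con o :+ con i :* (r :+ :- (r :+ :- d))) refl r d))

  -- Without a period the polynomial is injective on a finite field, hence bijective.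
  one-root : ∀ {c₀ c₂ c₃} → ¬ HasPeriod c₀ c₂ → Count (λ t → cubic c₀ c₂ c₃ t ≡ 0#) 1
  one-root {c₀} {c₂} {c₃} aperiodic = unique (injective⇒surjective (cubic c₀ c₂ c₃) (λ {t} {r} → injective t r) 0#)
    where
    injective : ∀ t r → cubic c₀ c₂ c₃ t ≡ cubic c₀ c₂ c₃ r → t ≡ r
    injective t r e = [ (λ h → h) , (λ h → ⊥-elim (aperiodic (t + - r , h))) ]′ (root-difference {c₀} {c₂} {c₃} {t} {r} e)
    unique : HasRoot c₀ c₂ c₃ → Count (λ t → cubic c₀ c₂ c₃ t ≡ 0#) 1
    unique (r , hr) = count-one r hr (λ t ht → injective t r (trans ht (sym hr)))

  linear-aperiodic : ∀ {c₂} → ¬ c₂ ≡ 0# → ¬ HasPeriod 0# c₂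
  linear-aperiodic c₂≢0 d = period⇒≢0 c₂≢0 d refl

  shape⇒type : ∀ {c₀ c₂ c₃} → ¬ c₂ ≡ 0# → ∀ π → Shape π c₀ c₂ c₃ → HasType π (vec c₀ 0# c₂ c₃)
  shape⇒type {_} {c₂} {c₃} c₂≢0 2C refl = parameters⇒points {vec 0# 0# c₂ c₃}
    (roots-and-∞⇒parameters {c₂} {c₃} (one-root (linear-aperiodic c₂≢0)))
  shape⇒type {c₀} {c₂} {c₃} c₂≢0 3C (d , r) = parameters⇒points {vec c₀ 0# c₂ c₃}
    (roots⇒parameters {c₀} {c₂} {c₃} (period⇒≢0 c₂≢0 d) (three-roots c₂≢0 d r))
  shape⇒type {c₀} {c₂} {c₃} c₂≢0 0C (d , ¬r) = parameters⇒points {vec c₀ 0# c₂ c₃}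
    (roots⇒parameters {c₀} {c₂} {c₃} (period⇒≢0 c₂≢0 d) (count-none (λ t e → ¬r (t , e))))
  shape⇒type {c₀} {c₂} {c₃} c₂≢0 1̄C (c₀≢0 , ¬d) =
    (λ γ → c₂≢0 (trans (sym (trans (dot-axis c₀ 0# c₂ c₃ 0# 1#) (solve 1 (λ c → con o :* con o :+ c :* con i := c) refl c₂)))
                  (gamma⇒axis {vec c₀ 0# c₂ c₃} γ 0# 1#))) ,
    parameters⇒points {vec c₀ 0# c₂ c₃} (roots⇒parameters {c₀} {c₂} {c₃} c₀≢0 (one-root ¬d))

  -- Some shape always holds and implies its type. The four types have different numbers of points,
  -- so that shape belongs to the given type.
  type⇒shape : ∀ {c₀ c₂ c₃} → ¬ c₂ ≡ 0# → ∀ π → HasType π (vec c₀ 0# c₂ c₃) → Shape π c₀ c₂ c₃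
  type⇒shape {c₀} {c₂} {c₃} c₂≢0 π τ =
    let π′ , σ = some-shape c₀ c₂ c₃ in
    subst (λ π → Shape π c₀ c₂ c₃) (type-unique {vec c₀ 0# c₂ c₃} π′ π (shape⇒type c₂≢0 π′ σ) τ) σ

  -- The polynomial is c₀ t³ + c₃. For c₀ ≠ 0 bijectivity of cubing gives one root; for c₀ = 0 there
  -- is no affine root and the point is P(∞).
  gamma-one-point : ∀ {c₀ c₃} → ¬ vec c₀ 0# 0# c₃ ≡ zeroV → Parameters (vec c₀ 0# 0# c₃) 1
  gamma-one-point {c₀} {c₃} c≢0 with c₀ ≟ 0#
  ... | yes refl = roots-and-∞⇒parameters {0#} {c₃} (count-none λ t e → c≢0 (vec-cong refl refl refl
    (trans (solve 2 (λ c t → c := con o :* (t :* t :* t) :+ con o :* t :+ c) refl c₃ t) e)))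
  ... | no c₀≢0 = roots⇒parameters {c₀} {0#} {c₃} c₀≢0 (unique (inverse c₀ c₀≢0))
    where
    root : ∀ a r → c₀ * a ≡ 1# → cube r ≡ - (a * c₃) → cubic c₀ 0# c₃ r ≡ 0#
    root a r ca hr = modulo₂ c₀ (- c₃) hr ca (solve 4 (λ c₀ c₃ a r → c₀ :* (r :* r :* r) :+ con o :* r :+ c₃
      := con o :+ c₀ :* (r :* r :* r :+ :- :- (a :* c₃)) :+ :- c₃ :* (c₀ :* a :+ :- con i)) refl c₀ c₃ a r)
    same : ∀ t r → cubic c₀ 0# c₃ t ≡ 0# → cubic c₀ 0# c₃ r ≡ 0# → c₀ * (cube t + - cube r) ≡ 0#
    same t r ht hr = modulo₂ 1# (- 1#) ht hr (solve 4 (λ c₀ c₃ t r → c₀ :* (t :* t :* t :+ :- (r :* r :* r))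
      := con o :+ con i :* (c₀ :* (t :* t :* t) :+ con o :* t :+ c₃ :+ :- con o) :+ :- con i :* (c₀ :* (r :* r :* r) :+ con o :* r :+ c₃ :+ :- con o))
          refl c₀ c₃ t r)
    only : ∀ r → cubic c₀ 0# c₃ r ≡ 0# → Count (λ t → cubic c₀ 0# c₃ t ≡ 0#) 1
    only r hr = count-one r hr (λ t ht → cube-injective {t} {r} (difference-zero (*-cancel-0 c₀≢0 (same t r ht hr))))
    unique : ∃[ a ] c₀ * a ≡ 1# → Count (λ t → cubic c₀ 0# c₃ t ≡ 0#) 1
    unique (a , ca) = let r , hr = cube-root (- (a * c₃)) in only r (root a r ca hr)

  -- Planes containing the axis are Γ-planes, with one point, so they have none of the four types.
  type⇒c₂≢0 : ∀ {c₀ c₂ c₃} → ¬ vec c₀ 0# c₂ c₃ ≡ zeroV → ∀ π → HasType π (vec c₀ 0# c₂ c₃) → ¬ c₂ ≡ 0#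
  type⇒c₂≢0 {c₀} {_} {c₃} c≢0 π τ refl = not-one π τ
    (number-injective π 1̄C (count-unique (points⇒parameters {vec c₀ 0# 0# c₃} (type⇒points {vec c₀ 0# 0# c₃} π τ)) (gamma-one-point {c₀} {c₃} c≢0)))
    where
    not-one : ∀ π → HasType π (vec c₀ 0# 0# c₃) → ¬ π ≡ 1̄C
    not-one .1̄C (¬γ , _) refl = ¬γ (axis⇒gamma {vec c₀ 0# 0# c₃} c≢0 λ b d →
      trans (dot-axis c₀ 0# 0# c₃ b d) (solve 2 (λ b d → con o :* b :+ con o :* d := con o) refl b d))

  e₁-plane : ∀ {c} → ¬ c ≡ zeroV → ∀ π → HasType π c → OnPlane e₁ c →
             ∃[ c₀ ] ∃[ c₂ ] ∃[ c₃ ] (¬ c₂ ≡ 0#) × c ≡ vec c₀ 0# c₂ c₃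
  e₁-plane {c₀ ∷ c₁ ∷ c₂ ∷ c₃ ∷ []} c≢0 π τ on = go c₁≡0 c≢0 τ
    where
    c₁≡0 : c₁ ≡ 0#
    c₁≡0 = trans (solve 4 (λ a b c d → b := a :* con o :+ b :* con i :+ c :* con o :+ d :* con o) refl c₀ c₁ c₂ c₃) on
    go : c₁ ≡ 0# → ¬ vec c₀ c₁ c₂ c₃ ≡ zeroV → HasType π (vec c₀ c₁ c₂ c₃) → _
    go refl c≢0 τ = c₀ , c₂ , c₃ , type⇒c₂≢0 {c₀} {c₂} {c₃} c≢0 π τ , refl

  scaled-e₁-plane : ∀ {c} → ¬ c ≡ zeroV → ∀ π → HasType π c → OnPlane e₁ c → ∃[ y₀ ] ∃[ y₃ ] c ∼ vec y₀ 0# 1# y₃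
  scaled-e₁-plane {c} c≢0 π τ on = go (e₁-plane {c} c≢0 π τ on)
    where
    go : (∃[ c₀ ] ∃[ c₂ ] ∃[ c₃ ] (¬ c₂ ≡ 0#) × c ≡ vec c₀ 0# c₂ c₃) → _
    go (c₀ , c₂ , c₃ , c₂≢0 , refl) with inverse c₂ c₂≢0
    ... | a , ca = c₀ * a , c₃ * a , c₂ , c₂≢0 ,
      vec-cong (scale c₀) (sym (zeroʳ c₂)) (sym (*-identityʳ c₂)) (scale c₃)
      where
      scale : ∀ x → x ≡ c₂ * (x * a)
      scale x = modulo (- x) ca (solve 3 (λ x c a → x := c :* (x :* a) :+ :- x :* (c :* a :+ :- con i)) refl x c₂ a)

  -- Parametrising the planes through a line

  module _ (y₀ y₃ : F → F) (v : V4)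
    (contains : ∀ x → OnPlane v (vec (y₀ x) 0# 1# (y₃ x)))
    (injective : ∀ x x′ → y₀ x ≡ y₀ x′ → y₃ x ≡ y₃ x′ → x ≡ x′)
    (surjective : ∀ c₀ c₃ → OnPlane v (vec c₀ 0# 1# c₃) → ∃[ x ] c₀ ≡ y₀ x × c₃ ≡ y₃ x)
    where
    private
      p : F → V4
      p x = vec (y₀ x) 0# 1# (y₃ x)

      p-nonzero : ∀ x → ¬ p x ≡ zeroV
      p-nonzero x e = 1≢0 (proj₁ (proj₂ (proj₂ (vec-injective e))))

      p-injective : ∀ {x x′} → p x ∼ p x′ → x ≡ x′
      p-injective {x} {x′} (a , _ , e) =
        let e₀ , _ , e₂ , e₃ = vec-injective e
            a≡1 = trans (sym (*-identityʳ a)) (sym e₂)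
        in injective x x′ (trans e₀ (trans (cong (_* y₀ x′) a≡1) (*-identityˡ _)))
                          (trans e₃ (trans (cong (_* y₃ x′) a≡1) (*-identityˡ _)))

      p-contains : ∀ x → ContainsLine (p x) (e₁ , v)
      p-contains x = solve 2 (λ a b → a :* con o :+ con o :* con i :+ con i :* con o :+ b :* con o
          := con o) refl (y₀ x) (y₃ x) , contains x

    -- Since c₂ ≠ 0, each of these planes has one multiple with third coordinate 1, whereas its
    -- normalised vector has leading coordinate 1; hence the matching up to scalars.
    count-planes : ∀ π {n} → Count (λ x → Shape π (y₀ x) 1# (y₃ x)) n → Count (PlaneThrough π (e₁ , v)) n
    count-planes π = count-↔ (λ x c → c ∼ p x)
      (λ x σ → let c , nc , e = normalize {p x} (p-nonzero x) in
        c , (nc , hasType-∼ {c} {p x} e π (shape⇒type 1≢0 π σ) , ContainsLine-∼ {c} {p x} {e₁ , v} e (p-contains x)) , e)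
      backward
      (λ _ (n , _) (n′ , _) e e′ → normalized-unique n n′ (∼-trans e (∼-sym e′)))
      (λ _ _ _ e e′ → p-injective (∼-trans (∼-sym e) e′))
      where
      backward : ∀ c → PlaneThrough π (e₁ , v) c → ∃[ x ] Shape π (y₀ x) 1# (y₃ x) × c ∼ p x
      backward c (nc , τ , h₁ , hv) =
        let c₀ , c₃ , e = scaled-e₁-plane {c} (normalized-nonzero nc) π τ h₁
            x , e₀ , e₃ = surjective c₀ c₃ (OnPlane-∼ {vec c₀ 0# 1# c₃} {c} {v} (∼-sym e) hv)
            e′ = subst₂ (λ a b → c ∼ vec a 0# 1# b) e₀ e₃ e
        in x , type⇒shape 1≢0 π (hasType-∼ {p x} {c} (∼-sym e′) π τ) , e′

  -- Incidence with (1, 0, b, 0) fixes c₀ = - b and leaves c₃ free. The value b = 1 belongs to `ℓ₂`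
  -- and b = ρ to `ℓ₃ ρ`.
  count-planes-b : ∀ b π {n} → Count (λ x → Shape π (- b) 1# x) n → Count (PlaneThrough π (e₁ , vec 1# 0# b 0#)) n
  count-planes-b b = count-planes (λ _ → - b) (λ x → x) (vec 1# 0# b 0#)
    (solve 2 (λ b x → :- b :* con i :+ con o :* con o :+ con i :* b :+ x :* con o := con o) refl b)
    (λ _ _ _ e → e)
    (λ c₀ c₃ h → c₃ , modulo 1# h
        (solve 3 (λ b c₀ c₃ → c₀
            := :- b :+ con i :* (c₀ :* con i :+ con o :* con o :+ con i :* b :+ c₃ :* con o :+ :- con o))
                refl b c₀ c₃) , refl)

  -- Incidence with (0, 0, 1, 1) fixes c₃ = - 1 and leaves c₀ free, so the existence of a period now
  -- varies from plane to plane.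
  count-planes-1 : ∀ π {n} → Count (λ x → Shape π x 1# (- 1#)) n → Count (PlaneThrough π ℓ₁) n
  count-planes-1 = count-planes (λ x → x) (λ _ → - 1#) (vec 0# 0# 1# 1#)
    (solve 1 (λ x → x :* con o :+ con o :* con o :+ con i :* con i :+ :- con i :* con i := con o) refl)
    (λ _ _ e _ → e)
    (λ c₀ c₃ h → c₀ , refl , modulo 1# h
        (solve 2 (λ c₀ c₃ → c₃
            := :- con i :+ con i :* (c₀ :* con o :+ con o :* con o :+ con i :* con i :+ c₃ :* con i :+ :- con o))
                refl c₀ c₃))

  independent-b : ∀ b → Independent (e₁ , vec 1# 0# b 0#)
  independent-b b x y h =
    let h₀ , h₁ , _ = vec-injective h in
    trans (solve 2 (λ x y → x := x :* con i :+ y :* con o) refl x y) h₁ ,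
    trans (solve 2 (λ x y → y := x :* con o :+ y :* con i) refl x y) h₀

  independent-1 : Independent ℓ₁
  independent-1 x y h =
    let _ , h₁ , _ , h₃ = vec-injective h in
    trans (solve 2 (λ x y → x := x :* con i :+ y :* con o) refl x y) h₁ ,
    trans (solve 2 (λ x y → y := x :* con o :+ y :* con i) refl x y) h₃


  -- The numbers of planes through a line of each orbit

  square-period : HasPeriod (- 1#) 1#
  square-period = 1# , solve 0 (:- con i :* (con i :* con i) :+ con i := con o) refl

  -- For c₀ = - 1 and c₂ = 1 the root equation reads x = z³ - z.
  wp-root : ∀ {x} → InImage x → HasRoot (- 1#) 1# x
  wp-root (z , refl) = z , solve 1 (λ z → :- con i :* (z :* z :* z) :+ con i :* z :+ (z :* z :* z :+ :- z) := con o) refl z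

  root-wp : ∀ {x} → HasRoot (- 1#) 1# x → InImage x
  root-wp {x} (z , h) = z , modulo (- 1#) h (solve 2 (λ x z → z :* z :* z :+ :- z
    := x :+ :- con i :* (:- con i :* (z :* z :* z) :+ con i :* z :+ x :+ :- con o)) refl x z)

  m₃ : ℕ
  m₃ = proj₁ image

  InImages : Count InImage m₃
  InImages = proj₁ (proj₂ image)

  size≡m₃*3 : size ≡ m₃ ℕ.* 3
  size≡m₃*3 = proj₂ (proj₂ image)

  NotInImages : Count (λ x → ¬ InImage x) (size ∸ m₃)
  NotInImages = count-cong (λ _ → proj₂) (λ _ h → tt , h)
    (count-complement finite (count-cong (λ _ h → tt , h) (λ _ → proj₂) InImages) InImage?)

  size/3 : size ℕ./ 3 ≡ m₃
  size/3 = trans (cong (ℕ._/ 3) size≡m₃*3) (m*n/n≡m m₃ 3)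

  size∸m₃ : size ∸ m₃ ≡ m₃ ℕ.* 2
  size∸m₃ = trans (cong (_∸ m₃) (trans size≡m₃*3 (ℕ.*-suc m₃ 2))) (ℕ.m+n∸m≡n m₃ (m₃ ℕ.* 2))

  2*size/3 : 2 ℕ.* size ℕ./ 3 ≡ size ∸ m₃
  2*size/3 = begin
    2 ℕ.* size ℕ./ 3          ≡⟨ cong (λ n → 2 ℕ.* n ℕ./ 3) size≡m₃*3 ⟩
    2 ℕ.* (m₃ ℕ.* 3) ℕ./ 3    ≡⟨ cong (ℕ._/ 3) (ℕ.*-assoc 2 m₃ 3) ⟨
    2 ℕ.* m₃ ℕ.* 3 ℕ./ 3      ≡⟨ m*n/n≡m (2 ℕ.* m₃) 3 ⟩
    2 ℕ.* m₃                  ≡⟨ ℕ.*-comm 2 m₃ ⟩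
    m₃ ℕ.* 2                  ≡⟨ size∸m₃ ⟨
    size ∸ m₃                 ∎
    where open ≡-Reasoning

  Π-b : ∀ b π {n} → Count (λ x → Shape π (- b) 1# x) n → PiIs π (Orbit (e₁ , vec 1# 0# b 0#)) n
  Π-b b π cnt = planes-through-orbit {π} {e₁} {vec 1# 0# b 0#} (independent-b b) (count-planes-b b π cnt)

  Π-1 : ∀ π {n} → Count (λ x → Shape π x 1# (- 1#)) n → PiIs π (Orbit ℓ₁) n
  Π-1 π cnt = planes-through-orbit {π} {e₁} {vec 0# 0# 1# 1#} independent-1 (count-planes-1 π cnt)

  Π-3C-2 : PiIs 3C (Orbit ℓ₂) (size ℕ./ 3)
  Π-3C-2 = Π-b 1# 3C (subst (Count _) (sym size/3) (count-cong (λ _ h → square-period , wp-root h) (λ _ h → root-wp (proj₂ h)) InImages))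

  Π-0C-2 : PiIs 0C (Orbit ℓ₂) (2 ℕ.* size ℕ./ 3)
  Π-0C-2 = Π-b 1# 0C (subst (Count _) (sym 2*size/3) (count-cong (λ _ h → square-period , (λ r → h (root-wp r))) (λ _ h z → proj₂ h (wp-root z)) NotInImages))

  Π-2C-2 : PiIs 2C (Orbit ℓ₂) 0
  Π-2C-2 = Π-b 1# 2C (count-none λ _ → -1≢0)

  Π-1̄C-2 : PiIs 1̄C (Orbit ℓ₂) 0
  Π-1̄C-2 = Π-b 1# 1̄C (count-none λ _ h → proj₂ h square-period)

  module _ {ρ : F} (nonsquare : NonSquare ρ) where
    ρ≢0 : ¬ ρ ≡ 0#
    ρ≢0 h = nonsquare 0# (trans (zeroˡ 0#) (sym h))

    -ρ≢0 : ¬ - ρ ≡ 0#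
    -ρ≢0 h = ρ≢0 (modulo (- 1#) h (solve 1 (λ r → r := con o :+ :- con i :* (:- r :+ :- con o)) refl ρ))

    -- A period d would mean ρ d² = 1, making ρ the square of 1/d.
    ρ-aperiodic : ¬ HasPeriod (- ρ) 1#
    ρ-aperiodic (d , h) = go (inverse d d≢0)
      where
      d≢0 : ¬ d ≡ 0#
      d≢0 refl = 1≢0 (trans (solve 1 (λ r → con i := :- r :* (con o :* con o) :+ con i) refl ρ) h)
      go : ¬ (∃[ t ] d * t ≡ 1#)
      go (t , dt) = nonsquare t (modulo₂ (t * t) (ρ * (d * t + 1#)) h dt
        (solve 3 (λ r d t → t :* t
            := r :+ t :* t :* (:- r :* (d :* d) :+ con i :+ :- con o) :+ r :* (d :* t :+ con i) :* (d :* t :+ :- con i))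
                refl ρ d t))

    Π-1̄C-3 : PiIs 1̄C (Orbit (ℓ₃ ρ)) size
    Π-1̄C-3 = Π-b ρ 1̄C (count-cong (λ _ _ → -ρ≢0 , ρ-aperiodic) (λ _ _ → tt) finite)

    Π-2C-3 : PiIs 2C (Orbit (ℓ₃ ρ)) 0
    Π-2C-3 = Π-b ρ 2C (count-none λ _ → -ρ≢0)

    Π-3C-3 : PiIs 3C (Orbit (ℓ₃ ρ)) 0
    Π-3C-3 = Π-b ρ 3C (count-none λ _ h → ρ-aperiodic (proj₁ h))

    Π-0C-3 : PiIs 0C (Orbit (ℓ₃ ρ)) 0
    Π-0C-3 = Π-b ρ 0C (count-none λ _ h → ρ-aperiodic (proj₁ h))

  Π-2C-1 : PiIs 2C (Orbit ℓ₁) 1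
  Π-2C-1 = Π-1 2C (count-one 0# refl (λ _ h → h))

  -- For c₂ = 1 having a period is the same as `NegSquare`, so the planes correspond to the c₀ ≠ 0
  -- outside that class.
  Π-1̄C-1 : PiIs 1̄C (Orbit ℓ₁) ((size ∸ 1) ℕ./ 2)
  Π-1̄C-1 = Π-1 1̄C (subst (Count _) (sym (trans (cong (ℕ._/ 2) (proj₂ (proj₂ halves))) (m*n/n≡m half 2))) NonNegSquares)

  wp-odd : ∀ z → wp (- z) ≡ - wp z
  wp-odd = solve 1 (λ z → :- z :* :- z :* :- z :+ :- :- z := :- (z :* z :* z :+ :- z)) refl

  InImage-neg : ∀ {y} → InImage y → InImage (- y)
  InImage-neg (z , e) = - z , trans (wp-odd z) (cong -_ e)

  InImage-neg⁻ : ∀ {y} → InImage (- y) → InImage y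
  InImage-neg⁻ {y} h = subst InImage (solve 1 (λ y → :- :- y := y) refl y) (InImage-neg h)

  -- Substituting t = - z / e turns - e² t³ + t - 1 into (z³ - z - e) / e.
  InImage⇒root : ∀ {e} → ¬ e ≡ 0# → InImage e → HasRoot (negsq e) 1# (- 1#)
  InImage⇒root {e} e≢0 (z , h) = go (inverse e e≢0)
    where
    go : ∃[ a ] e * a ≡ 1# → HasRoot (negsq e) 1# (- 1#)
    go (a , ea) = - (z * a) , modulo₂ a (1# + z * z * z * a * (e * a + 1#)) h ea
      (solve 3 (λ e z a → :- (e :* e) :* (:- (z :* a) :* :- (z :* a) :* :- (z :* a)) :+ con i :* :- (z :* a) :+ :- con i
        := con o :+ a :* (z :* z :* z :+ :- z :+ :- e) :+ (con i :+ z :* z :* z :* a :* (e :* a :+ con i)) :* (e :* a :+ :- con i))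
            refl e z a)

  root⇒InImage : ∀ {e} → HasRoot (negsq e) 1# (- 1#) → InImage e
  root⇒InImage {e} (t , h) = - (t * e) , modulo e h
    (solve 2 (λ e t → :- (t :* e) :* :- (t :* e) :* :- (t :* e) :+ :- :- (t :* e)
       := e :+ e :* (:- (e :* e) :* (t :* t :* t) :+ con i :* t :+ :- con i :+ :- con o)) refl e t)

  neg-nonzero : ∀ {e} → ¬ e ≡ 0# → ¬ - e ≡ 0#
  neg-nonzero {e} e≢0 h = e≢0 (modulo (- 1#) h (solve 1 (λ e → e := con o :+ :- con i :* (:- e :+ :- con o)) refl e))

  0-InImage : InImage 0#
  0-InImage = 0# , solve 0 (con o :* con o :* con o :+ :- con o := con o) refl

  -- With c₀ = - e², a root exists exactly when e is in the image of `wp`. The elements e and - e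
  -- give the same plane and 0 is excluded, whence (m₃ - 1)/2 planes.
  three-root-planes : ∃[ m ] Count (λ x → Shape 3C x 1# (- 1#)) m × m₃ ∸ 1 ≡ m ℕ.* 2
  three-root-planes = count-halve {E = λ e → InImage e × ¬ e ≡ 0#}
    (λ x → HasPeriod? x 1# ×-dec HasRoot? x 1# (- 1#))
    (λ _ → proj₂) (λ _ (y , e≢0) → InImage-neg y , neg-nonzero e≢0)
    (λ _ (y , e≢0) → negsq-NegSquare e≢0 , InImage⇒root e≢0 y)
    (λ { x (σ , r) → let e , e≢0 , h = NegSquare⇒negsq σ in
         e , (root⇒InImage (subst (λ x → HasRoot x 1# (- 1#)) (sym h) r) , e≢0) , h })
    (count-complement InImages (count-one 0# (0-InImage , refl) (λ _ → proj₂)) (_≟ 0#))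

  -- The same substitution with e outside the image. Since 0 lies in the image, nothing is removed:
  -- 2 m₃ elements give m₃ planes.
  rootless-planes : ∃[ m ] Count (λ x → Shape 0C x 1# (- 1#)) m × size ∸ m₃ ≡ m ℕ.* 2
  rootless-planes = count-halve {E = λ e → ¬ InImage e}
    (λ x → HasPeriod? x 1# ×-dec ¬? (HasRoot? x 1# (- 1#)))
    (λ { _ y refl → y 0-InImage }) (λ _ y h → y (InImage-neg⁻ h))
    (λ e y → negsq-NegSquare (λ { refl → y 0-InImage }) , (λ r → y (root⇒InImage r)))
    (λ { x (σ , r) → let e , e≢0 , h = NegSquare⇒negsq σ in
         e , (λ y → r (subst (λ x → HasRoot x 1# (- 1#)) h (InImage⇒root e≢0 y))) , h })
    NotInImages

  Π-3C-1 : PiIs 3C (Orbit ℓ₁) ((size ∸ 3) ℕ./ 6)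
  Π-3C-1 =
    let m , cnt , e = three-root-planes
        size∸3 = begin
          size ∸ 3            ≡⟨ cong (_∸ 3) size≡m₃*3 ⟩
          m₃ ℕ.* 3 ∸ 1 ℕ.* 3  ≡⟨ ℕ.*-distribʳ-∸ 3 m₃ 1 ⟨
          (m₃ ∸ 1) ℕ.* 3      ≡⟨ cong (ℕ._* 3) e ⟩
          m ℕ.* 2 ℕ.* 3       ≡⟨ ℕ.*-assoc m 2 3 ⟩
          m ℕ.* 6             ∎
    in Π-1 3C (subst (Count _) (sym (trans (cong (ℕ._/ 6) size∸3) (m*n/n≡m m 6))) cnt)
    where open ≡-Reasoning

  Π-0C-1 : PiIs 0C (Orbit ℓ₁) (size ℕ./ 3)
  Π-0C-1 =
    let m , cnt , e = rootless-planes
    in Π-1 0C (subst (Count _) (trans (ℕ.*-cancelʳ-≡ m m₃ 2 (trans (sym e) size∸m₃)) (sym size/3)) cnt)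

  -- Lines in a plane

  LineIn : V4 × V4 → V4 → V4 × V4 → Set
  LineIn ℓ c ℓ′ = RREF ℓ′ × Orbit ℓ ℓ′ × ContainsLine c ℓ′

  ContainsLine-exchange : ∀ {c x y ℓ} → Independent (x , y) → InSpan x ℓ → InSpan y ℓ → OnPlane x c → OnPlane y c →
      ContainsLine c ℓ
  ContainsLine-exchange {c} {x} {y} {u , v} ind x∈ y∈ hx hy =
    let u∈ , v∈ = exchange ind x∈ y∈ in
    OnPlane-span {c} {x , y} (hx , hy) u∈ , OnPlane-span {c} {x , y} (hx , hy) v∈

  orbit-matrix : ∀ {M} → InG M → ∀ {u v ℓ} → InSpan (apply M u) ℓ → InSpan (apply M v) ℓ → Orbit (u , v) ℓ
  orbit-matrix {M} g Mu Mv = M , g , Mu , Mv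

  -- T carries the plane `pull T c` onto the plane c and permutes the orbit. Images are brought back
  -- to echelon form, so lines are matched through spans.
  lines-in-image : ∀ {T ℓ c n} → InG T → Count (LineIn ℓ (pull T c)) n → Count (LineIn ℓ c) n
  lines-in-image {T} {ℓ} {c} g = count-↔ R fwd bwd fun inj
    where
    N : M4
    N = inv {T} g
    R : V4 × V4 → V4 × V4 → Set
    R (u , v) ℓ′ = InSpan (apply T u) ℓ′ × InSpan (apply T v) ℓ′
    back : ∀ {ℓ₁ ℓ₂} → RREF ℓ₁ → R ℓ₁ ℓ₂ → InSpan (apply N (proj₁ ℓ₂)) ℓ₁ × InSpan (apply N (proj₂ ℓ₂)) ℓ₁
    back {u , v} {ℓ₂} r (h , h′) = orbit-sym {u} {v} {ℓ₂} (rref-independent r) (T , g , h , h′)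
    fwd : ∀ ℓ₁ → LineIn ℓ (pull T c) ℓ₁ → ∃[ ℓ₂ ] LineIn ℓ c ℓ₂ × R ℓ₁ ℓ₂
    fwd (u , v) (r , O , hu , hv) =
      let ind = independent-image {T} g (rref-independent r)
          ℓ₂ , r₂ , Tu , Tv = rref-exists ind
      in ℓ₂ , (r₂ , orbit-trans {ℓ} {u , v} {ℓ₂} O (T , g , Tu , Tv) ,
               ContainsLine-exchange {c} {apply T u} {apply T v} {ℓ₂} ind Tu Tv
                 (trans (sym (dot-pull T c u)) hu) (trans (sym (dot-pull T c v)) hv)) , Tu , Tv
    bwd : ∀ ℓ₂ → LineIn ℓ c ℓ₂ → ∃[ ℓ₁ ] LineIn ℓ (pull T c) ℓ₁ × R ℓ₁ ℓ₂
    bwd (u , v) (r , O , h) =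
      let ind = independent-image {N} (inv-InG {T} g) (rref-independent r)
          ℓ₁ , r₁ , Nu , Nv = rref-exists ind
          Tu , Tv = orbit-sym {u} {v} {ℓ₁} (rref-independent r) (N , inv-InG {T} g , Nu , Nv)
      in ℓ₁ , (r₁ , orbit-trans {ℓ} {u , v} {ℓ₁} O (N , inv-InG {T} g , Nu , Nv) ,
               pull-ContainsLine T {c} {proj₁ ℓ₁} {proj₂ ℓ₁} {u , v} Tu Tv h) , Tu , Tv
    fun : ∀ {ℓ₁ ℓ₂ ℓ₃} → LineIn ℓ (pull T c) ℓ₁ → LineIn ℓ c ℓ₂ → LineIn ℓ c ℓ₃ → R ℓ₁ ℓ₂ → R ℓ₁ ℓ₃ → ℓ₂ ≡ ℓ₃
    fun (r , _) (r₂ , _) (r₃ , _) (a , b) (a′ , b′) =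
      rref-unique (independent-image {T} g (rref-independent r)) r₂ r₃ a b a′ b′
    inj : ∀ {ℓ₁ ℓ₂ ℓ₃} → LineIn ℓ (pull T c) ℓ₁ → LineIn ℓ (pull T c) ℓ₂ → LineIn ℓ c ℓ₃ → R ℓ₁ ℓ₃ → R ℓ₂ ℓ₃ → ℓ₁ ≡ ℓ₂
    inj {ℓ₁} {ℓ₂} {ℓ₃} (r₁ , _) (r₂ , _) (r₃ , _) h h′ =
      let a , b = back {ℓ₁} {ℓ₃} r₁ h
          a′ , b′ = back {ℓ₂} {ℓ₃} r₂ h′
      in rref-unique (independent-image {N} (inv-InG {T} g) (rref-independent r₃)) r₁ r₂ a b a′ b′

  idM-InG : InG idM
  idM-InG = InG-intro {idM} idM idM² idM² (λ t → t , ∼-reflexive (apply-idM (P t)))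
    where
    idM² : ∀ x → apply idM (apply idM x) ≡ x
    idM² x = trans (apply-idM (apply idM x)) (apply-idM x)

  -- For c₁ ≠ 0 the plane contains (0, - s, 1, 0) with s = c₂/c₁, which is the image of `e₁` under
  -- `turn s`.
  turn-meets-axis : ∀ {c} → ∃[ T ] InG T × OnPlane e₁ (pull T c)
  turn-meets-axis {c₀ ∷ c₁ ∷ c₂ ∷ c₃ ∷ []} with c₁ ≟ 0#
  ... | yes refl = idM , idM-InG ,
      trans (dot-pull idM (vec c₀ 0# c₂ c₃) e₁) (trans (cong (dot (vec c₀ 0# c₂ c₃)) (apply-idM e₁))
        (trans (dot-axis c₀ 0# c₂ c₃ 1# 0#) (solve 1 (λ c → con o :* con i :+ c :* con o := con o) refl c₂)))
  ... | no c₁≢0 with inverse c₁ c₁≢0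
  ... | a , ca = turn (c₂ * a) , turn-InG (c₂ * a) ,
      trans (dot-pull (turn (c₂ * a)) (vec c₀ c₁ c₂ c₃) e₁)
        (trans (cong (dot (vec c₀ c₁ c₂ c₃)) (turn-axis (c₂ * a) 1# 0#))
          (trans (dot-axis c₀ c₁ c₂ c₃ (0# + - (c₂ * a * 1#)) 1#)
            (modulo (- c₂) ca
                (solve 3 (λ c₁ c₂ a → c₁ :* (con o :+ :- (c₂ :* a :* con i)) :+ c₂ :* con i
                    := con o :+ :- c₂ :* (c₁ :* a :+ :- con i)) refl c₁ c₂ a))))

  lines-in-e₁-planes : ∀ {ℓ n} π → (∀ c₀ c₂ c₃ → ¬ c₂ ≡ 0# → Shape π c₀ c₂ c₃ → Count (LineIn ℓ (vec c₀ 0# c₂ c₃)) n) →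
      LamIs (Orbit ℓ) π n
  lines-in-e₁-planes {ℓ} {n} π core c nc τ = go (turn-meets-axis {c})
    where
    go : ∃[ T ] InG T × OnPlane e₁ (pull T c) → Count (LineIn ℓ c) n
    go (T , g , on) = lines-in-image {T} {ℓ} {c} g (normal τ′ (e₁-plane {pull T c} (pull-nonzero {T} g c≢0) π τ′ on))
      where
      c≢0 : ¬ c ≡ zeroV
      c≢0 = normalized-nonzero nc
      τ′ : HasType π (pull T c)
      τ′ = hasType-pull {T} g {c} c≢0 π τ
      normal : ∀ {c′} → HasType π c′ → (∃[ c₀ ] ∃[ c₂ ] ∃[ c₃ ] (¬ c₂ ≡ 0#) × c′ ≡ vec c₀ 0# c₂ c₃) → Count (LineIn ℓ c′) n
      normal τ (c₀ , c₂ , c₃ , c₂≢0 , refl) = core c₀ c₂ c₃ c₂≢0 (type⇒shape c₂≢0 π τ)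

  InSpan-unscale : ∀ {a x ℓ} → ¬ a ≡ 0# → InSpan (a · x) ℓ → InSpan x ℓ
  InSpan-unscale {a} {x} {ℓ} a≢0 h with inverse a a≢0
  ... | b , ab = subst (λ z → InSpan z ℓ)
      (trans (·-assoc b a x) (trans (cong (_· x) (trans (*-comm b a) ab)) (·-identity x))) (InSpan-· b h)

  affine-e₁ : ∀ d k s → apply (affine d k s) e₁ ≡ (d * (k * k)) · e₁
  affine-e₁ d k s = trans (affine-axis d k s 1# 0#) (vec-cong (sym (zeroʳ (d * (k * k))))
    (solve 3 (λ d k s → d :* (k :* k :* con i :+ :- (k :* s) :* con o) := d :* (k :* k) :* con i) refl d k s)
    (solve 2 (λ d k → d :* (k :* con o) := d :* (k :* k) :* con o) refl d k) (sym (zeroʳ (d * (k * k)))))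

  AffineImage : V4 → V4 × V4 → Set
  AffineImage v ℓ = ∃[ d ] ∃[ k ] ∃[ s ] (¬ d ≡ 0#) × (¬ k ≡ 0#) × InSpan e₁ ℓ × InSpan (apply (affine d k s) v) ℓ

  -- A plane meeting the axis in e₁ only contains lines that come from a matrix fixing e₁,
  -- that is, fixing P(∞).
  affine-orbit : ∀ {c₀ c₂ c₃ v ℓ} → ¬ c₂ ≡ 0# → Orbit (e₁ , v) ℓ → ContainsLine (vec c₀ 0# c₂ c₃) ℓ → AffineImage v ℓ
  affine-orbit {c₀} {c₂} {c₃} {v} {ℓ} c₂≢0 (M , g , Me₁ , Mv) h = go (proj₂ g nothing)
    where
    fixed : apply M (P nothing) ∼ P nothing → AffineImage v ℓ
    fixed e =
      let d , k , s , d≢0 , k≢0 , M≡ = fixes-∞⇒affine {M} g e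
          e₁∈ = subst (λ L → InSpan (apply L e₁) ℓ) M≡ Me₁
      in d , k , s , d≢0 , k≢0 ,
         InSpan-unscale {d * (k * k)} {e₁} {ℓ} (*-nonzero d≢0 (*-nonzero k≢0 k≢0)) (subst (λ x → InSpan x ℓ) (affine-e₁ d k s) e₁∈) ,
         subst (λ L → InSpan (apply L v) ℓ) M≡ Mv
    -- If P(∞) went to P(s), the line would contain a multiple of (0, - s, 1, 0), but this axis
    -- point is off the plane because c₂ ≠ 0.
    moved : ∀ s d → ¬ d ≡ 0# → ¬ apply M e₁ ≡ onAxis (- (s * d)) d
    moved s d d≢0 e = *-nonzero c₂≢0 d≢0 (begin
      c₂ * d                                              ≡⟨ solve 3 (λ c s d → c :* d
          := con o :* :- (s :* d) :+ c :* d) refl c₂ s d ⟩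
      0# * - (s * d) + c₂ * d                             ≡⟨ dot-axis c₀ 0# c₂ c₃ (- (s * d)) d ⟨
      dot (vec c₀ 0# c₂ c₃) (onAxis (- (s * d)) d)        ≡⟨ cong (dot (vec c₀ 0# c₂ c₃)) e ⟨
      dot (vec c₀ 0# c₂ c₃) (apply M e₁)                  ≡⟨ OnPlane-span {vec c₀ 0# c₂ c₃} {ℓ} {apply M e₁} h Me₁ ⟩
      0#                                                  ∎)
      where open ≡-Reasoning
    go : (∃[ s ] apply M (P nothing) ∼ P s) → AffineImage v ℓ
    go (nothing , e) = fixed e
    go (just s , e) = let d , d≢0 , Me₁≡ = moves-∞⇒e₁ {M} g s e in ⊥-elim (moved s d d≢0 Me₁≡)

  e₁-on : ∀ c₀ c₂ c₃ → OnPlane e₁ (vec c₀ 0# c₂ c₃)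
  e₁-on = solve 3 (λ c₀ c₂ c₃ → c₀ :* con o :+ con o :* con i :+ c₂ :* con o :+ c₃ :* con o := con o) refl

  -- On a line through `e₁` the second coordinate can be changed freely, so the line is determined
  -- by its projection from `e₁`.
  InSpan-drop : ∀ {x y z w ℓ} → InSpan e₁ ℓ → InSpan (vec x y z w) ℓ → InSpan (vec x 0# z w) ℓ
  InSpan-drop {x} {y} {z} {w} {ℓ} h h′ = subst (λ u → InSpan u ℓ) (vec-cong (s x)
    (solve 1 (λ y → con i :* y :+ :- y :* con i := con o) refl y) (s z) (s w)) (InSpan-lin 1# (- y) h′ h)
    where
    s : ∀ p → 1# * p + - y * 0# ≡ p
    s = solve 2 (λ y p → con i :* p :+ :- y :* con o := p) refl y

  InSpan-add : ∀ {x y z w ℓ} → InSpan e₁ ℓ → InSpan (vec x 0# z w) ℓ → InSpan (vec x y z w) ℓ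
  InSpan-add {x} {y} {z} {w} {ℓ} h h′ = subst (λ u → InSpan u ℓ) (vec-cong (s x)
    (solve 1 (λ y → con i :* con o :+ y :* con i := y) refl y) (s z) (s w)) (InSpan-lin 1# y h′ h)
    where
    s : ∀ p → 1# * p + y * 0# ≡ p
    s = solve 2 (λ y p → con i :* p :+ y :* con o := p) refl y

  -- Orbit lines in a plane that meets the axis in `e₁`

  module Lines (c₀ c₂ c₃ : F) (c₂≢0 : ¬ c₂ ≡ 0#) where
    c : V4
    c = vec c₀ 0# c₂ c₃

    private
      a : F
      a = proj₁ (inverse c₂ c₂≢0)

      c₂a : c₂ * a ≡ 1#
      c₂a = proj₂ (inverse c₂ c₂≢0)

    -- The point of the plane over (1 , z , 0) in the projection from e₁.
    z : F
    z = - (c₀ * a)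

    w : V4
    w = vec 1# 0# z 0#

    w-on : OnPlane w c
    w-on = modulo (- c₀) c₂a (solve 4 (λ c₀ c₂ c₃ a → c₀ :* con i :+ con o :* con o :+ c₂ :* :- (c₀ :* a) :+ c₃ :* con o
      := con o :+ :- c₀ :* (c₂ :* a :+ :- con i)) refl c₀ c₂ c₃ a)

    module _ (b : F) where
      v : V4
      v = vec 1# 0# b 0#

      affine-v : ∀ d k s → apply (affine d k s) v ≡ vec (d * cube k) (- (d * (k * s * b))) (d * (k * b)) 0#
      affine-v d k s = trans (apply-affine d k s v) (vec-cong
        (solve 3 (λ d k s → d :* (k :* k :* k :* con i :+ s :* s :* s :* con o) := d :* (k :* k :* k)) refl d k s)
        (solve 4 (λ d k s b → d :* (k :* k :* con o :+ :- (k :* s) :* b :+ s :* s :* con o)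
            := :- (d :* (k :* s :* b))) refl d k s b)
        (solve 4 (λ d k s b → d :* (k :* b :+ s :* con o) := d :* (k :* b)) refl d k s b)
        (zeroʳ d))

      b≡zk² : ∀ {k} → c₀ * (k * k) + c₂ * b ≡ 0# → b ≡ z * (k * k)
      b≡zk² {k} h = modulo₂ a (- b) h c₂a (solve 5 (λ c₀ c₂ k a b → b := :- (c₀ :* a) :* (k :* k)
        :+ a :* (c₀ :* (k :* k) :+ c₂ :* b :+ :- con o) :+ :- b :* (c₂ :* a :+ :- con i)) refl c₀ c₂ k a b)

      image-scaled : ∀ d k → c₀ * (k * k) + c₂ * b ≡ 0# → vec (d * cube k) 0# (d * (k * b)) 0# ≡ (d * cube k) · w
      image-scaled d k h = vec-cong (sym (*-identityʳ (d * cube k))) (sym (zeroʳ (d * cube k)))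
        (trans (cong (λ b → d * (k * b)) (b≡zk² h))
            (solve 3 (λ d k z → d :* (k :* (z :* (k :* k))) := d :* (k :* k :* k) :* z) refl d k z))
        (sym (zeroʳ (d * cube k)))

      -- Incidence forces c₀ k² + c₂ b = 0, and the image of `v` is then, modulo `e₁`, a multiple of
      -- `w`, which depends on the plane alone.
      line-data : ∀ {ℓ} → LineIn (e₁ , v) c ℓ → ∃[ k ] c₀ * (k * k) + c₂ * b ≡ 0# × InSpan e₁ ℓ × InSpan w ℓ
      line-data {ℓ} (_ , O , h) = go (affine-orbit {c₀} {c₂} {c₃} {v} {ℓ} c₂≢0 O h)
        where
        go : AffineImage v ℓ → ∃[ k ] c₀ * (k * k) + c₂ * b ≡ 0# × InSpan e₁ ℓ × InSpan w ℓ
        go (d , k , s , d≢0 , k≢0 , e₁∈ , v∈) = k , period , e₁∈ ,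
          InSpan-unscale {d * cube k} {w} {ℓ} (*-nonzero d≢0 (λ h → k≢0 (cube-zero h))) (subst (λ x → InSpan x ℓ) (image-scaled d k period) x∈)
          where
          x∈ : InSpan (vec (d * cube k) 0# (d * (k * b)) 0#) ℓ
          x∈ = InSpan-drop {ℓ = ℓ} e₁∈ (subst (λ x → InSpan x ℓ) (affine-v d k s) v∈)
          period : c₀ * (k * k) + c₂ * b ≡ 0#
          -- The product of the plane with the image point factors as d k (c₀ k² + c₂ b).
          period = *-cancel-0 (*-nonzero d≢0 k≢0) (trans (solve 6 (λ c₀ c₂ c₃ d k b → d :* k :* (c₀ :* (k :* k) :+ c₂ :* b)
            := c₀ :* (d :* (k :* k :* k)) :+ con o :* con o :+ c₂ :* (d :* (k :* b)) :+ c₃ :* con o)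
                refl c₀ c₂ c₃ d k b) (OnPlane-span {c} {ℓ} h x∈))

      no-line : (∀ k → ¬ c₀ * (k * k) + c₂ * b ≡ 0#) → Count (LineIn (e₁ , v) c) 0
      no-line none = count-none λ ℓ h → let k , e , _ = line-data {ℓ} h in none k e

      -- Whatever k and s are, the line joins `e₁` to `w`; a single solution k therefore yields
      -- exactly one line.
      one-line : ¬ b ≡ 0# → (∃[ k ] c₀ * (k * k) + c₂ * b ≡ 0#) → Count (LineIn (e₁ , v) c) 1
      one-line b≢0 (k , e) = go (rref-exists (independent-b z))
        where
        k≢0 : ¬ k ≡ 0#
        k≢0 refl = *-nonzero c₂≢0 b≢0 (trans
            (solve 3 (λ c₀ c₂ b → c₂ :* b := c₀ :* (con o :* con o) :+ c₂ :* b) refl c₀ c₂ b) e)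
        go : ∃[ ℓ ] RREF ℓ × InSpan e₁ ℓ × InSpan w ℓ → Count (LineIn (e₁ , v) c) 1
        go (ℓ , r , e₁∈ , w∈) = count-one ℓ
          (r , orbit-matrix {affine 1# k 0#} (affine-InG {k} 0# k≢0) {e₁} {v} {ℓ}
                 -- The parameter s affects only the second coordinate of the image of `v`, so s = 0
                 -- may be chosen.
                 (subst (λ x → InSpan x ℓ) (sym (affine-e₁ 1# k 0#)) (InSpan-· {ℓ = ℓ} (1# * (k * k)) e₁∈))
                 (subst (λ x → InSpan x ℓ) (sym (affine-v 1# k 0#)) (InSpan-add {ℓ = ℓ} e₁∈
                   (subst (λ x → InSpan x ℓ) (sym (image-scaled 1# k e)) (InSpan-· {ℓ = ℓ} (1# * cube k) w∈)))) ,
           ContainsLine-exchange {c} {e₁} {w} {ℓ} (independent-b z) e₁∈ w∈ (e₁-on c₀ c₂ c₃) w-on)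
          (λ ℓ′ h → let _ , _ , e₁∈′ , w∈′ = line-data {ℓ′} h in rref-unique (independent-b z) (proj₁ h) r e₁∈′ w∈′ e₁∈ w∈)

    -- Third coordinate of the plane's point with first coordinate s³, second 0 and last 1. It
    -- equals s exactly when s is a root of the cubic polynomial.
    height : F → F
    height s = - ((c₀ * cube s + c₃) * a)

    q : F → V4
    q s = vec (cube s) 0# (height s) 1#

    q-on : ∀ s → OnPlane (q s) c
    q-on s = modulo (- (c₀ * cube s + c₃)) c₂a
        (solve 5 (λ c₀ c₂ c₃ a s → c₀ :* (s :* s :* s) :+ con o :* con o :+ c₂ :* :- ((c₀ :* (s :* s :* s) :+ c₃) :* a) :+ c₃ :* con i
      := con o :+ :- (c₀ :* (s :* s :* s) :+ c₃) :* (c₂ :* a :+ :- con i)) refl c₀ c₂ c₃ a s)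

    independent-q : ∀ s → Independent (e₁ , q s)
    independent-q s x y h =
      let _ , h₁ , _ , h₃ = vec-injective h in
      trans (solve 2 (λ x y → x := x :* con i :+ y :* con o) refl x y) h₁ ,
      trans (solve 2 (λ x y → y := x :* con o :+ y :* con i) refl x y) h₃

    height-unique : ∀ {s y} → c₀ * cube s + c₂ * y + c₃ ≡ 0# → y ≡ height s
    height-unique {s} {y} h = modulo₂ a (- y) h c₂a (solve 6 (λ c₀ c₂ c₃ a s y → y := :- ((c₀ :* (s :* s :* s) :+ c₃) :* a)
      :+ a :* (c₀ :* (s :* s :* s) :+ c₂ :* y :+ c₃ :+ :- con o) :+ :- y :* (c₂ :* a :+ :- con i)) refl c₀ c₂ c₃ a s y)

    v₁ : V4
    v₁ = vec 0# 0# 1# 1#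

    affine-v₁ : ∀ d k s → apply (affine d k s) v₁ ≡ d · vec (cube s) (s * s + - (k * s)) (k + s) 1#
    affine-v₁ d k s = trans (apply-affine d k s v₁) (vec-cong
      (solve 3 (λ d k s → d :* (k :* k :* k :* con o :+ s :* s :* s :* con i) := d :* (s :* s :* s)) refl d k s)
      (solve 3 (λ d k s → d :* (k :* k :* con o :+ :- (k :* s) :* con i :+ s :* s :* con i)
          := d :* (s :* s :+ :- (k :* s))) refl d k s)
      (solve 3 (λ d k s → d :* (k :* con i :+ s :* con i) := d :* (k :+ s)) refl d k s)
      refl)

    RootFree : F → Set
    RootFree s = ¬ cubic c₀ c₂ c₃ s ≡ 0#

    -- Up to scalars (0, 0, 1, 1) goes to a point with first coordinate s³, third k + s and last 1.
    -- Incidence gives k = `height s` - s, and k ≠ 0 excludes exactly the roots. As s³ determines s,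
    -- lines correspond to non-roots.
    lines-ℓ₁ : ∀ {n} → Count RootFree n → Count (LineIn ℓ₁ c) n
    lines-ℓ₁ = count-↔ R fwd bwd fun inj
      where
      R : F → V4 × V4 → Set
      R s ℓ = InSpan e₁ ℓ × InSpan (q s) ℓ
      fwd : ∀ s → RootFree s → ∃[ ℓ ] LineIn ℓ₁ c ℓ × R s ℓ
      fwd s s∉ = go (rref-exists (independent-q s))
        where
        k : F
        k = height s + - s
        k≢0 : ¬ k ≡ 0#
        k≢0 h = s∉ (modulo₂ (- c₂) (- (c₀ * cube s + c₃)) h c₂a
            (solve 5 (λ c₀ c₂ c₃ a s → c₀ :* (s :* s :* s) :+ c₂ :* s :+ c₃
          := con o :+ :- c₂ :* (:- ((c₀ :* (s :* s :* s) :+ c₃) :* a) :+ :- s :+ :- con o)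
             :+ :- (c₀ :* (s :* s :* s) :+ c₃) :* (c₂ :* a :+ :- con i)) refl c₀ c₂ c₃ a s))
        k+s : k + s ≡ height s
        k+s = solve 2 (λ h s → h :+ :- s :+ s := h) refl (height s) s
        go : ∃[ ℓ ] RREF ℓ × InSpan e₁ ℓ × InSpan (q s) ℓ → ∃[ ℓ ] LineIn ℓ₁ c ℓ × R s ℓ
        go (ℓ , r , e₁∈ , q∈) = ℓ ,
          (r , orbit-matrix {affine 1# k s} (affine-InG {k} s k≢0) {e₁} {v₁} {ℓ}
                 (subst (λ x → InSpan x ℓ) (sym (affine-e₁ 1# k s)) (InSpan-· {ℓ = ℓ} (1# * (k * k)) e₁∈))
                 (subst (λ x → InSpan x ℓ) (sym (affine-v₁ 1# k s)) (InSpan-· {ℓ = ℓ} 1#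
                   (InSpan-add {ℓ = ℓ} e₁∈ (subst (λ y → InSpan (vec (cube s) 0# y 1#) ℓ) (sym k+s) q∈)))) ,
           ContainsLine-exchange {c} {e₁} {q s} {ℓ} (independent-q s) e₁∈ q∈ (e₁-on c₀ c₂ c₃) (q-on s)) ,
          e₁∈ , q∈
      bwd : ∀ ℓ → LineIn ℓ₁ c ℓ → ∃[ s ] RootFree s × R s ℓ
      bwd ℓ (_ , O , h) = go (affine-orbit {c₀} {c₂} {c₃} {v₁} {ℓ} c₂≢0 O h)
        where
        go : AffineImage v₁ ℓ → ∃[ s ] RootFree s × R s ℓ
        go (d , k , s , d≢0 , k≢0 , e₁∈ , v∈) = s , root-free , e₁∈ ,
          subst (λ y → InSpan (vec (cube s) 0# y 1#) ℓ) (height-unique on) x∈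
          where
          x∈ : InSpan (vec (cube s) 0# (k + s) 1#) ℓ
          x∈ = InSpan-drop {ℓ = ℓ} e₁∈ (InSpan-unscale {d} {vec (cube s) (s * s + - (k * s)) (k + s) 1#} {ℓ} d≢0
            (subst (λ x → InSpan x ℓ) (affine-v₁ d k s) v∈))
          on : c₀ * cube s + c₂ * (k + s) + c₃ ≡ 0#
          on = trans (solve 5 (λ c₀ c₂ c₃ s y → c₀ :* (s :* s :* s) :+ c₂ :* y :+ c₃
            := c₀ :* (s :* s :* s) :+ con o :* con o :+ c₂ :* y :+ c₃ :* con i)
                refl c₀ c₂ c₃ s (k + s)) (OnPlane-span {c} {ℓ} h x∈)
          root-free : RootFree s
          root-free e = *-nonzero c₂≢0 k≢0 (modulo₂ 1# (- 1#) on e (solve 5 (λ c₀ c₂ c₃ s k → c₂ :* k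
            := con o :+ con i :* (c₀ :* (s :* s :* s) :+ c₂ :* (k :+ s) :+ c₃ :+ :- con o)
               :+ :- con i :* (c₀ :* (s :* s :* s) :+ c₂ :* s :+ c₃ :+ :- con o)) refl c₀ c₂ c₃ s k))
      fun : ∀ {s ℓ ℓ′} → RootFree s → LineIn ℓ₁ c ℓ → LineIn ℓ₁ c ℓ′ → R s ℓ → R s ℓ′ → ℓ ≡ ℓ′
      fun {s} _ (r , _) (r′ , _) (x , y) (x′ , y′) = rref-unique (independent-q s) r r′ x y x′ y′
      inj : ∀ {s s′ ℓ} → RootFree s → RootFree s′ → LineIn ℓ₁ c ℓ → R s ℓ → R s′ ℓ → s ≡ s′
      inj {s} {s′} {ℓ} _ _ _ (e₁∈ , q∈) (_ , q′∈) =
        let u∈ , v∈ = exchange (independent-q s) e₁∈ q∈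
            x , y , e = InSpan-trans q′∈ u∈ v∈
            h₀ , _ , _ , h₃ = vec-injective e
            y≡1 = trans (solve 2 (λ x y → y := x :* con o :+ y :* con i) refl x y) (sym h₃)
        -- Comparing last coordinates gives `q s` the coefficient 1, and the first coordinates then
        -- give equal cubes.
        in cube-injective {s} {s′} (sym (trans h₀ (trans (cong (λ y → x * 0# + y * cube s) y≡1)
             (solve 2 (λ x t → x :* con o :+ con i :* t := t) refl x (cube s)))))

  open Lines using (one-line; no-line; lines-ℓ₁)

  -- The numbers of lines of each orbit in a plane

  root-free-count : ∀ {c₀ c₂ c₃ r} → Count (λ t → cubic c₀ c₂ c₃ t ≡ 0#) r → Count (λ s → ¬ cubic c₀ c₂ c₃ s ≡ 0#) (size ∸ r)
  root-free-count {c₀} {c₂} {c₃} cnt = count-cong (λ _ → proj₂) (λ _ h → tt , h)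
    (count-complement finite (count-cong (λ _ h → tt , h) (λ _ → proj₂) cnt) (λ t → cubic c₀ c₂ c₃ t ≟ 0#))

  -- Only one of the two points of the plane on the cubic is affine; the other, P(∞), excludes no
  -- parameter s.
  Λ-1-2C : LamIs (Orbit ℓ₁) 2C (size ∸ 1)
  Λ-1-2C = lines-in-e₁-planes {ℓ₁} 2C λ { c₀ c₂ c₃ c₂≢0 refl → lines-ℓ₁ c₀ c₂ c₃ c₂≢0 (root-free-count {c₀} {c₂} {c₃} (one-root (linear-aperiodic c₂≢0))) }

  Λ-1-1̄C : LamIs (Orbit ℓ₁) 1̄C (size ∸ 1)
  Λ-1-1̄C = lines-in-e₁-planes {ℓ₁} 1̄C λ c₀ c₂ c₃ c₂≢0 (_ , aperiodic) → lines-ℓ₁ c₀ c₂ c₃ c₂≢0 (root-free-count {c₀} {c₂} {c₃} (one-root aperiodic))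

  Λ-1-3C : LamIs (Orbit ℓ₁) 3C (size ∸ 3)
  Λ-1-3C = lines-in-e₁-planes {ℓ₁} 3C λ c₀ c₂ c₃ c₂≢0 (d , r) → lines-ℓ₁ c₀ c₂ c₃ c₂≢0 (root-free-count {c₀} {c₂} {c₃} (three-roots c₂≢0 d r))

  Λ-1-0C : LamIs (Orbit ℓ₁) 0C size
  Λ-1-0C = lines-in-e₁-planes {ℓ₁} 0C λ c₀ c₂ c₃ c₂≢0 (_ , rootless) → lines-ℓ₁ c₀ c₂ c₃ c₂≢0 (root-free-count {c₀} {c₂} {c₃} (count-none λ t e → rootless (t , e)))

  periodic-1 : ∀ {c₀ c₂} → HasPeriod c₀ c₂ → ∃[ k ] c₀ * (k * k) + c₂ * 1# ≡ 0#
  periodic-1 {c₀} {c₂} (d , e) = d , trans (cong (c₀ * (d * d) +_) (*-identityʳ c₂)) e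

  aperiodic-1 : ∀ {c₀ c₂} → ¬ HasPeriod c₀ c₂ → ∀ k → ¬ c₀ * (k * k) + c₂ * 1# ≡ 0#
  aperiodic-1 {c₀} {c₂} h k e = h (k , trans (cong (c₀ * (k * k) +_) (sym (*-identityʳ c₂))) e)

  Λ-2-3C : LamIs (Orbit ℓ₂) 3C 1
  Λ-2-3C = lines-in-e₁-planes {ℓ₂} 3C λ c₀ c₂ c₃ c₂≢0 (d , _) → one-line c₀ c₂ c₃ c₂≢0 1# 1≢0 (periodic-1 d)

  Λ-2-0C : LamIs (Orbit ℓ₂) 0C 1
  Λ-2-0C = lines-in-e₁-planes {ℓ₂} 0C λ c₀ c₂ c₃ c₂≢0 (d , _) → one-line c₀ c₂ c₃ c₂≢0 1# 1≢0 (periodic-1 d)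

  Λ-2-2C : LamIs (Orbit ℓ₂) 2C 0
  Λ-2-2C = lines-in-e₁-planes {ℓ₂} 2C λ { c₀ c₂ c₃ c₂≢0 refl → no-line c₀ c₂ c₃ c₂≢0 1# (aperiodic-1 (linear-aperiodic c₂≢0)) }

  Λ-2-1̄C : LamIs (Orbit ℓ₂) 1̄C 0
  Λ-2-1̄C = lines-in-e₁-planes {ℓ₂} 1̄C λ c₀ c₂ c₃ c₂≢0 (_ , aperiodic) → no-line c₀ c₂ c₃ c₂≢0 1# (aperiodic-1 aperiodic)

  module _ {ρ : F} (nonsquare : NonSquare ρ) where
    -- A period d and a solution k together give k² = ρ d², so ρ would be the square of k/d.
    aperiodic-ρ : ∀ {c₀ c₂} → ¬ c₂ ≡ 0# → HasPeriod c₀ c₂ → ∀ k → ¬ c₀ * (k * k) + c₂ * ρ ≡ 0#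
    aperiodic-ρ {c₀} {c₂} c₂≢0 (d , hd) k hk = go (inverse d d≢0)
      where
      c₀≢0 : ¬ c₀ ≡ 0#
      c₀≢0 = period⇒≢0 c₂≢0 (d , hd)
      d≢0 : ¬ d ≡ 0#
      d≢0 refl = c₂≢0 (trans (solve 2 (λ c₀ c₂ → c₂ := c₀ :* (con o :* con o) :+ c₂) refl c₀ c₂) hd)
      k²≡ρd² : k * k ≡ ρ * (d * d)
      k²≡ρd² = difference-zero (*-cancel-0 c₀≢0 (modulo₂ 1# (- ρ) hk hd
          (solve 5 (λ c₀ c₂ k d r → c₀ :* (k :* k :+ :- (r :* (d :* d)))
        := con o :+ con i :* (c₀ :* (k :* k) :+ c₂ :* r :+ :- con o) :+ :- r :* (c₀ :* (d :* d) :+ c₂ :+ :- con o))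
            refl c₀ c₂ k d ρ)))
      go : ¬ (∃[ t ] d * t ≡ 1#)
      go (t , dt) = nonsquare (k * t) (modulo₂ (t * t) (ρ * (d * t + 1#)) k²≡ρd² dt
        (solve 4 (λ r d k t → k :* t :* (k :* t)
            := r :+ t :* t :* (k :* k :+ :- (r :* (d :* d))) :+ r :* (d :* t :+ con i) :* (d :* t :+ :- con i))
                refl ρ d k t))

    -- Without a period c₀/c₂ is not the negative of a square, so it equals ρ x with x d² = - 1 for
    -- some d, and this d solves the equation.
    periodic-ρ : ∀ {c₀ c₂} → ¬ c₂ ≡ 0# → ¬ c₀ ≡ 0# → ¬ HasPeriod c₀ c₂ → ∃[ k ] c₀ * (k * k) + c₂ * ρ ≡ 0#
    periodic-ρ {c₀} {c₂} c₂≢0 c₀≢0 aperiodic = go (inverse c₂ c₂≢0)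
      where
      go : ∃[ a ] c₂ * a ≡ 1# → ∃[ k ] c₀ * (k * k) + c₂ * ρ ≡ 0#
      go (a , ca) = finish (nonsquare-coset nonsquare (*-nonzero c₀≢0 (nonzeroʳ ca 1≢0)) not-neg-square)
        where
        not-neg-square : ¬ NegSquare (c₀ * a)
        not-neg-square (d , h) = aperiodic (d , modulo₂ c₂ (- (c₀ * (d * d))) h ca
            (solve 4 (λ c₀ c₂ a d → c₀ :* (d :* d) :+ c₂
          := con o :+ c₂ :* (c₀ :* a :* (d :* d) :+ con i :+ :- con o) :+ :- (c₀ :* (d :* d)) :* (c₂ :* a :+ :- con i))
              refl c₀ c₂ a d))
        finish : (∃[ x ] NegSquare x × ρ * x ≡ c₀ * a) → ∃[ k ] c₀ * (k * k) + c₂ * ρ ≡ 0#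
        finish (x , (d , hd) , h) = d , modulo (- (c₀ * (d * d))) ca (modulo₂ (c₂ * ρ) (- (c₂ * (d * d))) hd h
          (solve 6 (λ c₀ c₂ a d x r → c₀ :* (d :* d) :+ c₂ :* r := con o :+ :- (c₀ :* (d :* d)) :* (c₂ :* a :+ :- con i)
            :+ c₂ :* r :* (x :* (d :* d) :+ con i :+ :- con o) :+ :- (c₂ :* (d :* d)) :* (r :* x :+ :- (c₀ :* a))) refl c₀ c₂ a d x ρ))

    Λ-3-1̄C : LamIs (Orbit (ℓ₃ ρ)) 1̄C 1
    Λ-3-1̄C = lines-in-e₁-planes {ℓ₃ ρ} 1̄C λ c₀ c₂ c₃ c₂≢0 (c₀≢0 , aperiodic) →
      one-line c₀ c₂ c₃ c₂≢0 ρ (ρ≢0 nonsquare) (periodic-ρ c₂≢0 c₀≢0 aperiodic)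

    Λ-3-2C : LamIs (Orbit (ℓ₃ ρ)) 2C 0
    Λ-3-2C = lines-in-e₁-planes {ℓ₃ ρ} 2C λ { c₀ c₂ c₃ c₂≢0 refl → no-line c₀ c₂ c₃ c₂≢0 ρ λ k e →
      linear-aperiodic (*-nonzero c₂≢0 (ρ≢0 nonsquare)) (k , e) }

    Λ-3-3C : LamIs (Orbit (ℓ₃ ρ)) 3C 0
    Λ-3-3C = lines-in-e₁-planes {ℓ₃ ρ} 3C λ c₀ c₂ c₃ c₂≢0 (d , _) → no-line c₀ c₂ c₃ c₂≢0 ρ (aperiodic-ρ c₂≢0 d)

    Λ-3-0C : LamIs (Orbit (ℓ₃ ρ)) 0C 0
    Λ-3-0C = lines-in-e₁-planes {ℓ₃ ρ} 0C λ c₀ c₂ c₃ c₂≢0 (d , _) → no-line c₀ c₂ c₃ c₂≢0 ρ (aperiodic-ρ c₂≢0 d)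

    claims : Claims (Orbit ℓ₁) (Orbit ℓ₂) (Orbit (ℓ₃ ρ))
    claims = record
      { Π-2C-1 = Π-2C-1 ; Λ-2-3C = Λ-2-3C ; Λ-2-0C = Λ-2-0C ; Λ-3-1̄C = Λ-3-1̄C ; Λ-1-2C = Λ-1-2C ; Λ-1-1̄C = Λ-1-1̄C
      ; Π-2C-2 = Π-2C-2 ; Λ-2-2C = Λ-2-2C ; Π-1̄C-2 = Π-1̄C-2 ; Λ-2-1̄C = Λ-2-1̄C
      ; Π-2C-3 = Π-2C-3 nonsquare ; Λ-3-2C = Λ-3-2C ; Π-3C-3 = Π-3C-3 nonsquare ; Λ-3-3C = Λ-3-3C
      ; Π-0C-3 = Π-0C-3 nonsquare ; Λ-3-0C = Λ-3-0C ; Π-1̄C-3 = Π-1̄C-3 nonsquare ; Λ-1-0C = Λ-1-0C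
      ; Π-3C-2 = Π-3C-2 ; Π-0C-1 = Π-0C-1 ; Π-0C-2 = Π-0C-2 ; Π-3C-1 = Π-3C-1 ; Λ-1-3C = Λ-1-3C ; Π-1̄C-1 = Π-1̄C-1 }

theorem7p7 : (K : FiniteField) → PowerOf3≥9 (FiniteField.size K) →
    FiniteField._+_ K (FiniteField._+_ K (FiniteField.1# K) (FiniteField.1# K)) (FiniteField.1# K) ≡ FiniteField.0# K →
    (ρ : FiniteField.F K) → Geometry.NonSquare K ρ →
    Geometry.Claims K (Geometry.Orbit K (Geometry.ℓ₁ K)) (Geometry.Orbit K (Geometry.ℓ₂ K)) (Geometry.Orbit K (Geometry.ℓ₃ K ρ))
    ⊎ Geometry.Claims K (Geometry.Orbit K (Geometry.ℓ₁ K)) (Geometry.Orbit K (Geometry.ℓ₃ K ρ)) (Geometry.Orbit K (Geometry.ℓ₂ K))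
-- The first labelling always holds: scaled to c₂ = 1, the planes of the four types through `ℓ₂`
-- have c₀ = - 1 and period 1, while those through `ℓ₃ ρ` have c₀ = - ρ and no period.
theorem7p7 K (h , 2≤h , size≡) 3≡0 ρ nonsquare = inj₁ (TwistedCubic.claims K 3≡0 7≤size nonsquare)
  where
  7≤size : 7 ≤ FiniteField.size K
  7≤size = subst (7 ≤_) (sym size≡) (ℕ.≤-trans (ℕ.m≤m+n 7 2) (ℕ.^-monoʳ-≤ 3 2≤h))
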